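{- Let $k\ge 0$, $\ell\ge 0$ and $n\ge 2$ be integers. For $\omega\in\mathfrak{B}_n$ chosen uniformly at random, with $\alpha=\alpha(\omega)$ and $\beta=\beta(\omega)$, $$\mathbb{E}\left[\alpha^k\beta^\ell\right]=\frac{k!\,\ell!}{2^{k+\ell}\,\mathfrak{b}_n}\left[t^{n+2}u^kv^\ell\right]\frac{\left(g_k\left(te^{(1-t)u}\right)-\mathbf{1}_{\{k=0\}}\right)^2\left(g_\ell\left(te^{(1-t)v}\right)-\mathbf{1}_{\{\ell=0\}}\right)^2}{(1-t)^{k+\ell}}.$$
   Context: $\mathfrak{S}_n$ is the set of permutations of $[n]=\{1,\dots,n\}$, in one-line notation. A reduction of $\omega\in\mathfrak{S}_n$ interchanges $\omega(i)$ and $\omega(j)$ for some $i<j$ with $\omega(i)>\omega(j)$. Bruhat order: $\pi\le\sigma$ if $\pi$ is obtained from $\sigma$ by a (possibly empty) sequence of reductions. $\mathfrak{B}_n\subseteq\mathfrak{S}_n$ is the set of bigrassmannian permutations, i.e. those $\omega$ such that both $\omega$ and $\omega^{ -1}$ have exactly one descent; equivalently $\omega=1\cdots a\,(b+1)\cdots c\,(a+1)\cdots b\,(c+1)\cdots n$ for some $0\le a<b<c\le n$. $\mathfrak{b}_n=|\mathfrak{B}_n|=\binom{n+1}{3}$. For $\omega\in\mathfrak{B}_n$, $\beta(\omega)$ is the number of $\pi\in\mathfrak{B}_n$ with $\pi\le\omega$, and $\alpha(\omega)$ is the number of $\tau\in\mathfrak{B}_n$ with $\omega\le\tau$. For $k\ge0$,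 $g_k(t)=\sum_{i\ge 0}i^kt^i$ with $0^0=1$, so that $g_k(te^{(1-t)u})=\sum_{i\ge0}i^kt^ie^{i(1-t)u}$ as a formal power series in $t,u$. $[t^{n+2}u^kv^\ell]G$ is the coefficient of $t^{n+2}u^kv^\ell$ in the formal power series $G$. $\mathbf{1}_{\{k=0\}}$ is $1$ if $k=0$ and $0$ otherwise. -}

module Defs where

open import Data.Fin.Base using (Fin; zero; suc; toℕ; _<_; punchIn)
open import Data.Fin.Patterns using (0F; 1F)
open import Data.Fin.Permutation using (Permutation′; _⟨$⟩ʳ_; _⟨$⟩ˡ_; _≈_; _∘ₚ_; flip; id; insert; remove; transpose; inverseˡ; inverseʳ; insert-punchIn; insert-remove)
open import Data.Fin.Properties using (_≟_; _<?_; any?; all?; punchIn-injective; <-cmp; <⇒≢)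
open import Data.Fin.Induction using (<-wellFounded)
open import Data.Integer.Base using (+_)
open import Data.List.Base using (List; []; _∷_; length; filter; map; allFin; cartesianProductWith)
open import Data.List.Membership.Propositional.Properties using (∈-allFin)
import Data.List.Membership.Setoid as Membership
import Data.List.Membership.Setoid.Properties as Membershipₚ
open import Data.List.Relation.Unary.All using ([])
open import Data.List.Relation.Unary.AllPairs using ([]; _∷_)
open import Data.List.Relation.Unary.Any using (here; there)
import Data.List.Relation.Unary.Enumerates.Setoid as Enumerates
import Data.List.Relation.Unary.Unique.Propositional.Properties as Uniqueₚ
import Data.List.Relation.Unary.Unique.Setoid as Unique
import Data.List.Relation.Unary.Unique.Setoid.Properties as UniqueSetoidₚ
open import Data.Nat.Base as ℕ using (ℕ; zero; suc; _+_; _*_; _∸_; _^_; _≤_; z≤n; s≤s; NonZero; _!)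
open import Data.Nat.ListAction using (sum)
open import Data.Nat.Properties as ℕ using (_!≢0; m*n≢0; m^n≢0)
open import Data.Product using (∃; ∃!; ∃-syntax; _×_; _,_; proj₁; proj₂)
open import Data.Rational.Base as ℚ using (ℚ; 0ℚ; 1ℚ; _/_)
open import Data.Rational.Properties using (+-0-commutativeMonoid)
open import Data.Sum.Base using (_⊎_; inj₁; inj₂)
open import Data.Vec.Base using (Vec; tabulate)
open import Data.Vec.Relation.Binary.Lex.Strict as Lex using (Lex-<; this; next)
open import Function.Base using (_∘_; _on_)
open import Induction.WellFounded using (WellFounded; Acc; acc)
open import Level using (0ℓ)
open import Relation.Binary.Bundles using (Setoid)
open import Relation.Binary.Construct.Closure.ReflexiveTransitive using (Star; ε; _◅_)
import Relation.Binary.Construct.On as On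
open import Relation.Binary.Definitions using (tri<; tri≈; tri>)
open import Relation.Binary.PropositionalEquality using (_≡_; _≢_; refl; sym; trans; cong; subst; subst₂; setoid; resp₂)
open import Relation.Nullary using (Dec; yes; no; ¬_; contradiction)
open import Relation.Nullary.Decidable using (map′; _×-dec_; _⊎-dec_; _→-dec_)
open import Algebra.Properties.CommutativeMonoid.Sum +-0-commutativeMonoid using (sum⁺-syntax)

------------------------------------------------------------------------
-- The symmetric group
--
-- [n] is modelled by Fin n, so that all positions and values are shifted
-- down by one.  Permutations are compared by the pointwise equality _≈_.

𝔖-setoid : ℕ → Setoid 0ℓ 0ℓ
𝔖-setoid n = record
  { Carrier       = Permutation′ n
  ; _≈_           = _≈_
  ; isEquivalence = record
    { refl  = λ _ → refl
    ; sym   = λ p i → sym (p i)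
    ; trans = λ p q i → trans (p i) (q i)
    }
  }

𝔖 : ∀ n → List (Permutation′ n)
𝔖 zero    = id ∷ []
𝔖 (suc n) = cartesianProductWith (insert 0F) (allFin (suc n)) (𝔖 n)

private
  insert-cong : ∀ {n} {j k} {π ρ : Permutation′ n} → j ≡ k → π ≈ ρ → insert 0F j π ≈ insert 0F k ρ
  insert-cong refl p zero    = refl
  insert-cong {j = j} refl p (suc i) = cong (punchIn j) (p i)

  insert-injective : ∀ {n} {j k} {π ρ : Permutation′ n} → insert 0F j π ≈ insert 0F k ρ → j ≡ k × π ≈ ρ
  insert-injective {j = j} {k} {π} {ρ} p with p 0F
  ... | refl = refl , λ i → punchIn-injective j _ _
    (trans (sym (insert-punchIn 0F j π i)) (trans (p (suc i)) (insert-punchIn 0F j ρ i)))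

𝔖-complete : ∀ n → Enumerates.IsEnumeration (𝔖-setoid n) (𝔖 n)
𝔖-complete zero    π = here λ ()
𝔖-complete (suc n) π = Membershipₚ.∈-resp-≈ (𝔖-setoid (suc n))
  {x = insert 0F (π ⟨$⟩ʳ 0F) (remove 0F π)} {π} (insert-remove 0F π)
  (Membershipₚ.∈-cartesianProductWith⁺ (setoid (Fin (suc n))) (𝔖-setoid n) (𝔖-setoid (suc n))
    (λ {_} {_} {π} {ρ} → insert-cong {π = π} {ρ})
    {b = remove 0F π} (∈-allFin (π ⟨$⟩ʳ 0F)) (𝔖-complete n (remove 0F π)))

𝔖-unique : ∀ n → Unique.Unique (𝔖-setoid n) (𝔖 n)
𝔖-unique zero    = [] ∷ []
𝔖-unique (suc n) = UniqueSetoidₚ.cartesianProductWith⁺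
  (setoid (Fin (suc n))) (𝔖-setoid n) (𝔖-setoid (suc n)) (insert 0F)
  (λ {j} {k} {π} {ρ} → insert-injective {π = π} {ρ})
  (Uniqueₚ.allFin⁺ (suc n)) (𝔖-unique n)

------------------------------------------------------------------------
-- The Bruhat order

infix 4 _⇝_ _≤ᴮ_ _≤ᴮ?_

-- transpose i j ∘ₚ σ applies the transposition first, so it interchanges
-- the entries of σ at the positions i and j.
data _⇝_ {n} (σ : Permutation′ n) : Permutation′ n → Set where
  reduce : ∀ {i j} → i < j → σ ⟨$⟩ʳ j < σ ⟨$⟩ʳ i → σ ⇝ transpose i j ∘ₚ σ

_≤ᴮ_ : ∀ {n} → Permutation′ n → Permutation′ n → Set
π ≤ᴮ σ = ∃[ τ ] Star _⇝_ σ τ × τ ≈ π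

-- A reduction makes the one-line notation lexicographically smaller, so
-- the search for a sequence of reductions terminates.

private
  _≺_ : ∀ {n} → Permutation′ n → Permutation′ n → Set
  _≺_ = Lex-< _≡_ _<_ on (λ σ → tabulate (σ ⟨$⟩ʳ_))

  ≺-wellFounded : ∀ {n} → WellFounded (_≺_ {n})
  ≺-wellFounded = On.wellFounded _ (Lex.<-wellFounded trans (proj₁ (resp₂ _<_)) <-wellFounded)

  lex : ∀ {m n} (f g : Fin m → Fin n) i → (∀ k → k < i → f k ≡ g k) → f i < g i →
        Lex-< _≡_ _<_ (tabulate f) (tabulate g)
  lex f g zero    eq lt = this lt refl
  lex f g (suc i) eq lt = next (eq 0F (s≤s z≤n)) (lex (f ∘ suc) (g ∘ suc) i (λ k k<i → eq (suc k) (s≤s k<i)) lt)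

  transpose-fst : ∀ {n} (i j : Fin n) → transpose i j ⟨$⟩ʳ i ≡ j
  transpose-fst i j with i ≟ i
  ... | yes _  = refl
  ... | no i≢i = contradiction refl i≢i

  transpose-other : ∀ {n} (i j k : Fin n) → k ≢ i → k ≢ j → transpose i j ⟨$⟩ʳ k ≡ k
  transpose-other i j k k≢i k≢j with k ≟ i
  ... | yes k≡i = contradiction k≡i k≢i
  ... | no _ with k ≟ j
  ...   | yes k≡j = contradiction k≡j k≢j
  ...   | no _    = refl

  reduce-≺ : ∀ {n} (σ : Permutation′ n) {i j} → i < j → σ ⟨$⟩ʳ j < σ ⟨$⟩ʳ i → (transpose i j ∘ₚ σ) ≺ σ
  reduce-≺ σ {i} {j} i<j lt = lex _ _ i
    (λ k k<i → cong (σ ⟨$⟩ʳ_) (transpose-other i j k (<⇒≢ k<i) (<⇒≢ (ℕ.<-trans k<i i<j))))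
    (subst (_< σ ⟨$⟩ʳ i) (cong (σ ⟨$⟩ʳ_) (sym (transpose-fst i j))) lt)

  ≤ᴮ-dec : ∀ {n} (π σ : Permutation′ n) → Acc _≺_ σ → Dec (π ≤ᴮ σ)
  ≤ᴮ-dec {n} π σ (acc rs) = map′ to from
    (all? (λ i → σ ⟨$⟩ʳ i ≟ π ⟨$⟩ʳ i) ⊎-dec any? (λ i → any? (λ j → step? i j)))
    where
    Step : Fin n → Fin n → Set
    Step i j = i < j × σ ⟨$⟩ʳ j < σ ⟨$⟩ʳ i × π ≤ᴮ transpose i j ∘ₚ σ

    step? : ∀ i j → Dec (Step i j)
    step? i j with i <? j | (σ ⟨$⟩ʳ j) <? (σ ⟨$⟩ʳ i)
    ... | no ¬p | _     = no (¬p ∘ proj₁)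
    ... | yes _ | no ¬q = no (¬q ∘ proj₁ ∘ proj₂)
    ... | yes p | yes q = map′ (λ r → p , q , r) (proj₂ ∘ proj₂)
      (≤ᴮ-dec π (transpose i j ∘ₚ σ) (rs (reduce-≺ σ p q)))

    to : (σ ≈ π ⊎ ∃[ i ] ∃[ j ] Step i j) → π ≤ᴮ σ
    to (inj₁ σ≈π)                             = σ , ε , σ≈π
    to (inj₂ (i , j , p , q , τ , path , eq)) = τ , reduce p q ◅ path , eq

    from : π ≤ᴮ σ → σ ≈ π ⊎ ∃[ i ] ∃[ j ] Step i j
    from (τ , ε , σ≈π)               = inj₁ σ≈π
    from (τ , reduce p q ◅ path , eq) = inj₂ (_ , _ , p , q , τ , path , eq)

_≤ᴮ?_ : ∀ {n} (π σ : Permutation′ n) → Dec (π ≤ᴮ σ)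
π ≤ᴮ? σ = ≤ᴮ-dec π σ (≺-wellFounded σ)

------------------------------------------------------------------------
-- Bigrassmannian permutations

Descent : ∀ {n} → Permutation′ n → Fin n → Set
Descent σ i = ∃[ j ] toℕ j ≡ suc (toℕ i) × σ ⟨$⟩ʳ j < σ ⟨$⟩ʳ i

OneDescent : ∀ {n} → Permutation′ n → Set
OneDescent σ = ∃! _≡_ (Descent σ)

Bigrassmannian : ∀ {n} → Permutation′ n → Set
Bigrassmannian σ = OneDescent σ × OneDescent (flip σ)

descent? : ∀ {n} (σ : Permutation′ n) i → Dec (Descent σ i)
descent? σ i = any? λ j → (toℕ j ℕ.≟ suc (toℕ i)) ×-dec ((σ ⟨$⟩ʳ j) <? (σ ⟨$⟩ʳ i))

oneDescent? : ∀ {n} (σ : Permutation′ n) → Dec (OneDescent σ)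
oneDescent? σ = map′ (λ (i , d , u) → i , d , λ {y} → u y) (λ (i , d , u) → i , d , λ y → u {y})
  (any? λ i → descent? σ i ×-dec all? λ y → descent? σ y →-dec (i ≟ y))

bigrassmannian? : ∀ {n} (σ : Permutation′ n) → Dec (Bigrassmannian σ)
bigrassmannian? σ = oneDescent? σ ×-dec oneDescent? (flip σ)

𝔅 : ∀ n → List (Permutation′ n)
𝔅 n = filter bigrassmannian? (𝔖 n)

𝔟 : ℕ → ℕ
𝔟 n = length (𝔅 n)

β : ∀ {n} → Permutation′ n → ℕ
β {n} ω = length (filter (λ π → π ≤ᴮ? ω) (𝔅 n))

α : ∀ {n} → Permutation′ n → ℕ
α {n} ω = length (filter (λ τ → ω ≤ᴮ? τ) (𝔅 n))

-- The expectation of X(ω) for ω uniform on 𝔅 n.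
𝔼 : ∀ n → .{{NonZero (𝔟 n)}} → (Permutation′ n → ℕ) → ℚ
𝔼 n X = + sum (map X (𝔅 n)) / 𝔟 n

private
  flip-cong : ∀ {n} {σ τ : Permutation′ n} → σ ≈ τ → flip σ ≈ flip τ
  flip-cong {σ = σ} {τ} p i = trans (cong (σ ⟨$⟩ˡ_) (sym (inverseʳ τ)))
    (trans (cong (σ ⟨$⟩ˡ_) (sym (p (τ ⟨$⟩ˡ i)))) (inverseˡ σ))

  oneDescent-resp : ∀ {n} {σ τ : Permutation′ n} → σ ≈ τ → OneDescent σ → OneDescent τ
  oneDescent-resp {σ = σ} {τ} p (i , (j , e , lt) , u) =
    i , (j , e , subst₂ _<_ (p j) (p i) lt) ,
    λ {y} (j′ , e′ , lt′) → u (j′ , e′ , subst₂ _<_ (sym (p j′)) (sym (p y)) lt′)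

  bigrassmannian-resp : ∀ {n} {σ τ : Permutation′ n} → σ ≈ τ → Bigrassmannian σ → Bigrassmannian τ
  bigrassmannian-resp {σ = σ} {τ} p (d , d′) =
    oneDescent-resp {σ = σ} {τ} p d , oneDescent-resp {σ = flip σ} {flip τ} (flip-cong {σ = σ} {τ} p) d′

  swap₀₁ : ∀ m → Permutation′ (suc (suc m))
  swap₀₁ m = transpose 0F 1F

  swap₀₁-oneDescent : ∀ m → OneDescent (swap₀₁ m)
  swap₀₁-oneDescent m = 0F , (1F , refl , s≤s z≤n) , unique
    where
    unique : ∀ {y} → Descent (swap₀₁ m) y → 0F ≡ y
    unique {zero}        _                             = refl
    unique {suc zero}    (suc (suc j) , e , ())
    unique {suc (suc y)} (suc (suc j) , e , lt) =
      contradiction lt (ℕ.<⇒≯ (subst (suc (suc (toℕ y)) ℕ.<_) (sym e) (ℕ.n<1+n _)))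

  swap₀₁-flip : ∀ m → swap₀₁ m ≈ flip (swap₀₁ m)
  swap₀₁-flip m zero          = refl
  swap₀₁-flip m (suc zero)    = refl
  swap₀₁-flip m (suc (suc i)) = refl

  swap₀₁-bigrassmannian : ∀ m → Bigrassmannian (swap₀₁ m)
  swap₀₁-bigrassmannian m = swap₀₁-oneDescent m ,
    oneDescent-resp {σ = swap₀₁ m} {flip (swap₀₁ m)} (swap₀₁-flip m) (swap₀₁-oneDescent m)

𝔟≢0 : ∀ {n} → 2 ≤ n → NonZero (𝔟 n)
𝔟≢0 {suc zero} (s≤s ())
𝔟≢0 {suc (suc m)} _ = nonEmpty {swap₀₁ m} (Membershipₚ.∈-filter⁺ S bigrassmannian?
  (λ {σ} {τ} → bigrassmannian-resp {σ = σ} {τ}) {swap₀₁ m} {𝔖 (suc (suc m))} (𝔖-complete _ (swap₀₁ m)) (swap₀₁-bigrassmannian m))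
  where
  S = 𝔖-setoid (suc (suc m))

  nonEmpty : ∀ {π πs} → Membership._∈_ S π πs → NonZero (length πs)
  nonEmpty (here _)  = _
  nonEmpty (there _) = _

2^m*𝔟≢0 : ∀ m {n} → 2 ≤ n → NonZero (2 ^ m * 𝔟 n)
2^m*𝔟≢0 m {n} 2≤n = m*n≢0 (2 ^ m) (𝔟 n) {{m^n≢0 2 m}} {{𝔟≢0 2≤n}}

------------------------------------------------------------------------
-- Formal power series in t, u, v over ℚ
--
-- F a b c is the coefficient of t^a u^b v^c in F.

Series : Set
Series = ℕ → ℕ → ℕ → ℚ

[t^_u^_v^_]_ : ℕ → ℕ → ℕ → Series → ℚ
[t^ a u^ b v^ c ] F = F a b c

infix  1 [t^_u^_v^_]_
infixl 6 _-ₛ_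
infixl 7 _*ₛ_ _/ₛ_
infixr 8 _^ₛ_
infixr 9 _∘ₛ_

const : ℚ → Series
const q 0 0 0 = q
const q _ _ _ = 0ℚ

0ₛ 1ₛ t u v : Series
0ₛ = const 0ℚ
1ₛ = const 1ℚ

t 1 0 0 = 1ℚ
t _ _ _ = 0ℚ

u 0 1 0 = 1ℚ
u _ _ _ = 0ℚ

v 0 0 1 = 1ℚ
v _ _ _ = 0ℚ

_-ₛ_ _*ₛ_ : Series → Series → Series
(F -ₛ G) a b c = F a b c ℚ.- G a b c
(F *ₛ G) a b c = ∑[ i ≤ a ] ∑[ j ≤ b ] ∑[ k ≤ c ]
  (F (toℕ i) (toℕ j) (toℕ k) ℚ.* G (a ∸ toℕ i) (b ∸ toℕ j) (c ∸ toℕ k))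

_^ₛ_ : Series → ℕ → Series
F ^ₛ zero  = 1ₛ
F ^ₛ suc n = F *ₛ F ^ₛ n

-- The composite ∑ᵢ fᵢ Gⁱ of a univariate series f with a series G whose
-- constant coefficient is zero: then Gⁱ has no terms of total degree
-- below i, so the omitted summands contribute nothing to this coefficient.
_∘ₛ_ : (ℕ → ℚ) → Series → Series
(f ∘ₛ G) a b c = ∑[ i ≤ a + b + c ] (f (toℕ i) ℚ.* (G ^ₛ toℕ i) a b c)

exp : Series → Series
exp G = (λ i → (+ 1 / i !) {{i !≢0}}) ∘ₛ G

-- Division by a series F with constant coefficient 1, using the geometric
-- series 1/F = ∑ᵢ (1 - F)ⁱ.
_/ₛ_ : Series → Series → Series
G /ₛ F = G *ₛ ((λ _ → 1ℚ) ∘ₛ (1ₛ -ₛ F))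

-- ℕ's power satisfies 0 ^ 0 = 1.
g : ℕ → ℕ → ℚ
g k i = + (i ^ k) / 1

𝟏[_≡0] : ℕ → Series
𝟏[ zero  ≡0] = 1ₛ
𝟏[ suc _ ≡0] = 0ₛ

{-# OPTIONS --safe #-}
-- A bigrassmannian permutation interchanges two adjacent blocks of lengths r
-- and q, preceded by p - 1 and followed by s - 1 fixed points, p + q + r + s
-- being n + 2.  In the Bruhat order the permutation of (p′, q′, r′, s′) lies
-- below that of (p, q, r, s) exactly when p ≤ p′, s ≤ s′, q′ ≤ q and r′ ≤ r:
-- reductions do not increase the displacements and keep initial and final
-- fixed segments, and conversely one unit of q or r can be moved to p or s by
-- a chain of reductions.  Counting gives 2 β = q r (q + r) and, by symmetry,
-- 2 α = p s (p + s).  On the other side the coefficient of u^k in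
-- (g_k(t e^((1-t)u)) - 1_{k=0})² is (1-t)^k / k! ∑ (p s (p + s))^k t^(p+s) by
-- the binomial theorem, and the division removes the powers of 1 - t.
module Submission where

open import Algebra.Bundles using (CommutativeRing)
open import Function.Base using (_∘_)
open import Relation.Binary.PropositionalEquality

-- The two sides meet because `α` depends only on p and s and `β` only on q and r, while the four
-- numbers are tied by their sum alone. Splitting that sum as (p + s) + (q + r) turns the moment
-- into a Cauchy product in t of a factor for `α` and a factor for `β`, and a series in t, u times a
-- series in t, v has just this shape. In the code p, q, r, s are each lowered by one, which matches
-- the factor t^2 of each square; the coefficient of t^(n+2) becomes that of t^m, where n = m + 2.
-- Having (1 - t) u in place of u is harmless: the substitution multiplies the coefficient of u^b by
-- (1 - t)^b and is compatible with products, so the computation is that for t e^u with weights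
-- carried along. Two obstacles shape the rest. Permutations act on finite types and are listed only
-- up to pointwise equality; they are extended by the identity to functions on ℕ, and lists are
-- compared in a setoid. Composition of series is truncated at the total degree, so sums must be
-- shown not to change under larger bounds.

-- Natural numbers and reciprocal factorials in ℚ

module RationalEmbedding where

  open import Data.Integer.Base as ℤ using (+_)
  import Data.Integer.Properties as ℤ
  open import Data.Nat.Base as ℕ using (ℕ; zero; suc; NonZero; _!)
  import Data.Nat.Properties as ℕ
  open import Data.Rational.Base using (ℚ; 1ℚ; _+_; _*_; _/_; toℚᵘ)
  open import Data.Rational.Properties
  open import Data.Rational.Solver using (module +-*-Solver)
  import Data.Rational.Unnormalised.Base as ℚᵘ
  import Data.Rational.Unnormalised.Properties as ℚᵘ
  open import Algebra.Properties.Semiring.Exp (CommutativeRing.semiring +-*-commutativeRing) using (_^_)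
  open +-*-Solver using (solve; _:*_; _:=_)

  -- Since `_/_` divides by a gcd, it does not compute on variables. This lemma moves identities to
  -- unnormalised fractions, where they are identities of integers.
  toℚᵘ-/ : ∀ i n .{{_ : NonZero n}} → toℚᵘ (i / n) ℚᵘ.≃ i ℚᵘ./ n
  toℚᵘ-/ i (suc n) = toℚᵘ-fromℚᵘ (i ℚᵘ./ suc n)

  ι : ℕ → ℚ
  ι n = + n / 1

  ι-+ : ∀ m n → ι (m ℕ.+ n) ≡ ι m + ι n
  ι-+ m n = toℚᵘ-injective (begin
    toℚᵘ (ι (m ℕ.+ n))               ≈⟨ toℚᵘ-/ (+ (m ℕ.+ n)) 1 ⟩
    + (m ℕ.+ n) ℚᵘ./ 1               ≡⟨ cong (ℚᵘ._/ 1) (cong₂ ℤ._+_ (ℤ.*-identityʳ (+ m)) (ℤ.*-identityʳ (+ n))) ⟨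
    (+ m ℚᵘ./ 1) ℚᵘ.+ (+ n ℚᵘ./ 1)   ≈⟨ ℚᵘ.+-cong (toℚᵘ-/ (+ m) 1) (toℚᵘ-/ (+ n) 1) ⟨
    toℚᵘ (ι m) ℚᵘ.+ toℚᵘ (ι n)       ≈⟨ toℚᵘ-homo-+ (ι m) (ι n) ⟨
    toℚᵘ (ι m + ι n)                 ∎)
    where open ℚᵘ.≃-Reasoning

  ι-* : ∀ m n → ι (m ℕ.* n) ≡ ι m * ι n
  ι-* m n = toℚᵘ-injective (begin
    toℚᵘ (ι (m ℕ.* n))               ≈⟨ toℚᵘ-/ (+ (m ℕ.* n)) 1 ⟩
    + (m ℕ.* n) ℚᵘ./ 1               ≡⟨ cong (ℚᵘ._/ 1) (ℤ.pos-* m n) ⟩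
    (+ m ℚᵘ./ 1) ℚᵘ.* (+ n ℚᵘ./ 1)   ≈⟨ ℚᵘ.*-cong (toℚᵘ-/ (+ m) 1) (toℚᵘ-/ (+ n) 1) ⟨
    toℚᵘ (ι m) ℚᵘ.* toℚᵘ (ι n)       ≈⟨ toℚᵘ-homo-* (ι m) (ι n) ⟨
    toℚᵘ (ι m * ι n)                 ∎)
    where open ℚᵘ.≃-Reasoning

  /-*-ι : ∀ m d .{{_ : NonZero d}} → + m / d * ι d ≡ ι m
  /-*-ι m d = toℚᵘ-injective (begin
    toℚᵘ (+ m / d * ι d)                ≈⟨ toℚᵘ-homo-* (+ m / d) (ι d) ⟩
    toℚᵘ (+ m / d) ℚᵘ.* toℚᵘ (ι d)      ≈⟨ ℚᵘ.*-cong (toℚᵘ-/ (+ m) d) (toℚᵘ-/ (+ d) 1) ⟩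
    (+ m ℚᵘ./ d) ℚᵘ.* (+ d ℚᵘ./ 1)      ≈⟨ cancel m d ⟩
    + m ℚᵘ./ 1                          ≈⟨ toℚᵘ-/ (+ m) 1 ⟨
    toℚᵘ (ι m)                          ∎)
    where
    open ℚᵘ.≃-Reasoning
    cancel : ∀ m d .{{_ : NonZero d}} → (+ m ℚᵘ./ d) ℚᵘ.* (+ d ℚᵘ./ 1) ℚᵘ.≃ + m ℚᵘ./ 1
    cancel m (suc d) = ℚᵘ.*≡* (ℤ.*-assoc (+ m) (+ suc d) (+ 1))

  open ≡-Reasoning

  -- The means of clearing denominators: `ι d` has the inverse `+ 1 / d`.
  *-ι-cancelʳ : ∀ d .{{_ : NonZero d}} {x y} → x * ι d ≡ y * ι d → x ≡ y
  *-ι-cancelʳ d {x} {y} eq = trans (unit x) (trans (cong (_* (+ 1 / d)) eq) (sym (unit y)))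
    where
    unit : ∀ x → x ≡ x * ι d * (+ 1 / d)
    unit x = begin
      x                         ≡⟨ *-identityʳ x ⟨
      x * ι 1                   ≡⟨ cong (x *_) (/-*-ι 1 d) ⟨
      x * (+ 1 / d * ι d)       ≡⟨ solve 3 (λ x a b → x :* (a :* b) := x :* b :* a) refl x (+ 1 / d) (ι d) ⟩
      x * ι d * (+ 1 / d)       ∎

  ι-^ : ∀ m n → ι (m ℕ.^ n) ≡ ι m ^ n
  ι-^ m zero    = refl
  ι-^ m (suc n) = trans (ι-* m (m ℕ.^ n)) (cong (ι m *_) (ι-^ m n))

  1/_! : ℕ → ℚ
  1/ n ! = (+ 1 / n !) {{n ℕ.!≢0}}

  1/!-* : ∀ n → 1/ n ! * ι (n !) ≡ 1ℚ
  1/!-* n = /-*-ι 1 (n !) {{n ℕ.!≢0}}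

  1/!-suc : ∀ n → 1/ suc n ! * ι (suc n) ≡ 1/ n !
  1/!-suc n = *-ι-cancelʳ (n !) {{n ℕ.!≢0}} (begin
    1/ suc n ! * ι (suc n) * ι (n !)   ≡⟨ *-assoc (1/ suc n !) (ι (suc n)) (ι (n !)) ⟩
    1/ suc n ! * (ι (suc n) * ι (n !)) ≡⟨ cong (1/ suc n ! *_) (ι-* (suc n) (n !)) ⟨
    1/ suc n ! * ι (suc n !)           ≡⟨ 1/!-* (suc n) ⟩
    1ℚ                                 ≡⟨ 1/!-* n ⟨
    1/ n ! * ι (n !)                   ∎)

-- Formal power series and the coefficient on the right-hand side

module PowerSeries where

  open import Data.Fin.Base using (toℕ)
  open import Data.Fin.Properties using (toℕ≤pred[n])
  open import Data.Nat.Base as ℕ using (ℕ; zero; suc; _∸_; _!; _≤_; z≤n; s≤s)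
  import Data.Nat.Properties as ℕ
  open import Data.Product using (_,_)
  open import Data.Rational.Base using (ℚ; 0ℚ; 1ℚ; _+_; _*_; _-_; -_)
  open import Data.Rational.Properties
  open import Data.Rational.Solver using (module +-*-Solver)
  open import Level using (0ℓ)
  open import Algebra.Properties.CommutativeSemigroup ℕ.*-commutativeSemigroup using () renaming (interchange to ℕ*-interchange)
  open import Algebra.Properties.Semiring.Exp (CommutativeRing.semiring +-*-commutativeRing) using (_^_)
  open import Algebra.Properties.Semiring.Sum (CommutativeRing.semiring +-*-commutativeRing)
    using (sum; sum-cong-≗; ∑-distrib-+; ∑-comm; *-distribˡ-sum; *-distribʳ-sum)
  open import Defs
  open RationalEmbedding
  open +-*-Solver using (solve; _:+_; _:*_; _:=_; con; :-_)
  open ≡-Reasoning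

  -- Series in one variable

  -- Unfolds to the same expression as the sums in `_*ₛ_` and `_∘ₛ_`, so that the lemmas on `∑≤`
  -- apply to these without conversion.
  ∑≤ : ℕ → (ℕ → ℚ) → ℚ
  ∑≤ n φ = sum {suc n} (φ ∘ toℕ)

  ∑≤-cong : ∀ n {φ ψ} → (∀ i → φ i ≡ ψ i) → ∑≤ n φ ≡ ∑≤ n ψ
  ∑≤-cong n eq = sum-cong-≗ {suc n} (eq ∘ toℕ)

  ∑≤-zero : ∀ n {φ} → (∀ i → φ i ≡ 0ℚ) → ∑≤ n φ ≡ 0ℚ
  ∑≤-zero zero    eq = cong (_+ 0ℚ) (eq 0)
  ∑≤-zero (suc n) eq = cong₂ _+_ (eq 0) (∑≤-zero n (eq ∘ suc))

  ∑≤-+ : ∀ n φ ψ → ∑≤ n (λ i → φ i + ψ i) ≡ ∑≤ n φ + ∑≤ n ψ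
  ∑≤-+ n φ ψ = ∑-distrib-+ {suc n} (φ ∘ toℕ) (ψ ∘ toℕ)

  ∑≤-comm : ∀ m n (φ : ℕ → ℕ → ℚ) → ∑≤ m (λ i → ∑≤ n (φ i)) ≡ ∑≤ n (λ j → ∑≤ m (λ i → φ i j))
  ∑≤-comm m n φ = ∑-comm {suc m} {suc n} (λ i j → φ (toℕ i) (toℕ j))

  *-∑≤ : ∀ n c φ → c * ∑≤ n φ ≡ ∑≤ n (λ i → c * φ i)
  *-∑≤ n c φ = *-distribˡ-sum {suc n} c (φ ∘ toℕ)

  ∑≤-* : ∀ n c φ → ∑≤ n φ * c ≡ ∑≤ n (λ i → φ i * c)
  ∑≤-* n c φ = *-distribʳ-sum {suc n} c (φ ∘ toℕ)

  ℚ⟦t⟧ : Set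
  ℚ⟦t⟧ = ℕ → ℚ

  infixl 6 _⊕_
  infixl 7 _⊗_ _•_

  _⊕_ _⊗_ : ℚ⟦t⟧ → ℚ⟦t⟧ → ℚ⟦t⟧
  (f ⊕ h) n = f n + h n
  (f ⊗ h) n = ∑≤ n (λ i → f i * h (n ∸ i))

  _•_ : ℚ → ℚ⟦t⟧ → ℚ⟦t⟧
  (c • f) n = c * f n

  ⊝_ : ℚ⟦t⟧ → ℚ⟦t⟧
  (⊝ f) n = - f n

  𝟘 𝟙 : ℚ⟦t⟧
  𝟘 _ = 0ℚ
  𝟙 zero    = 1ℚ
  𝟙 (suc _) = 0ℚ

  ⊗-cong : ∀ {f f′ h h′} → f ≗ f′ → h ≗ h′ → f ⊗ h ≗ f′ ⊗ h′
  ⊗-cong p q n = ∑≤-cong n (λ i → cong₂ _*_ (p i) (q (n ∸ i)))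

  ⊗-zeroˡ : ∀ h → 𝟘 ⊗ h ≗ 𝟘
  ⊗-zeroˡ h n = ∑≤-zero n (λ i → *-zeroˡ (h (n ∸ i)))

  ⊗-identityˡ : ∀ h → 𝟙 ⊗ h ≗ h
  ⊗-identityˡ h zero    = trans (+-identityʳ (1ℚ * h 0)) (*-identityˡ (h 0))
  ⊗-identityˡ h (suc n) = trans (cong₂ _+_ (*-identityˡ (h (suc n))) (⊗-zeroˡ h n)) (+-identityʳ (h (suc n)))

  ⊗-distribʳ : ∀ h f f′ → (f ⊕ f′) ⊗ h ≗ f ⊗ h ⊕ f′ ⊗ h
  ⊗-distribʳ h f f′ n = trans (∑≤-cong n (λ i → *-distribʳ-+ (h (n ∸ i)) (f i) (f′ i))) (∑≤-+ n (λ i → f i * h (n ∸ i)) (λ i → f′ i * h (n ∸ i)))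

  •-⊗ : ∀ c f h → (c • f) ⊗ h ≗ c • (f ⊗ h)
  •-⊗ c f h n = trans (∑≤-cong n (λ i → *-assoc c (f i) (h (n ∸ i)))) (sym (*-∑≤ n c (λ i → f i * h (n ∸ i))))

  -- The sum unfolds at its first term by computation; this is the mirror image at its last term, on
  -- which commutativity by induction rests.
  ⊗-unfoldʳ : ∀ f h n → (f ⊗ h) (suc n) ≡ (f ⊗ (h ∘ suc)) n + f (suc n) * h 0
  ⊗-unfoldʳ f h zero    = solve 4 (λ a b c d → a :* b :+ (c :* d :+ con 0ℚ) := (a :* b :+ con 0ℚ) :+ c :* d) refl (f 0) (h 1) (f 1) (h 0)
  ⊗-unfoldʳ f h (suc n) = begin
    f 0 * h (2 ℕ.+ n) + ((f ∘ suc) ⊗ h) (suc n)                      ≡⟨ cong (λ s → f 0 * h (2 ℕ.+ n) + s) (⊗-unfoldʳ (f ∘ suc) h n) ⟩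
    f 0 * h (2 ℕ.+ n) + (((f ∘ suc) ⊗ (h ∘ suc)) n + f (2 ℕ.+ n) * h 0) ≡⟨ +-assoc (f 0 * h (2 ℕ.+ n)) (((f ∘ suc) ⊗ (h ∘ suc)) n) (f (2 ℕ.+ n) * h 0) ⟨
    (f ⊗ (h ∘ suc)) (suc n) + f (2 ℕ.+ n) * h 0                      ∎

  ⊗-comm : ∀ f h → f ⊗ h ≗ h ⊗ f
  ⊗-comm f h zero    = cong (_+ 0ℚ) (*-comm (f 0) (h 0))
  ⊗-comm f h (suc n) = begin
    f 0 * h (suc n) + ((f ∘ suc) ⊗ h) n  ≡⟨ cong₂ _+_ (*-comm (f 0) (h (suc n))) (⊗-comm (f ∘ suc) h n) ⟩
    h (suc n) * f 0 + (h ⊗ (f ∘ suc)) n  ≡⟨ +-comm (h (suc n) * f 0) ((h ⊗ (f ∘ suc)) n) ⟩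
    (h ⊗ (f ∘ suc)) n + h (suc n) * f 0  ≡⟨ ⊗-unfoldʳ h f n ⟨
    (h ⊗ f) (suc n)                      ∎

  -- Shifted down by one degree, `f ⊗ h` is `f 0 • (h ∘ suc) ⊕ (f ∘ suc) ⊗ h` by computation.
  -- Induction on the degree therefore needs only distributivity and no reindexing of a double sum.
  ⊗-assoc : ∀ f h k → (f ⊗ h) ⊗ k ≗ f ⊗ (h ⊗ k)
  ⊗-assoc f h k zero    = solve 3 (λ a b c → (a :* b :+ con 0ℚ) :* c :+ con 0ℚ := a :* (b :* c :+ con 0ℚ) :+ con 0ℚ) refl (f 0) (h 0) (k 0)
  ⊗-assoc f h k (suc n) = begin
    (f 0 * h 0 + 0ℚ) * k (suc n) + ((f 0 • (h ∘ suc) ⊕ (f ∘ suc) ⊗ h) ⊗ k) n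
      ≡⟨ cong (λ s → (f 0 * h 0 + 0ℚ) * k (suc n) + s) (⊗-distribʳ k (f 0 • (h ∘ suc)) ((f ∘ suc) ⊗ h) n) ⟩
    (f 0 * h 0 + 0ℚ) * k (suc n) + (((f 0 • (h ∘ suc)) ⊗ k) n + (((f ∘ suc) ⊗ h) ⊗ k) n)
      ≡⟨ cong₂ (λ x y → (f 0 * h 0 + 0ℚ) * k (suc n) + (x + y)) (•-⊗ (f 0) (h ∘ suc) k n) (⊗-assoc (f ∘ suc) h k n) ⟩
    (f 0 * h 0 + 0ℚ) * k (suc n) + (f 0 * ((h ∘ suc) ⊗ k) n + ((f ∘ suc) ⊗ (h ⊗ k)) n)
      ≡⟨ solve 5 (λ a b c d e → (a :* b :+ con 0ℚ) :* c :+ (a :* d :+ e) := a :* (b :* c :+ d) :+ e) refl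
           (f 0) (h 0) (k (suc n)) (((h ∘ suc) ⊗ k) n) (((f ∘ suc) ⊗ (h ⊗ k)) n) ⟩
    (f ⊗ (h ⊗ k)) (suc n) ∎

  ⊗-distribˡ : ∀ f h k → f ⊗ (h ⊕ k) ≗ f ⊗ h ⊕ f ⊗ k
  ⊗-distribˡ f h k n = trans (⊗-comm f (h ⊕ k) n) (trans (⊗-distribʳ f h k n) (cong₂ _+_ (⊗-comm h f n) (⊗-comm k f n)))

  ℚ⟦t⟧-commutativeRing : CommutativeRing 0ℓ 0ℓ
  ℚ⟦t⟧-commutativeRing = record
    { Carrier           = ℚ⟦t⟧
    ; _≈_               = _≗_
    ; _+_               = _⊕_
    ; _*_               = _⊗_
    ; -_                = ⊝_
    ; 0#                = 𝟘
    ; 1#                = 𝟙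
    ; isCommutativeRing = record
      { isRing = record
        { +-isAbelianGroup = record
          { isGroup = record
            { isMonoid = record
              { isSemigroup = record
                { isMagma = record
                  { isEquivalence = record
                    { refl  = λ _ → refl
                    ; sym   = λ p n → sym (p n)
                    ; trans = λ p q n → trans (p n) (q n)
                    }
                  ; ∙-cong = λ p q n → cong₂ _+_ (p n) (q n)
                  }
                ; assoc = λ f h k n → +-assoc (f n) (h n) (k n)
                }
              ; identity = (λ f n → +-identityˡ (f n)) , (λ f n → +-identityʳ (f n))
              }
            ; inverse = (λ f n → +-inverseˡ (f n)) , (λ f n → +-inverseʳ (f n))
            ; ⁻¹-cong = λ p n → cong -_ (p n)
            }
          ; comm = λ f h n → +-comm (f n) (h n)
          }
        ; *-cong     = λ {f} {f′} {h} {h′} → ⊗-cong {f} {f′} {h} {h′}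
        ; *-assoc    = ⊗-assoc
        ; *-identity = ⊗-identityˡ , λ f n → trans (⊗-comm f 𝟙 n) (⊗-identityˡ f n)
        ; distrib    = ⊗-distribˡ , ⊗-distribʳ
        }
      ; *-comm = ⊗-comm
      }
    }

  open import Algebra.Properties.Semiring.Exp (CommutativeRing.semiring ℚ⟦t⟧-commutativeRing) using () renaming (_^_ to _^ₜ_; ^-homo-* to ^ₜ-homo-⊗)
  open import Algebra.Properties.CommutativeSemigroup (CommutativeRing.*-commutativeSemigroup ℚ⟦t⟧-commutativeRing) using () renaming (interchange to ⊗-interchange)

  ∑≤-cong-≤ : ∀ n {φ ψ} → (∀ i → i ≤ n → φ i ≡ ψ i) → ∑≤ n φ ≡ ∑≤ n ψ
  ∑≤-cong-≤ n eq = sum-cong-≗ {suc n} (λ i → eq (toℕ i) (toℕ≤pred[n] i))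

  X : ℚ⟦t⟧ → ℚ⟦t⟧
  X f zero    = 0ℚ
  X f (suc n) = f n

  X-cong : ∀ {f h} → f ≗ h → X f ≗ X h
  X-cong eq zero    = refl
  X-cong eq (suc n) = eq n

  X-⊗ : ∀ f h → X f ⊗ h ≗ X (f ⊗ h)
  X-⊗ f h zero    = trans (+-identityʳ (0ℚ * h 0)) (*-zeroˡ (h 0))
  X-⊗ f h (suc n) = trans (cong (_+ (f ⊗ h) n) (*-zeroˡ (h (suc n)))) (+-identityˡ ((f ⊗ h) n))

  ⊗-X : ∀ f h → f ⊗ X h ≗ X (f ⊗ h)
  ⊗-X f h n = trans (⊗-comm f (X h) n) (trans (X-⊗ h f n) (X-cong (⊗-comm h f) n))

  •-⊗-• : ∀ c d f h → (c • f) ⊗ (d • h) ≗ (c * d) • (f ⊗ h)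
  •-⊗-• c d f h n = begin
    ((c • f) ⊗ (d • h)) n     ≡⟨ •-⊗ c f (d • h) n ⟩
    c * (f ⊗ (d • h)) n       ≡⟨ cong (c *_) (⊗-comm f (d • h) n) ⟩
    c * ((d • h) ⊗ f) n       ≡⟨ cong (c *_) (•-⊗ d h f n) ⟩
    c * (d * (h ⊗ f) n)       ≡⟨ cong (λ x → c * (d * x)) (⊗-comm h f n) ⟩
    c * (d * (f ⊗ h) n)       ≡⟨ *-assoc c d ((f ⊗ h) n) ⟨
    c * d * (f ⊗ h) n         ∎

  X^ : ℕ → ℚ⟦t⟧ → ℚ⟦t⟧
  X^ zero    f = f
  X^ (suc i) f = X (X^ i f)

  X^-cong : ∀ i {f h} → f ≗ h → X^ i f ≗ X^ i h
  X^-cong zero    eq = eq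
  X^-cong (suc i) eq = X-cong (X^-cong i eq)

  ⊗-X^ : ∀ i f h → f ⊗ X^ i h ≗ X^ i (f ⊗ h)
  ⊗-X^ zero    f h n = refl
  ⊗-X^ (suc i) f h n = trans (⊗-X f (X^ i h) n) (X-cong (⊗-X^ i f h) n)

  -- The terms with i > a are divisible by a higher power of t than t^a. The slack `e` is there
  -- because `_∘ₛ_` sums up to the total degree in all three variables.
  ∑-X^ : ∀ c f a e → ∑≤ (a ℕ.+ e) (λ i → c i * X^ i f a) ≡ (c ⊗ f) a
  ∑-X^ c f zero zero    = refl
  ∑-X^ c f zero (suc e) = cong (λ s → c 0 * f 0 + s) (∑≤-zero e (λ i → *-zeroʳ (c (suc i))))
  ∑-X^ c f (suc a) e    = cong (λ s → c 0 * f (suc a) + s) (∑-X^ (c ∘ suc) f a e)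

  -- The Euler operator t d/dt; `θ-⊗` is its product rule.
  θ : ℚ⟦t⟧ → ℚ⟦t⟧
  θ f n = ι n * f n

  θ-⊗ : ∀ f h n → θ (f ⊗ h) n ≡ (θ f ⊗ h ⊕ f ⊗ θ h) n
  θ-⊗ f h n = begin
    ι n * (f ⊗ h) n                                              ≡⟨ *-∑≤ n (ι n) (λ i → f i * h (n ∸ i)) ⟩
    ∑≤ n (λ i → ι n * (f i * h (n ∸ i)))                         ≡⟨ ∑≤-cong-≤ n split ⟩
    ∑≤ n (λ i → θ f i * h (n ∸ i) + f i * θ h (n ∸ i))           ≡⟨ ∑≤-+ n (λ i → θ f i * h (n ∸ i)) (λ i → f i * θ h (n ∸ i)) ⟩
    (θ f ⊗ h ⊕ f ⊗ θ h) n                                        ∎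
    where
    split : ∀ i → i ≤ n → ι n * (f i * h (n ∸ i)) ≡ θ f i * h (n ∸ i) + f i * θ h (n ∸ i)
    split i i≤n = begin
      ι n * (f i * h (n ∸ i))                                    ≡⟨ cong (λ k → ι k * (f i * h (n ∸ i))) (ℕ.m+[n∸m]≡n i≤n) ⟨
      ι (i ℕ.+ (n ∸ i)) * (f i * h (n ∸ i))                      ≡⟨ cong (_* (f i * h (n ∸ i))) (ι-+ i (n ∸ i)) ⟩
      (ι i + ι (n ∸ i)) * (f i * h (n ∸ i))
        ≡⟨ solve 4 (λ a b c d → (a :+ b) :* (c :* d) := a :* c :* d :+ c :* (b :* d)) refl (ι i) (ι (n ∸ i)) (f i) (h (n ∸ i)) ⟩
      θ f i * h (n ∸ i) + f i * θ h (n ∸ i)                      ∎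

  -- The exponential series e^(x t), and `θ-𝕖` its differential equation.
  𝕖 : ℚ → ℚ⟦t⟧
  𝕖 x n = 1/ n ! * x ^ n

  θ-𝕖 : ∀ x → θ (𝕖 x) ≗ X (x • 𝕖 x)
  θ-𝕖 x zero    = *-zeroˡ (𝕖 x 0)
  θ-𝕖 x (suc n) = begin
    ι (suc n) * (1/ suc n ! * (x * x ^ n)) ≡⟨ solve 4 (λ a b c d → a :* (b :* (c :* d)) := c :* (b :* a :* d)) refl (ι (suc n)) (1/ suc n !) x (x ^ n) ⟩
    x * (1/ suc n ! * ι (suc n) * x ^ n)   ≡⟨ cong (λ y → x * (y * x ^ n)) (1/!-suc n) ⟩
    x * 𝕖 x n                              ∎

  -- The binomial theorem, by comparing logarithmic derivatives.
  𝕖-+ : ∀ x y → 𝕖 x ⊗ 𝕖 y ≗ 𝕖 (x + y)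
  𝕖-+ x y zero    = refl
  𝕖-+ x y (suc n) = *-ι-cancelʳ (suc n) (begin
    P (suc n) * ι (suc n)                                        ≡⟨ *-comm (P (suc n)) (ι (suc n)) ⟩
    θ P (suc n)                                                  ≡⟨ θ-⊗ (𝕖 x) (𝕖 y) (suc n) ⟩
    (θ (𝕖 x) ⊗ 𝕖 y ⊕ 𝕖 x ⊗ θ (𝕖 y)) (suc n)
      ≡⟨ cong₂ _+_ (⊗-cong {h = 𝕖 y} (θ-𝕖 x) (λ _ → refl) (suc n)) (⊗-cong {𝕖 x} (λ _ → refl) (θ-𝕖 y) (suc n)) ⟩
    (X (x • 𝕖 x) ⊗ 𝕖 y ⊕ 𝕖 x ⊗ X (y • 𝕖 y)) (suc n)
      ≡⟨ cong₂ _+_ (X-⊗ (x • 𝕖 x) (𝕖 y) (suc n)) (⊗-X (𝕖 x) (y • 𝕖 y) (suc n)) ⟩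
    ((x • 𝕖 x) ⊗ 𝕖 y) n + (𝕖 x ⊗ (y • 𝕖 y)) n
      ≡⟨ cong₂ _+_ (•-⊗ x (𝕖 x) (𝕖 y) n) (trans (⊗-comm (𝕖 x) (y • 𝕖 y) n) (trans (•-⊗ y (𝕖 y) (𝕖 x) n) (cong (y *_) (⊗-comm (𝕖 y) (𝕖 x) n)))) ⟩
    x * P n + y * P n                                            ≡⟨ *-distribʳ-+ (P n) x y ⟨
    (x + y) * P n                                                ≡⟨ cong ((x + y) *_) (𝕖-+ x y n) ⟩
    X ((x + y) • 𝕖 (x + y)) (suc n)                              ≡⟨ θ-𝕖 (x + y) (suc n) ⟨
    θ (𝕖 (x + y)) (suc n)                                        ≡⟨ *-comm (ι (suc n)) (𝕖 (x + y) (suc n)) ⟩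
    𝕖 (x + y) (suc n) * ι (suc n)                                ∎)
    where P = 𝕖 x ⊗ 𝕖 y

  geometric : ℚ⟦t⟧ → ℚ⟦t⟧
  geometric y n = ∑≤ n (λ i → (y ^ₜ i) n)

  module _ (y : ℚ⟦t⟧) (y₀≡0 : y 0 ≡ 0ℚ) where

    ^ₜ-order : ∀ i n → n ℕ.< i → (y ^ₜ i) n ≡ 0ℚ
    ^ₜ-order (suc i) zero    _         = trans (+-identityʳ (y 0 * (y ^ₜ i) 0)) (trans (cong (_* (y ^ₜ i) 0) y₀≡0) (*-zeroˡ ((y ^ₜ i) 0)))
    ^ₜ-order (suc i) (suc n) (s≤s n<i) = begin
      y 0 * (y ^ₜ i) (suc n) + ((y ∘ suc) ⊗ (y ^ₜ i)) n
        ≡⟨ cong₂ _+_ (trans (cong (_* (y ^ₜ i) (suc n)) y₀≡0) (*-zeroˡ ((y ^ₜ i) (suc n))))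
             (∑≤-zero n (λ j → trans (cong (y (suc j) *_) (^ₜ-order i (n ∸ j) (ℕ.≤-<-trans (ℕ.m∸n≤m n j) n<i))) (*-zeroʳ (y (suc j))))) ⟩
      0ℚ ∎

    -- As y has no constant term, y^i begins in degree i at the earliest, and the summands beyond i
    -- = n vanish in degree n.
    geometric-≥ : ∀ n e → ∑≤ (n ℕ.+ e) (λ i → (y ^ₜ i) n) ≡ geometric y n
    geometric-≥ n e = go n e (λ i → (y ^ₜ i) n) (λ i → ^ₜ-order i n)
      where
      go : ∀ n e φ → (∀ i → n ℕ.< i → φ i ≡ 0ℚ) → ∑≤ (n ℕ.+ e) φ ≡ ∑≤ n φ
      go zero    zero    φ eq = refl
      go zero    (suc e) φ eq = cong (λ s → φ 0 + s) (∑≤-zero e (λ i → eq (suc i) (s≤s z≤n)))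
      go (suc n) e       φ eq = cong (λ s → φ 0 + s) (go n e (φ ∘ suc) (λ i lt → eq (suc i) (s≤s lt)))

    geometric-fixpoint : geometric y ≗ 𝟙 ⊕ y ⊗ geometric y
    geometric-fixpoint n = begin
      -- One summand more than needed: once the term i = 0 is split off, a sum with the original
      -- bound remains.
      geometric y n                                              ≡⟨ geometric-≥ n 1 ⟨
      ∑≤ (n ℕ.+ 1) (λ i → (y ^ₜ i) n)                            ≡⟨ cong (λ m → ∑≤ m (λ i → (y ^ₜ i) n)) (ℕ.+-comm n 1) ⟩
      𝟙 n + ∑≤ n (λ i → ∑≤ n (λ j → y j * (y ^ₜ i) (n ∸ j)))     ≡⟨ cong (λ s → 𝟙 n + s) (∑≤-comm n n (λ i j → y j * (y ^ₜ i) (n ∸ j))) ⟩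
      𝟙 n + ∑≤ n (λ j → ∑≤ n (λ i → y j * (y ^ₜ i) (n ∸ j)))     ≡⟨ cong (λ s → 𝟙 n + s) (∑≤-cong-≤ n inner) ⟩
      (𝟙 ⊕ y ⊗ geometric y) n                                    ∎
      where
      inner : ∀ j → j ≤ n → ∑≤ n (λ i → y j * (y ^ₜ i) (n ∸ j)) ≡ y j * geometric y (n ∸ j)
      inner j j≤n = begin
        ∑≤ n (λ i → y j * (y ^ₜ i) (n ∸ j))                      ≡⟨ *-∑≤ n (y j) (λ i → (y ^ₜ i) (n ∸ j)) ⟨
        y j * ∑≤ n (λ i → (y ^ₜ i) (n ∸ j))                      ≡⟨ cong (λ m → y j * ∑≤ m (λ i → (y ^ₜ i) (n ∸ j))) (ℕ.m∸n+n≡m j≤n) ⟨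
        y j * ∑≤ (n ∸ j ℕ.+ j) (λ i → (y ^ₜ i) (n ∸ j))          ≡⟨ cong (y j *_) (geometric-≥ (n ∸ j) j) ⟩
        y j * geometric y (n ∸ j)                                ∎

    geometric-inverse : (𝟙 ⊕ ⊝ y) ⊗ geometric y ≗ 𝟙
    geometric-inverse n = begin
      ((𝟙 ⊕ ⊝ y) ⊗ geometric y) n
        ≡⟨ ∑≤-cong n (λ i → solve 3 (λ a b c → (a :+ :- b) :* c := a :* c :+ (con (- 1ℚ) :* b) :* c) refl (𝟙 i) (y i) (geometric y (n ∸ i))) ⟩
      ∑≤ n (λ i → 𝟙 i * geometric y (n ∸ i) + (- 1ℚ * y i) * geometric y (n ∸ i))
        ≡⟨ ∑≤-+ n (λ i → 𝟙 i * geometric y (n ∸ i)) (λ i → (- 1ℚ * y i) * geometric y (n ∸ i)) ⟩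
      (𝟙 ⊗ geometric y) n + ((- 1ℚ • y) ⊗ geometric y) n
        ≡⟨ cong₂ _+_ (trans (⊗-identityˡ (geometric y) n) (geometric-fixpoint n)) (•-⊗ (- 1ℚ) y (geometric y) n) ⟩
      𝟙 n + (y ⊗ geometric y) n + - 1ℚ * (y ⊗ geometric y) n
        ≡⟨ solve 2 (λ a b → a :+ b :+ con (- 1ℚ) :* b := a) refl (𝟙 n) ((y ⊗ geometric y) n) ⟩
      𝟙 n ∎

  -- Series in three variables

  ∑≤-head : ∀ n φ → (∀ i → φ (suc i) ≡ 0ℚ) → ∑≤ n φ ≡ φ 0
  ∑≤-head zero    φ eq = +-identityʳ (φ 0)
  ∑≤-head (suc n) φ eq = trans (cong (λ s → φ 0 + s) (∑≤-zero n eq)) (+-identityʳ (φ 0))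

  ∑≤-last : ∀ n (φ : ℕ → ℕ → ℚ) → (∀ i j → φ i (suc j) ≡ 0ℚ) → ∑≤ n (λ i → φ i (n ∸ i)) ≡ φ n 0
  ∑≤-last zero    φ eq = +-identityʳ (φ 0 0)
  ∑≤-last (suc n) φ eq = trans (cong₂ _+_ (eq 0 n) (∑≤-last n (φ ∘ suc) (eq ∘ suc))) (+-identityˡ (φ (suc n) 0))

  ∑≤-⊗ : ∀ n (φ : ℕ → ℚ⟦t⟧) h a → ∑≤ n (λ j → (φ j ⊗ h) a) ≡ ((λ i → ∑≤ n (λ j → φ j i)) ⊗ h) a
  ∑≤-⊗ n φ h a = trans (∑≤-comm n a (λ j i → φ j i * h (a ∸ i)))
    (∑≤-cong a (λ i → sym (∑≤-* n (h (a ∸ i)) (λ j → φ j i))))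

  -- A record, so that F and G can be inferred from a proof of F ≐ G.
  infix 4 _≐_
  record _≐_ (F G : Series) : Set where
    field at : ∀ a b c → F a b c ≡ G a b c
  open _≐_

  ≐-refl : ∀ {F} → F ≐ F
  ≐-refl .at _ _ _ = refl

  ≐-trans : ∀ {F G H} → F ≐ G → G ≐ H → F ≐ H
  ≐-trans p q .at a b c = trans (at p a b c) (at q a b c)

  *ₛ-cong : ∀ {F F′ G G′} → F ≐ F′ → G ≐ G′ → F *ₛ G ≐ F′ *ₛ G′
  *ₛ-cong p q .at a b c = ∑≤-cong a λ i → ∑≤-cong b λ j → ∑≤-cong c λ k →
    cong₂ _*_ (at p i j k) (at q (a ∸ i) (b ∸ j) (c ∸ k))

  -ₛ-cong : ∀ {F F′ G G′} → F ≐ F′ → G ≐ G′ → F -ₛ G ≐ F′ -ₛ G′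
  -ₛ-cong p q .at a b c = cong₂ _-_ (at p a b c) (at q a b c)

  ^ₛ-cong : ∀ {F G} n → F ≐ G → F ^ₛ n ≐ G ^ₛ n
  ^ₛ-cong         zero    p = ≐-refl
  ^ₛ-cong {F} {G} (suc n) p = *ₛ-cong {F} {G} p (^ₛ-cong n p)

  infix 4 _⇄_
  -- The exchange of u and v. The factor in v is carried by it to the one in u, so that only the
  -- latter has to be computed.
  record _⇄_ (F G : Series) : Set where
    field swapped : ∀ a b c → F a b c ≡ G a c b
  open _⇄_

  ⇄-≐-trans : ∀ {F G H} → F ⇄ G → G ≐ H → F ⇄ H
  ⇄-≐-trans p q .swapped a b c = trans (swapped p a b c) (at q a c b)

  *ₛ-swap : ∀ {F F′ G G′} → F ⇄ F′ → G ⇄ G′ → F *ₛ G ⇄ F′ *ₛ G′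
  *ₛ-swap {F′ = F′} {G′ = G′} p q .swapped a b c = ∑≤-cong a λ i → trans
    (∑≤-cong b λ j → ∑≤-cong c λ k → cong₂ _*_ (swapped p i j k) (swapped q (a ∸ i) (b ∸ j) (c ∸ k)))
    (∑≤-comm b c λ j k → F′ i k j * G′ (a ∸ i) (c ∸ k) (b ∸ j))

  -ₛ-swap : ∀ {F F′ G G′} → F ⇄ F′ → G ⇄ G′ → F -ₛ G ⇄ F′ -ₛ G′
  -ₛ-swap p q .swapped a b c = cong₂ _-_ (swapped p a b c) (swapped q a b c)

  const-swap : ∀ q → const q ⇄ const q
  const-swap q .swapped zero    zero    zero    = refl
  const-swap q .swapped zero    zero    (suc _) = refl
  const-swap q .swapped zero    (suc _) zero    = refl
  const-swap q .swapped zero    (suc _) (suc _) = refl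
  const-swap q .swapped (suc _) _       _       = refl

  ^ₛ-swap : ∀ {F G} n → F ⇄ G → F ^ₛ n ⇄ G ^ₛ n
  ^ₛ-swap zero    p = const-swap 1ℚ
  ^ₛ-swap (suc n) p = *ₛ-swap p (^ₛ-swap n p)

  ∘ₛ-swap : ∀ f {F G} → F ⇄ G → f ∘ₛ F ⇄ f ∘ₛ G
  ∘ₛ-swap f {F} {G} p .swapped a b c = trans
    (∑≤-cong (a ℕ.+ b ℕ.+ c) λ i → cong (f i *_) (swapped (^ₛ-swap i p) a b c))
    (cong (λ N → ∑≤ N (λ i → f i * (G ^ₛ i) a c b)) (begin
      a ℕ.+ b ℕ.+ c    ≡⟨ ℕ.+-assoc a b c ⟩
      a ℕ.+ (b ℕ.+ c)  ≡⟨ cong (a ℕ.+_) (ℕ.+-comm b c) ⟩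
      a ℕ.+ (c ℕ.+ b)  ≡⟨ ℕ.+-assoc a c b ⟨
      a ℕ.+ c ℕ.+ b    ∎))

  t-swap : t ⇄ t
  t-swap .swapped zero          _       _       = refl
  t-swap .swapped (suc zero)    zero    zero    = refl
  t-swap .swapped (suc zero)    zero    (suc _) = refl
  t-swap .swapped (suc zero)    (suc _) zero    = refl
  t-swap .swapped (suc zero)    (suc _) (suc _) = refl
  t-swap .swapped (suc (suc _)) _       _       = refl

  v-swap : v ⇄ u
  v-swap .swapped zero    zero          zero          = refl
  v-swap .swapped zero    zero          (suc zero)    = refl
  v-swap .swapped zero    zero          (suc (suc _)) = refl
  v-swap .swapped zero    (suc _)       zero          = refl
  v-swap .swapped zero    (suc _)       (suc zero)    = refl
  v-swap .swapped zero    (suc _)       (suc (suc _)) = refl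
  v-swap .swapped (suc _) _             _             = refl

  𝟏-swap : ∀ k → 𝟏[ k ≡0] ⇄ 𝟏[ k ≡0]
  𝟏-swap zero    = const-swap 1ℚ
  𝟏-swap (suc _) = const-swap 0ℚ

  -- A series in t and u, given by the coefficients of the powers of u.
  ⟪_⟫ : (ℕ → ℚ⟦t⟧) → Series
  ⟪ f ⟫ a b zero    = f b a
  ⟪ f ⟫ a b (suc _) = 0ℚ

  ⟪⟫-cong : ∀ {f h} → (∀ b → f b ≗ h b) → ⟪ f ⟫ ≐ ⟪ h ⟫
  ⟪⟫-cong p .at a b zero    = p b a
  ⟪⟫-cong p .at a b (suc c) = refl

  infixl 7 _⊛_
  _⊛_ : (ℕ → ℚ⟦t⟧) → (ℕ → ℚ⟦t⟧) → ℕ → ℚ⟦t⟧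
  (f ⊛ h) b a = ∑≤ b (λ j → (f j ⊗ h (b ∸ j)) a)

  ⟪⟫-*ₛ : ∀ f h → ⟪ f ⟫ *ₛ ⟪ h ⟫ ≐ ⟪ f ⊛ h ⟫
  ⟪⟫-*ₛ f h .at a b zero = trans
    (∑≤-cong a λ i → ∑≤-cong b λ j → +-identityʳ (f j i * h (b ∸ j) (a ∸ i)))
    (∑≤-comm a b λ i j → f j i * h (b ∸ j) (a ∸ i))
  ⟪⟫-*ₛ f h .at a b (suc c) = ∑≤-zero a λ i → ∑≤-zero b λ j → trans
    (∑≤-head (suc c) (λ k → ⟪ f ⟫ i j k * ⟪ h ⟫ (a ∸ i) (b ∸ j) (suc c ∸ k)) (λ k → *-zeroˡ (⟪ h ⟫ (a ∸ i) (b ∸ j) (c ∸ k))))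
    (*-zeroʳ (f j i))

  -- The factors share only the variable t. Of the sums over the exponents of u and v just the term
  -- j = b, k = 0 survives.
  ⟪⟫-*ₛ-⇄ : ∀ f {G} h → G ⇄ ⟪ h ⟫ → ∀ a b c → (⟪ f ⟫ *ₛ G) a b c ≡ (f b ⊗ h c) a
  ⟪⟫-*ₛ-⇄ f {G} h p a b c = ∑≤-cong a λ i → trans
    (∑≤-cong b λ j → trans
      (∑≤-head c (λ k → ⟪ f ⟫ i j k * G (a ∸ i) (b ∸ j) (c ∸ k)) (λ k → *-zeroˡ (G (a ∸ i) (b ∸ j) (c ∸ suc k))))
      (cong (f j i *_) (swapped p (a ∸ i) (b ∸ j) c)))
    (∑≤-last b (λ j m → f j i * ⟪ h ⟫ (a ∸ i) c m) (λ j m → *-zeroʳ (f j i)))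

  [_]u^_ : ℚ⟦t⟧ → ℕ → ℕ → ℚ⟦t⟧
  ([ f ]u^ zero)  zero    = f
  ([ f ]u^ zero)  (suc b) = 𝟘
  ([ f ]u^ suc i) zero    = 𝟘
  ([ f ]u^ suc i) (suc b) = ([ f ]u^ i) b

  ⟪_⟫₀ : ℚ⟦t⟧ → Series
  ⟪ f ⟫₀ = ⟪ [ f ]u^ 0 ⟫

  *ₛ-⟪⟫₀ : ∀ F h a b c → (F *ₛ ⟪ h ⟫₀) a b c ≡ ((λ i → F i b c) ⊗ h) a
  *ₛ-⟪⟫₀ F h a b c = ∑≤-cong a λ i → trans
    (∑≤-cong b λ j → ∑≤-last c (λ k m → F i j k * ⟪ h ⟫₀ (a ∸ i) (b ∸ j) m) (λ k m → *-zeroʳ (F i j k)))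
    (∑≤-last b (λ j m → F i j c * ⟪ h ⟫₀ (a ∸ i) m 0) (λ j m → *-zeroʳ (F i j c)))

  ⟪⟫₀-*ₛ-⟪⟫ : ∀ f h → ⟪ f ⟫₀ *ₛ ⟪ h ⟫ ≐ ⟪ (λ b → f ⊗ h b) ⟫
  ⟪⟫₀-*ₛ-⟪⟫ f h = ≐-trans (⟪⟫-*ₛ ([ f ]u^ 0) h) (⟪⟫-cong λ b a →
    ∑≤-head b (λ j → (([ f ]u^ 0) j ⊗ h (b ∸ j)) a) (λ j → ⊗-zeroˡ (h (b ∸ suc j)) a))

  ⟪⟫₀-*ₛ : ∀ f h → ⟪ f ⟫₀ *ₛ ⟪ h ⟫₀ ≐ ⟪ f ⊗ h ⟫₀
  ⟪⟫₀-*ₛ f h = ≐-trans (⟪⟫₀-*ₛ-⟪⟫ f ([ h ]u^ 0))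
    (⟪⟫-cong λ { zero a → refl ; (suc b) a → trans (⊗-comm f 𝟘 a) (⊗-zeroˡ f a) })

  1ₛ≐ : 1ₛ ≐ ⟪ 𝟙 ⟫₀
  1ₛ≐ .at zero    zero    zero    = refl
  1ₛ≐ .at zero    zero    (suc _) = refl
  1ₛ≐ .at zero    (suc _) zero    = refl
  1ₛ≐ .at zero    (suc _) (suc _) = refl
  1ₛ≐ .at (suc _) zero    zero    = refl
  1ₛ≐ .at (suc _) zero    (suc _) = refl
  1ₛ≐ .at (suc _) (suc _) zero    = refl
  1ₛ≐ .at (suc _) (suc _) (suc _) = refl

  t≐ : t ≐ ⟪ X 𝟙 ⟫₀
  t≐ .at zero          zero    zero    = refl
  t≐ .at zero          zero    (suc _) = refl
  t≐ .at zero          (suc _) zero    = refl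
  t≐ .at zero          (suc _) (suc _) = refl
  t≐ .at (suc zero)    zero    zero    = refl
  t≐ .at (suc zero)    zero    (suc _) = refl
  t≐ .at (suc zero)    (suc _) zero    = refl
  t≐ .at (suc zero)    (suc _) (suc _) = refl
  t≐ .at (suc (suc _)) zero    zero    = refl
  t≐ .at (suc (suc _)) zero    (suc _) = refl
  t≐ .at (suc (suc _)) (suc _) zero    = refl
  t≐ .at (suc (suc _)) (suc _) (suc _) = refl

  u≐ : u ≐ ⟪ [ 𝟙 ]u^ 1 ⟫
  u≐ .at zero    zero          zero    = refl
  u≐ .at zero    zero          (suc _) = refl
  u≐ .at zero    (suc zero)    zero    = refl
  u≐ .at zero    (suc zero)    (suc _) = refl
  u≐ .at zero    (suc (suc _)) zero    = refl
  u≐ .at zero    (suc (suc _)) (suc _) = refl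
  u≐ .at (suc _) zero          zero    = refl
  u≐ .at (suc _) zero          (suc _) = refl
  u≐ .at (suc _) (suc zero)    zero    = refl
  u≐ .at (suc _) (suc zero)    (suc _) = refl
  u≐ .at (suc _) (suc (suc _)) zero    = refl
  u≐ .at (suc _) (suc (suc _)) (suc _) = refl

  ⟪⟫₀-^ₛ : ∀ f n → ⟪ f ⟫₀ ^ₛ n ≐ ⟪ f ^ₜ n ⟫₀
  ⟪⟫₀-^ₛ f zero    = 1ₛ≐
  ⟪⟫₀-^ₛ f (suc n) = ≐-trans (*ₛ-cong {⟪ f ⟫₀} ≐-refl (⟪⟫₀-^ₛ f n)) (⟪⟫₀-*ₛ f (f ^ₜ n))

  1-⟪⟫₀ : ∀ {F f} → F ≐ ⟪ f ⟫₀ → 1ₛ -ₛ F ≐ ⟪ 𝟙 ⊕ ⊝ f ⟫₀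
  1-⟪⟫₀ {F} {f} F≐ = ≐-trans (-ₛ-cong 1ₛ≐ F≐)
    λ { .at a zero zero → refl ; .at a zero (suc c) → refl ; .at a (suc b) zero → refl ; .at a (suc b) (suc c) → refl }

  geometric-∘ₛ : ∀ {F y} → F ≐ ⟪ y ⟫₀ → y 0 ≡ 0ℚ → (λ _ → 1ℚ) ∘ₛ F ≐ ⟪ geometric y ⟫₀
  geometric-∘ₛ {F} {y} F≐ y₀≡0 .at a b c = trans
    (∑≤-cong (a ℕ.+ b ℕ.+ c) λ i → trans (*-identityˡ ((F ^ₛ i) a b c)) (trans (at (^ₛ-cong i F≐) a b c) (at (⟪⟫₀-^ₛ y i) a b c)))
    (sums b c)
    where
    sums : ∀ b c → ∑≤ (a ℕ.+ b ℕ.+ c) (λ i → ⟪ y ^ₜ i ⟫₀ a b c) ≡ ⟪ geometric y ⟫₀ a b c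
    sums zero    zero    = trans (cong (λ N → ∑≤ N (λ i → (y ^ₜ i) a)) (ℕ.+-assoc a 0 0)) (geometric-≥ y y₀≡0 a 0)
    sums (suc b) zero    = ∑≤-zero (a ℕ.+ suc b ℕ.+ 0) λ _ → refl
    sums zero    (suc c) = ∑≤-zero (a ℕ.+ 0 ℕ.+ suc c) λ _ → refl
    sums (suc b) (suc c) = ∑≤-zero (a ℕ.+ suc b ℕ.+ suc c) λ _ → refl

  -- A divisor in t alone acts on each coefficient of u^b v^c separately, and the geometric series
  -- of 1 - d is the inverse of d.
  /ₛ-cancel : ∀ {F D d f} b c → D ≐ ⟪ d ⟫₀ → d 0 ≡ 1ℚ → (∀ a → F a b c ≡ (f ⊗ d) a) → ∀ a → (F /ₛ D) a b c ≡ f a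
  /ₛ-cancel {F} {D} {d} {f} b c D≐ d₀≡1 F≐ a = begin
    (F /ₛ D) a b c                       ≡⟨ at (*ₛ-cong {F} ≐-refl (geometric-∘ₛ (1-⟪⟫₀ D≐) y₀≡0)) a b c ⟩
    (F *ₛ ⟪ geometric y ⟫₀) a b c        ≡⟨ *ₛ-⟪⟫₀ F (geometric y) a b c ⟩
    ((λ i → F i b c) ⊗ geometric y) a    ≡⟨ ⊗-cong {h = geometric y} F≐ (λ _ → refl) a ⟩
    ((f ⊗ d) ⊗ geometric y) a            ≡⟨ ⊗-assoc f d (geometric y) a ⟩
    (f ⊗ (d ⊗ geometric y)) a            ≡⟨ ⊗-cong {f} (λ _ → refl) inverse a ⟩
    (f ⊗ 𝟙) a                            ≡⟨ ⊗-comm f 𝟙 a ⟩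
    (𝟙 ⊗ f) a                            ≡⟨ ⊗-identityˡ f a ⟩
    f a                                  ∎
    where
    y = 𝟙 ⊕ ⊝ d
    y₀≡0 : y 0 ≡ 0ℚ
    y₀≡0 = cong (λ x → 1ℚ + - x) d₀≡1
    inverse : d ⊗ geometric y ≗ 𝟙
    inverse n = trans (⊗-cong {h = geometric y} (λ i → solve 2 (λ x z → x := z :+ :- (z :+ :- x)) refl (d i) (𝟙 i)) (λ _ → refl) n)
      (geometric-inverse y y₀≡0 n)

  -- The generating function

  1-t : ℚ⟦t⟧
  1-t = 𝟙 ⊕ ⊝ X 𝟙

  1-t≐ : 1ₛ -ₛ t ≐ ⟪ 1-t ⟫₀
  1-t≐ = 1-⟪⟫₀ t≐

  1-t^-₀ : ∀ n → (1-t ^ₜ n) 0 ≡ 1ℚ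
  1-t^-₀ zero    = refl
  1-t^-₀ (suc n) = trans (+-identityʳ (1ℚ * (1-t ^ₜ n) 0)) (trans (*-identityˡ ((1-t ^ₜ n) 0)) (1-t^-₀ n))

  -- The substitution of (1 - t) u for u.
  ⟪_⟫₁₋ₜ : (ℕ → ℚ⟦t⟧) → Series
  ⟪ f ⟫₁₋ₜ = ⟪ (λ b → f b ⊗ 1-t ^ₜ b) ⟫

  ⟪⟫₁₋ₜ-cong : ∀ f h → (∀ b → f b ≗ h b) → ⟪ f ⟫₁₋ₜ ≐ ⟪ h ⟫₁₋ₜ
  ⟪⟫₁₋ₜ-cong f h p = ⟪⟫-cong {λ b → f b ⊗ 1-t ^ₜ b} {λ b → h b ⊗ 1-t ^ₜ b} λ b → ⊗-cong {f b} {h b} {1-t ^ₜ b} (p b) (λ _ → refl)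

  -- The substitution respects products: (1 - t)^j (1 - t)^(b-j) is (1 - t)^b for every j and comes
  -- out of the sum over j.
  ⟪⟫₁₋ₜ-*ₛ : ∀ f h → ⟪ f ⟫₁₋ₜ *ₛ ⟪ h ⟫₁₋ₜ ≐ ⟪ f ⊛ h ⟫₁₋ₜ
  ⟪⟫₁₋ₜ-*ₛ f h = ≐-trans (⟪⟫-*ₛ (λ b → f b ⊗ 1-t ^ₜ b) (λ b → h b ⊗ 1-t ^ₜ b)) (⟪⟫-cong λ b a → trans
    (∑≤-cong-≤ b λ j j≤b → trans
      (⊗-interchange (f j) (1-t ^ₜ j) (h (b ∸ j)) (1-t ^ₜ (b ∸ j)) a)
      (⊗-cong {f j ⊗ h (b ∸ j)} (λ _ → refl) (λ i → trans
        (sym (^ₜ-homo-⊗ 1-t j (b ∸ j) i))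
        (cong (λ n → (1-t ^ₜ n) i) (ℕ.m+[n∸m]≡n j≤b))) a))
    (∑≤-⊗ b (λ j → f j ⊗ h (b ∸ j)) (1-t ^ₜ b) a))

  ⟪⟫₀≐⟪⟫₁₋ₜ : ∀ f → ⟪ f ⟫₀ ≐ ⟪ [ f ]u^ 0 ⟫₁₋ₜ
  ⟪⟫₀≐⟪⟫₁₋ₜ f = ⟪⟫-cong λ
    { zero    a → sym (trans (⊗-comm f 𝟙 a) (⊗-identityˡ f a))
    ; (suc b) a → sym (⊗-zeroˡ (1-t ^ₜ suc b) a)
    }

  ⟪⟫₁₋ₜ-^ₛ2 : ∀ f → ⟪ f ⟫₁₋ₜ ^ₛ 2 ≐ ⟪ f ⊛ f ⟫₁₋ₜ
  ⟪⟫₁₋ₜ-^ₛ2 f = ≐-trans (*ₛ-cong {⟪ f ⟫₁₋ₜ} ≐-refl F*1) (⟪⟫₁₋ₜ-*ₛ f f)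
    where
    -- `F ^ₛ 2` unfolds to `F *ₛ (F *ₛ 1ₛ)`, whose last factor has to be removed.
    F*1 : ⟪ f ⟫₁₋ₜ *ₛ 1ₛ ≐ ⟪ f ⟫₁₋ₜ
    F*1 .at a b c = begin
      (⟪ f ⟫₁₋ₜ *ₛ 1ₛ) a b c              ≡⟨ at (*ₛ-cong {⟪ f ⟫₁₋ₜ} ≐-refl 1ₛ≐) a b c ⟩
      (⟪ f ⟫₁₋ₜ *ₛ ⟪ 𝟙 ⟫₀) a b c          ≡⟨ *ₛ-⟪⟫₀ ⟪ f ⟫₁₋ₜ 𝟙 a b c ⟩
      ((λ i → ⟪ f ⟫₁₋ₜ i b c) ⊗ 𝟙) a      ≡⟨ ⊗-comm (λ i → ⟪ f ⟫₁₋ₜ i b c) 𝟙 a ⟩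
      (𝟙 ⊗ (λ i → ⟪ f ⟫₁₋ₜ i b c)) a      ≡⟨ ⊗-identityˡ (λ i → ⟪ f ⟫₁₋ₜ i b c) a ⟩
      ⟪ f ⟫₁₋ₜ a b c                      ∎

  [1-t]u≐ : (1ₛ -ₛ t) *ₛ u ≐ ⟪ [ 1-t ]u^ 1 ⟫
  [1-t]u≐ = ≐-trans (*ₛ-cong 1-t≐ u≐) (≐-trans (⟪⟫₀-*ₛ-⟪⟫ 1-t ([ 𝟙 ]u^ 1)) (⟪⟫-cong λ
    { zero          a → 1-t*𝟘 a
    ; (suc zero)    a → trans (⊗-comm 1-t 𝟙 a) (⊗-identityˡ 1-t a)
    ; (suc (suc b)) a → 1-t*𝟘 a
    }))
    where
    1-t*𝟘 : 1-t ⊗ 𝟘 ≗ 𝟘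
    1-t*𝟘 a = trans (⊗-comm 1-t 𝟘 a) (⊗-zeroˡ 1-t a)

  []u^1-⊛ : ∀ f i h b → ([ f ]u^ 1 ⊛ [ h ]u^ i) b ≗ ([ f ⊗ h ]u^ suc i) b
  []u^1-⊛ f i h zero    a = trans (+-identityʳ ((𝟘 ⊗ ([ h ]u^ i) 0) a)) (⊗-zeroˡ (([ h ]u^ i) 0) a)
  []u^1-⊛ f i h (suc b) a = begin
    (𝟘 ⊗ ([ h ]u^ i) (suc b)) a + ∑≤ b φ     ≡⟨ cong₂ _+_ (⊗-zeroˡ (([ h ]u^ i) (suc b)) a) (∑≤-head b φ (λ j → ⊗-zeroˡ (([ h ]u^ i) (b ∸ suc j)) a)) ⟩
    0ℚ + (f ⊗ ([ h ]u^ i) b) a               ≡⟨ +-identityˡ ((f ⊗ ([ h ]u^ i) b) a) ⟩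
    (f ⊗ ([ h ]u^ i) b) a                    ≡⟨ ⊗-[]u^ i b a ⟩
    ([ f ⊗ h ]u^ i) b a                      ∎
    where
    φ : ℕ → ℚ
    φ j = (([ f ]u^ 1) (suc j) ⊗ ([ h ]u^ i) (b ∸ j)) a
    f*𝟘 : f ⊗ 𝟘 ≗ 𝟘
    f*𝟘 a = trans (⊗-comm f 𝟘 a) (⊗-zeroˡ f a)
    ⊗-[]u^ : ∀ i b → f ⊗ ([ h ]u^ i) b ≗ ([ f ⊗ h ]u^ i) b
    ⊗-[]u^ zero    zero    a = refl
    ⊗-[]u^ zero    (suc b) a = f*𝟘 a
    ⊗-[]u^ (suc i) zero    a = f*𝟘 a
    ⊗-[]u^ (suc i) (suc b) a = ⊗-[]u^ i b a

  [1-t]u^≐ : ∀ i → ((1ₛ -ₛ t) *ₛ u) ^ₛ i ≐ ⟪ [ 1-t ^ₜ i ]u^ i ⟫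
  [1-t]u^≐ zero    = 1ₛ≐
  [1-t]u^≐ (suc i) = ≐-trans (*ₛ-cong [1-t]u≐ ([1-t]u^≐ i))
    (≐-trans (⟪⟫-*ₛ ([ 1-t ]u^ 1) ([ 1-t ^ₜ i ]u^ i)) (⟪⟫-cong ([]u^1-⊛ 1-t i (1-t ^ₜ i))))

  ∑≤-[]u^ : ∀ N (c : ℕ → ℚ) (f : ℕ → ℚ⟦t⟧) b a → b ≤ N → ∑≤ N (λ i → c i * ([ f i ]u^ i) b a) ≡ c b * f b a
  ∑≤-[]u^ N       c f zero    a _         = ∑≤-head N (λ i → c i * ([ f i ]u^ i) 0 a) (λ i → *-zeroʳ (c (suc i)))
  ∑≤-[]u^ (suc N) c f (suc b) a (s≤s b≤N) = trans
    (cong₂ _+_ (*-zeroʳ (c 0)) (∑≤-[]u^ N (c ∘ suc) (f ∘ suc) b a b≤N))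
    (+-identityˡ (c (suc b) * f (suc b) a))

  exp[1-t]u≐ : exp ((1ₛ -ₛ t) *ₛ u) ≐ ⟪ (λ b → 1/ b ! • 1-t ^ₜ b) ⟫
  exp[1-t]u≐ .at a b c = trans (∑≤-cong (a ℕ.+ b ℕ.+ c) λ i → cong (1/ i ! *_) (at ([1-t]u^≐ i) a b c)) (sums c)
    where
    sums : ∀ c → ∑≤ (a ℕ.+ b ℕ.+ c) (λ i → 1/ i ! * ⟪ [ 1-t ^ₜ i ]u^ i ⟫ a b c) ≡ ⟪ (λ b → 1/ b ! • 1-t ^ₜ b) ⟫ a b c
    sums zero    = ∑≤-[]u^ (a ℕ.+ b ℕ.+ 0) 1/_! (1-t ^ₜ_) b a (ℕ.≤-trans (ℕ.m≤n+m b a) (ℕ.m≤m+n (a ℕ.+ b) 0))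
    sums (suc c) = ∑≤-zero (a ℕ.+ b ℕ.+ suc c) λ i → *-zeroʳ (1/ i !)

  1^ : ∀ n → 1ℚ ^ n ≡ 1ℚ
  1^ zero    = refl
  1^ (suc n) = trans (*-identityˡ (1ℚ ^ n)) (1^ n)

  𝕖-0-suc : ∀ b → 𝕖 0ℚ (suc b) ≡ 0ℚ
  𝕖-0-suc b = trans (cong (1/ suc b ! *_) (*-zeroˡ (0ℚ ^ b))) (*-zeroʳ (1/ suc b !))

  -- The coefficient of u^b in (t e^u)^i.
  te^ : ℕ → ℕ → ℚ⟦t⟧
  te^ i b = 𝕖 (ι i) b • X^ i 𝟙

  𝟙≗te^0 : ∀ b → ([ 𝟙 ]u^ 0) b ≗ te^ 0 b
  𝟙≗te^0 zero    a = sym (*-identityˡ (𝟙 a))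
  𝟙≗te^0 (suc b) a = sym (trans (cong (_* 𝟙 a) (𝕖-0-suc b)) (*-zeroˡ (𝟙 a)))

  te^1-⊛ : ∀ i b → (te^ 1 ⊛ te^ i) b ≗ te^ (suc i) b
  te^1-⊛ i b a = begin
    ∑≤ b (λ j → (te^ 1 j ⊗ te^ i (b ∸ j)) a)
      ≡⟨ ∑≤-cong b (λ j → •-⊗-• (𝕖 (ι 1) j) (𝕖 (ι i) (b ∸ j)) (X 𝟙) (X^ i 𝟙) a) ⟩
    ∑≤ b (λ j → 𝕖 (ι 1) j * 𝕖 (ι i) (b ∸ j) * (X 𝟙 ⊗ X^ i 𝟙) a)
      ≡⟨ ∑≤-* b ((X 𝟙 ⊗ X^ i 𝟙) a) (λ j → 𝕖 (ι 1) j * 𝕖 (ι i) (b ∸ j)) ⟨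
    (𝕖 (ι 1) ⊗ 𝕖 (ι i)) b * (X 𝟙 ⊗ X^ i 𝟙) a
      ≡⟨ cong₂ _*_ (trans (𝕖-+ (ι 1) (ι i) b) (cong (λ x → 𝕖 x b) (sym (ι-+ 1 i))))
           (trans (X-⊗ 𝟙 (X^ i 𝟙) a) (X-cong (⊗-identityˡ (X^ i 𝟙)) a)) ⟩
    te^ (suc i) b a ∎

  t*exp≐ : t *ₛ exp ((1ₛ -ₛ t) *ₛ u) ≐ ⟪ te^ 1 ⟫₁₋ₜ
  t*exp≐ = ≐-trans (*ₛ-cong t≐ exp[1-t]u≐) (≐-trans (⟪⟫₀-*ₛ-⟪⟫ (X 𝟙) (λ b → 1/ b ! • 1-t ^ₜ b)) (⟪⟫-cong λ b a → begin
    (X 𝟙 ⊗ (1/ b ! • 1-t ^ₜ b)) a     ≡⟨ ⊗-comm (X 𝟙) (1/ b ! • 1-t ^ₜ b) a ⟩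
    ((1/ b ! • 1-t ^ₜ b) ⊗ X 𝟙) a     ≡⟨ •-⊗ (1/ b !) (1-t ^ₜ b) (X 𝟙) a ⟩
    1/ b ! * (1-t ^ₜ b ⊗ X 𝟙) a       ≡⟨ cong₂ _*_ (trans (sym (*-identityʳ (1/ b !))) (cong (1/ b ! *_) (sym (1^ b)))) (⊗-comm (1-t ^ₜ b) (X 𝟙) a) ⟩
    𝕖 (ι 1) b * (X 𝟙 ⊗ 1-t ^ₜ b) a    ≡⟨ •-⊗ (𝕖 (ι 1) b) (X 𝟙) (1-t ^ₜ b) a ⟨
    (te^ 1 b ⊗ 1-t ^ₜ b) a            ∎))

  -- Stated for a variable F, since the unifier unfolds the sums of a concrete one.
  ^ₛ-suc : ∀ F n {G H} → F ≐ G → F ^ₛ n ≐ H → F ^ₛ suc n ≐ G *ₛ H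
  ^ₛ-suc F n = *ₛ-cong

  t*exp^≐ : ∀ i → (t *ₛ exp ((1ₛ -ₛ t) *ₛ u)) ^ₛ i ≐ ⟪ te^ i ⟫₁₋ₜ
  t*exp^≐ zero    = ≐-trans 1ₛ≐ (≐-trans (⟪⟫₀≐⟪⟫₁₋ₜ 𝟙) (⟪⟫₁₋ₜ-cong ([ 𝟙 ]u^ 0) (te^ 0) 𝟙≗te^0))
  t*exp^≐ (suc i) = ≐-trans (^ₛ-suc (t *ₛ exp ((1ₛ -ₛ t) *ₛ u)) i t*exp≐ (t*exp^≐ i))
    (≐-trans (⟪⟫₁₋ₜ-*ₛ (te^ 1) (te^ i)) (⟪⟫₁₋ₜ-cong (te^ 1 ⊛ te^ i) (te^ (suc i)) (te^1-⊛ i)))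

  -- The coefficients of u^b in g_k (t e^u), without and with the constant term 0^k.
  ge ge⁺ : ℕ → ℕ → ℚ⟦t⟧
  ge  k b i = ι (i ℕ.^ k) * 𝕖 (ι i) b
  ge⁺ k b   = ge k b ∘ suc

  -- The i-th power contributes i^k (i^b / b!) t^i (1 - t)^b to u^b, so that the sum over i
  -- multiplies (1 - t)^b by the series with coefficients `ge k b i`.
  g∘≐ : ∀ k → g k ∘ₛ (t *ₛ exp ((1ₛ -ₛ t) *ₛ u)) ≐ ⟪ ge k ⟫₁₋ₜ
  g∘≐ k .at a b c = trans (∑≤-cong (a ℕ.+ b ℕ.+ c) λ i → cong (g k i *_) (at (t*exp^≐ i) a b c)) (sums c)
    where
    sums : ∀ c → ∑≤ (a ℕ.+ b ℕ.+ c) (λ i → ι (i ℕ.^ k) * ⟪ te^ i ⟫₁₋ₜ a b c) ≡ ⟪ ge k ⟫₁₋ₜ a b c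
    sums zero    = begin
      ∑≤ (a ℕ.+ b ℕ.+ 0) (λ i → ι (i ℕ.^ k) * (te^ i b ⊗ 1-t ^ₜ b) a)
        ≡⟨ cong (λ N → ∑≤ N (λ i → ι (i ℕ.^ k) * (te^ i b ⊗ 1-t ^ₜ b) a)) (ℕ.+-assoc a b 0) ⟩
      ∑≤ (a ℕ.+ (b ℕ.+ 0)) (λ i → ι (i ℕ.^ k) * (te^ i b ⊗ 1-t ^ₜ b) a)
        ≡⟨ ∑≤-cong (a ℕ.+ (b ℕ.+ 0)) term ⟩
      ∑≤ (a ℕ.+ (b ℕ.+ 0)) (λ i → ge k b i * X^ i (1-t ^ₜ b) a)
        ≡⟨ ∑-X^ (ge k b) (1-t ^ₜ b) a (b ℕ.+ 0) ⟩
      (ge k b ⊗ 1-t ^ₜ b) a ∎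
      where
      term : ∀ i → ι (i ℕ.^ k) * (te^ i b ⊗ 1-t ^ₜ b) a ≡ ge k b i * X^ i (1-t ^ₜ b) a
      term i = begin
        ι (i ℕ.^ k) * (te^ i b ⊗ 1-t ^ₜ b) a   ≡⟨ cong (ι (i ℕ.^ k) *_) (•-⊗ (𝕖 (ι i) b) (X^ i 𝟙) (1-t ^ₜ b) a) ⟩
        ι (i ℕ.^ k) * (𝕖 (ι i) b * (X^ i 𝟙 ⊗ 1-t ^ₜ b) a)   ≡⟨ *-assoc (ι (i ℕ.^ k)) (𝕖 (ι i) b) ((X^ i 𝟙 ⊗ 1-t ^ₜ b) a) ⟨
        ge k b i * (X^ i 𝟙 ⊗ 1-t ^ₜ b) a                    ≡⟨ cong (ge k b i *_) (X^-⊗ i) ⟩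
        ge k b i * X^ i (1-t ^ₜ b) a                        ∎
        where
        X^-⊗ : ∀ i → (X^ i 𝟙 ⊗ 1-t ^ₜ b) a ≡ X^ i (1-t ^ₜ b) a
        X^-⊗ i = trans (⊗-comm (X^ i 𝟙) (1-t ^ₜ b) a) (trans (⊗-X^ i (1-t ^ₜ b) 𝟙 a)
          (X^-cong i (λ n → trans (⊗-comm (1-t ^ₜ b) 𝟙 n) (⊗-identityˡ (1-t ^ₜ b) n)) a))
    sums (suc c) = ∑≤-zero (a ℕ.+ b ℕ.+ suc c) λ i → *-zeroʳ (ι (i ℕ.^ k))

  -- The constant term of `ge k b` is 0^k 0^b / b!, which is 1 for k = b = 0 and 0 otherwise. The
  -- indicator removes precisely this and leaves a series divisible by t.
  g∘-𝟏≐ : ∀ k → g k ∘ₛ (t *ₛ exp ((1ₛ -ₛ t) *ₛ u)) -ₛ 𝟏[ k ≡0] ≐ ⟪ (λ b → X (ge⁺ k b)) ⟫₁₋ₜ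
  g∘-𝟏≐ k = ≐-trans (-ₛ-cong {G = 𝟏[ k ≡0]} (g∘≐ k) (𝟏≐ k)) λ
    { .at a b zero → begin
        (ge k b ⊗ 1-t ^ₜ b) a - (one k b ⊗ 1-t ^ₜ b) a
          ≡⟨ solve 2 (λ x y → x :+ :- y := x :+ con (- 1ℚ) :* y) refl ((ge k b ⊗ 1-t ^ₜ b) a) ((one k b ⊗ 1-t ^ₜ b) a) ⟩
        (ge k b ⊗ 1-t ^ₜ b) a + - 1ℚ * (one k b ⊗ 1-t ^ₜ b) a
          ≡⟨ cong (λ s → (ge k b ⊗ 1-t ^ₜ b) a + s) (•-⊗ (- 1ℚ) (one k b) (1-t ^ₜ b) a) ⟨
        (ge k b ⊗ 1-t ^ₜ b) a + ((- 1ℚ • one k b) ⊗ 1-t ^ₜ b) a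
          ≡⟨ ⊗-distribʳ (1-t ^ₜ b) (ge k b) (- 1ℚ • one k b) a ⟨
        ((ge k b ⊕ - 1ℚ • one k b) ⊗ 1-t ^ₜ b) a
          ≡⟨ ⊗-cong {h = 1-t ^ₜ b} (difference k b) (λ _ → refl) a ⟩
        (X (ge⁺ k b) ⊗ 1-t ^ₜ b) a ∎
    ; .at a b (suc c) → refl
    }
    where
    one : ℕ → ℕ → ℚ⟦t⟧
    one zero    = [ 𝟙 ]u^ 0
    one (suc k) = [ 𝟘 ]u^ 0
    0ₛ≐ : 0ₛ ≐ ⟪ [ 𝟘 ]u^ 0 ⟫
    0ₛ≐ .at zero    zero    zero    = refl
    0ₛ≐ .at zero    zero    (suc _) = refl
    0ₛ≐ .at zero    (suc _) zero    = refl
    0ₛ≐ .at zero    (suc _) (suc _) = refl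
    0ₛ≐ .at (suc _) zero    zero    = refl
    0ₛ≐ .at (suc _) zero    (suc _) = refl
    0ₛ≐ .at (suc _) (suc _) zero    = refl
    0ₛ≐ .at (suc _) (suc _) (suc _) = refl
    𝟏≐ : ∀ k → 𝟏[ k ≡0] ≐ ⟪ one k ⟫₁₋ₜ
    𝟏≐ zero    = ≐-trans 1ₛ≐ (⟪⟫₀≐⟪⟫₁₋ₜ 𝟙)
    𝟏≐ (suc k) = ≐-trans 0ₛ≐ (⟪⟫₀≐⟪⟫₁₋ₜ 𝟘)
    minus-0 : ∀ x → x + - 1ℚ * 0ℚ ≡ x
    minus-0 x = solve 1 (λ x → x :+ con (- 1ℚ) :* con 0ℚ := x) refl x
    difference : ∀ k b → ge k b ⊕ - 1ℚ • one k b ≗ X (ge⁺ k b)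
    difference zero    zero    zero    = refl
    difference zero    zero    (suc i) = minus-0 (ge 0 0 (suc i))
    difference zero    (suc b) zero    = trans (minus-0 (1ℚ * 𝕖 (ι 0) (suc b))) (cong (1ℚ *_) (𝕖-0-suc b))
    difference zero    (suc b) (suc i) = minus-0 (ge 0 (suc b) (suc i))
    difference (suc k) zero    zero    = refl
    difference (suc k) zero    (suc i) = minus-0 (ge (suc k) 0 (suc i))
    difference (suc k) (suc b) zero    = trans (minus-0 (0ℚ * 𝕖 (ι 0) (suc b))) (*-zeroˡ (𝕖 (ι 0) (suc b)))
    difference (suc k) (suc b) (suc i) = minus-0 (ge (suc k) (suc b) (suc i))

  ℕ^-distrib-* : ∀ x y n → (x ℕ.* y) ℕ.^ n ≡ x ℕ.^ n ℕ.* y ℕ.^ n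
  ℕ^-distrib-* x y zero    = refl
  ℕ^-distrib-* x y (suc n) = trans (cong (x ℕ.* y ℕ.*_) (ℕ^-distrib-* x y n)) (ℕ*-interchange x y (x ℕ.^ n) (y ℕ.^ n))

  -- The coefficient of u^k in (g_k (t e^u) - 1_{k=0})², divided by t².
  U : ℕ → ℚ⟦t⟧
  U k i = 1/ k ! * ∑≤ i (λ p → ι ((suc p ℕ.* suc (i ∸ p) ℕ.* suc (suc i)) ℕ.^ k))

  -- In x^k e^(xu) y^k e^(yu) the coefficient of u^k is (x y)^k (x + y)^k / k!. That u carries the
  -- same exponent as the index of g makes this a single k-th power.
  square-coefficient : ∀ k → ((λ b → X (ge⁺ k b)) ⊛ (λ b → X (ge⁺ k b))) k ≗ X (X (U k))
  square-coefficient k a = trans (∑≤-cong k λ j → trans (X-⊗ (ge⁺ k j) (X (ge⁺ k (k ∸ j))) a) (X-cong (⊗-X (ge⁺ k j) (ge⁺ k (k ∸ j))) a)) (go a)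
    where
    summand : ∀ i p → p ≤ i → ∑≤ k (λ j → ge⁺ k j p * ge⁺ k (k ∸ j) (i ∸ p)) ≡ 1/ k ! * ι ((suc p ℕ.* suc (i ∸ p) ℕ.* suc (suc i)) ℕ.^ k)
    summand i p p≤i = begin
      ∑≤ k (λ j → ι x^k * 𝕖 (ι x) j * (ι y^k * 𝕖 (ι y) (k ∸ j)))
        ≡⟨ ∑≤-cong k (λ j → solve 4 (λ a b c d → a :* b :* (c :* d) := a :* c :* (b :* d)) refl (ι x^k) (𝕖 (ι x) j) (ι y^k) (𝕖 (ι y) (k ∸ j))) ⟩
      ∑≤ k (λ j → ι x^k * ι y^k * (𝕖 (ι x) j * 𝕖 (ι y) (k ∸ j)))
        ≡⟨ *-∑≤ k (ι x^k * ι y^k) (λ j → 𝕖 (ι x) j * 𝕖 (ι y) (k ∸ j)) ⟨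
      ι x^k * ι y^k * (𝕖 (ι x) ⊗ 𝕖 (ι y)) k
        ≡⟨ cong (ι x^k * ι y^k *_) (𝕖-+ (ι x) (ι y) k) ⟩
      ι x^k * ι y^k * (1/ k ! * (ι x + ι y) ^ k)
        ≡⟨ cong₂ (λ s r → s * (1/ k ! * r)) (sym (ι-* x^k y^k)) (trans (cong (_^ k) (sym (ι-+ x y))) (sym (ι-^ (x ℕ.+ y) k))) ⟩
      ι (x^k ℕ.* y^k) * (1/ k ! * ι ((x ℕ.+ y) ℕ.^ k))
        ≡⟨ solve 3 (λ a b c → a :* (b :* c) := b :* (a :* c)) refl (ι (x^k ℕ.* y^k)) (1/ k !) (ι ((x ℕ.+ y) ℕ.^ k)) ⟩
      1/ k ! * (ι (x^k ℕ.* y^k) * ι ((x ℕ.+ y) ℕ.^ k))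
        ≡⟨ cong (1/ k ! *_) (ι-* (x^k ℕ.* y^k) ((x ℕ.+ y) ℕ.^ k)) ⟨
      1/ k ! * ι (x^k ℕ.* y^k ℕ.* (x ℕ.+ y) ℕ.^ k)
        ≡⟨ cong (λ s → 1/ k ! * ι s) (trans (cong (ℕ._* (x ℕ.+ y) ℕ.^ k) (sym (ℕ^-distrib-* x y k))) (sym (ℕ^-distrib-* (x ℕ.* y) (x ℕ.+ y) k))) ⟩
      1/ k ! * ι ((x ℕ.* y ℕ.* (x ℕ.+ y)) ℕ.^ k)
        ≡⟨ cong (λ s → 1/ k ! * ι ((x ℕ.* y ℕ.* s) ℕ.^ k)) (cong suc (trans (ℕ.+-suc p (i ∸ p)) (cong suc (ℕ.m+[n∸m]≡n p≤i)))) ⟩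
      1/ k ! * ι ((x ℕ.* y ℕ.* suc (suc i)) ℕ.^ k) ∎
      where
      x = suc p
      y = suc (i ∸ p)
      x^k = x ℕ.^ k
      y^k = y ℕ.^ k
    go : ∀ a → ∑≤ k (λ j → X (X (ge⁺ k j ⊗ ge⁺ k (k ∸ j))) a) ≡ X (X (U k)) a
    go zero          = ∑≤-zero k λ _ → refl
    go (suc zero)    = ∑≤-zero k λ _ → refl
    go (suc (suc i)) = begin
      ∑≤ k (λ j → ∑≤ i (λ p → ge⁺ k j p * ge⁺ k (k ∸ j) (i ∸ p)))       ≡⟨ ∑≤-comm k i (λ j p → ge⁺ k j p * ge⁺ k (k ∸ j) (i ∸ p)) ⟩
      ∑≤ i (λ p → ∑≤ k (λ j → ge⁺ k j p * ge⁺ k (k ∸ j) (i ∸ p)))       ≡⟨ ∑≤-cong-≤ i (summand i) ⟩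
      ∑≤ i (λ p → 1/ k ! * ι ((suc p ℕ.* suc (i ∸ p) ℕ.* suc (suc i)) ℕ.^ k))
        ≡⟨ *-∑≤ i (1/ k !) (λ p → ι ((suc p ℕ.* suc (i ∸ p) ℕ.* suc (suc i)) ℕ.^ k)) ⟨
      U k i ∎

  -- The weights (1 - t)^k and (1 - t)^ℓ that accompany u^k and v^ℓ multiply to the denominator and
  -- cancel against it.
  product-coefficient : ∀ F G f h k ℓ n → F ≐ ⟪ f ⟫₁₋ₜ → G ⇄ ⟪ h ⟫₁₋ₜ →
    (F ^ₛ 2 *ₛ G ^ₛ 2 /ₛ (1ₛ -ₛ t) ^ₛ (k ℕ.+ ℓ)) n k ℓ ≡ ((f ⊛ f) k ⊗ (h ⊛ h) ℓ) n
  product-coefficient F G f h k ℓ n F≐ G⇄ =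
    /ₛ-cancel {F ^ₛ 2 *ₛ G ^ₛ 2} {(1ₛ -ₛ t) ^ₛ (k ℕ.+ ℓ)} {1-t ^ₜ (k ℕ.+ ℓ)} {(f ⊛ f) k ⊗ (h ⊛ h) ℓ} k ℓ
      (≐-trans (^ₛ-cong (k ℕ.+ ℓ) 1-t≐) (⟪⟫₀-^ₛ 1-t (k ℕ.+ ℓ)))
      (1-t^-₀ (k ℕ.+ ℓ)) numerator n
    where
    F²≐ : F ^ₛ 2 ≐ ⟪ f ⊛ f ⟫₁₋ₜ
    F²≐ = ≐-trans (^ₛ-cong 2 F≐) (⟪⟫₁₋ₜ-^ₛ2 f)
    G²⇄ : G ^ₛ 2 ⇄ ⟪ h ⊛ h ⟫₁₋ₜ
    G²⇄ = ⇄-≐-trans (^ₛ-swap 2 G⇄) (⟪⟫₁₋ₜ-^ₛ2 h)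
    numerator : ∀ a → (F ^ₛ 2 *ₛ G ^ₛ 2) a k ℓ ≡ (((f ⊛ f) k ⊗ (h ⊛ h) ℓ) ⊗ 1-t ^ₜ (k ℕ.+ ℓ)) a
    numerator a = begin
      (F ^ₛ 2 *ₛ G ^ₛ 2) a k ℓ                                          ≡⟨ at (*ₛ-cong {G = G ^ₛ 2} F²≐ ≐-refl) a k ℓ ⟩
      (⟪ f ⊛ f ⟫₁₋ₜ *ₛ G ^ₛ 2) a k ℓ
        ≡⟨ ⟪⟫-*ₛ-⇄ (λ b → (f ⊛ f) b ⊗ 1-t ^ₜ b) (λ b → (h ⊛ h) b ⊗ 1-t ^ₜ b) G²⇄ a k ℓ ⟩
      (((f ⊛ f) k ⊗ 1-t ^ₜ k) ⊗ ((h ⊛ h) ℓ ⊗ 1-t ^ₜ ℓ)) a               ≡⟨ ⊗-interchange ((f ⊛ f) k) (1-t ^ₜ k) ((h ⊛ h) ℓ) (1-t ^ₜ ℓ) a ⟩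
      (((f ⊛ f) k ⊗ (h ⊛ h) ℓ) ⊗ (1-t ^ₜ k ⊗ 1-t ^ₜ ℓ)) a
        ≡⟨ ⊗-cong {(f ⊛ f) k ⊗ (h ⊛ h) ℓ} (λ _ → refl) (λ i → sym (^ₜ-homo-⊗ 1-t k ℓ i)) a ⟩
      (((f ⊛ f) k ⊗ (h ⊛ h) ℓ) ⊗ 1-t ^ₜ (k ℕ.+ ℓ)) a                    ∎

  exp-swap : ∀ {F G} → F ⇄ G → exp F ⇄ exp G
  exp-swap {F} {G} p = ∘ₛ-swap 1/_! {F} {G} p

  [1-t]v-swap : (1ₛ -ₛ t) *ₛ v ⇄ (1ₛ -ₛ t) *ₛ u
  [1-t]v-swap = *ₛ-swap {1ₛ -ₛ t} {1ₛ -ₛ t} {v} {u} (-ₛ-swap {1ₛ} {1ₛ} {t} {t} (const-swap 1ℚ) t-swap) v-swap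

  t*exp-swap : t *ₛ exp ((1ₛ -ₛ t) *ₛ v) ⇄ t *ₛ exp ((1ₛ -ₛ t) *ₛ u)
  t*exp-swap = *ₛ-swap {t} {t} {exp ((1ₛ -ₛ t) *ₛ v)} {exp ((1ₛ -ₛ t) *ₛ u)} t-swap (exp-swap [1-t]v-swap)

  g∘-𝟏-swap : ∀ ℓ → g ℓ ∘ₛ (t *ₛ exp ((1ₛ -ₛ t) *ₛ v)) -ₛ 𝟏[ ℓ ≡0] ⇄ g ℓ ∘ₛ (t *ₛ exp ((1ₛ -ₛ t) *ₛ u)) -ₛ 𝟏[ ℓ ≡0]
  g∘-𝟏-swap ℓ = -ₛ-swap {g ℓ ∘ₛ (t *ₛ exp ((1ₛ -ₛ t) *ₛ v))} {g ℓ ∘ₛ (t *ₛ exp ((1ₛ -ₛ t) *ₛ u))} {𝟏[ ℓ ≡0]} {𝟏[ ℓ ≡0]}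
    (∘ₛ-swap (g ℓ) {t *ₛ exp ((1ₛ -ₛ t) *ₛ v)} {t *ₛ exp ((1ₛ -ₛ t) *ₛ u)} t*exp-swap) (𝟏-swap ℓ)

  generating-function-coefficient : ∀ k ℓ m →
    ([t^ suc (suc m) ℕ.+ 2 u^ k v^ ℓ ]
      ((g k ∘ₛ (t *ₛ exp ((1ₛ -ₛ t) *ₛ u)) -ₛ 𝟏[ k ≡0]) ^ₛ 2
        *ₛ (g ℓ ∘ₛ (t *ₛ exp ((1ₛ -ₛ t) *ₛ v)) -ₛ 𝟏[ ℓ ≡0]) ^ₛ 2
        /ₛ (1ₛ -ₛ t) ^ₛ (k ℕ.+ ℓ))) ≡ (U k ⊗ U ℓ) m
  generating-function-coefficient k ℓ m = trans
    (product-coefficient (g k ∘ₛ (t *ₛ exp ((1ₛ -ₛ t) *ₛ u)) -ₛ 𝟏[ k ≡0]) (g ℓ ∘ₛ (t *ₛ exp ((1ₛ -ₛ t) *ₛ v)) -ₛ 𝟏[ ℓ ≡0])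
      (λ b → X (ge⁺ k b)) (λ b → X (ge⁺ ℓ b)) k ℓ (suc (suc m) ℕ.+ 2) (g∘-𝟏≐ k) (⇄-≐-trans (g∘-𝟏-swap ℓ) (g∘-𝟏≐ ℓ)))
    (trans (⊗-cong (square-coefficient k) (square-coefficient ℓ) (suc (suc m) ℕ.+ 2)) (shift (U k) (U ℓ)))
    where
    -- Each square supplies a factor t^2, and n + 2 = m + 4.
    shift : ∀ f h → (X (X f) ⊗ X (X h)) (suc (suc m) ℕ.+ 2) ≡ (f ⊗ h) m
    shift f h = begin
      (X (X f) ⊗ X (X h)) (suc (suc m) ℕ.+ 2)   ≡⟨ X-⊗ (X f) (X (X h)) (suc (suc m) ℕ.+ 2) ⟩
      (X f ⊗ X (X h)) (suc m ℕ.+ 2)             ≡⟨ X-⊗ f (X (X h)) (suc m ℕ.+ 2) ⟩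
      (f ⊗ X (X h)) (m ℕ.+ 2)                   ≡⟨ cong (f ⊗ X (X h)) (ℕ.+-comm m 2) ⟩
      (f ⊗ X (X h)) (2 ℕ.+ m)                   ≡⟨ ⊗-X f (X h) (2 ℕ.+ m) ⟩
      (f ⊗ X h) (1 ℕ.+ m)                       ≡⟨ ⊗-X f h (1 ℕ.+ m) ⟩
      (f ⊗ h) m                                 ∎

-- Bigrassmannian permutations, their order and the counts α and β

module BruhatOrder where

  open import Data.Fin.Base as Fin using (Fin; toℕ; fromℕ<)
  import Data.Fin.Properties as Fin
  open import Data.Fin.Permutation using (Permutation′; permutation; transpose; flip; _∘ₚ_; _⟨$⟩ʳ_; _⟨$⟩ˡ_; _≈_; inverseˡ; inverseʳ)
  import Data.Fin.Permutation.Components as Components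
  open import Data.List.Base using (List; []; _∷_; _++_; map; concatMap; tabulate; length; filter; cartesianProductWith; cartesianProduct)
  open import Data.List.Membership.Propositional using (_∈_)
  import Data.List.Membership.Propositional.Properties as ∈ₚ
  import Data.List.Membership.Setoid as SetoidMembership
  import Data.List.Membership.Setoid.Properties as SetoidMembershipₚ
  open import Data.List.Properties using (map-++; map-∘; map-cong; map-tabulate; tabulate-cong; length-map; length-tabulate; filter-≐)
  import Data.List.Relation.Unary.All.Properties as All
  open import Data.List.Relation.Unary.AllPairs using ([]; _∷_)
  open import Data.List.Relation.Unary.Any as Any using (here; there; _─_)
  open import Data.List.Relation.Unary.Unique.Propositional using (Unique)
  import Data.List.Relation.Unary.Unique.Propositional.Properties as Uniqueₚ
  import Data.List.Relation.Unary.Unique.Setoid as SetoidUnique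
  import Data.List.Relation.Unary.Unique.Setoid.Properties as SetoidUniqueₚ
  open import Data.Nat.Base
  open import Data.Nat.ListAction using (sum)
  open import Data.Nat.ListAction.Properties using (sum-++)
  open import Data.Nat.Properties
  open import Data.Nat.Tactic.RingSolver using (solve-∀)
  open import Data.Product using (∃; ∃-syntax; _×_; _,_; proj₁; proj₂)
  open import Data.Sum.Base using (_⊎_; inj₁; inj₂; [_,_]′; map₁)
  open import Relation.Binary.Bundles using (Setoid)
  open import Relation.Binary.Construct.Closure.ReflexiveTransitive using (Star; ε; _◅_; _◅◅_)
  open import Relation.Binary.Definitions using (tri<; tri≈; tri>)
  open import Relation.Nullary using (Dec; yes; no; ¬_; contradiction)
  open import Defs
  open ≡-Reasoning

  -- Interchanges of adjacent blocks

  -- The case distinction of `swapBlocks` past the first block: `y` is the offset into the second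
  -- block, and points beyond that block stay.
  lower : ℕ → ℕ → ℕ → ℕ
  lower d y x with y <? d
  ... | yes _ = y
  ... | no _  = x

  lower-< : ∀ {d y} x → y < d → lower d y x ≡ y
  lower-< {d} {y} x y<d with y <? d
  ... | yes _  = refl
  ... | no y≮d = contradiction y<d y≮d

  lower-≮ : ∀ {d y} x → ¬ y < d → lower d y x ≡ x
  lower-≮ {d} {y} x y≮d with y <? d
  ... | yes y<d = contradiction y<d y≮d
  ... | no _    = refl

  -- The map interchanging the adjacent blocks [a, a + u) and [a + u, a + u + d).
  swapBlocks : ℕ → ℕ → ℕ → ℕ → ℕ
  swapBlocks zero    u d x with x <? u
  ... | yes _ = d + x
  ... | no _  = lower d (x ∸ u) x
  swapBlocks (suc a) u d zero    = zero
  swapBlocks (suc a) u d (suc x) = suc (swapBlocks a u d x)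

  swapBlocks-before : ∀ a {u d x} → x < a → swapBlocks a u d x ≡ x
  swapBlocks-before (suc a) {x = zero}  _         = refl
  swapBlocks-before (suc a) {x = suc x} (s≤s x<a) = cong suc (swapBlocks-before a x<a)

  swapBlocks-up : ∀ a {u d k} → k < u → swapBlocks a u d (a + k) ≡ a + (d + k)
  swapBlocks-up (suc a) k<u = cong suc (swapBlocks-up a k<u)
  swapBlocks-up zero {u} {d} {k} k<u with k <? u
  ... | yes _   = refl
  ... | no k≮u = contradiction k<u k≮u

  swapBlocks-down : ∀ a {u d k} → k < d → swapBlocks a u d (a + (u + k)) ≡ a + k
  swapBlocks-down (suc a) k<d = cong suc (swapBlocks-down a k<d)
  swapBlocks-down zero {u} {d} {k} k<d with u + k <? u
  ... | yes p = contradiction p (m+n≮m u k)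
  ... | no _  = trans (cong (λ y → lower d y (u + k)) (m+n∸m≡n u k)) (lower-< (u + k) k<d)

  swapBlocks-after : ∀ a u d k → swapBlocks a u d (a + (u + (d + k))) ≡ a + (u + (d + k))
  swapBlocks-after (suc a) u d k = cong suc (swapBlocks-after a u d k)
  swapBlocks-after zero u d k with u + (d + k) <? u
  ... | yes p = contradiction p (m+n≮m u (d + k))
  ... | no _  = trans (cong (λ y → lower d y (u + (d + k))) (m+n∸m≡n u (d + k))) (lower-≮ (u + (d + k)) (m+n≮m d k))

  split-at : ∀ a x → x < a ⊎ ∃[ k ] x ≡ a + k
  split-at a x with x <? a
  ... | yes x<a = inj₁ x<a
  ... | no x≮a  = inj₂ (x ∸ a , sym (m+[n∸m]≡n (≮⇒≥ x≮a)))

  data Region (a u d : ℕ) : ℕ → Set where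
    before : ∀ {x} → x < a → Region a u d x
    up     : ∀ {k} → k < u → Region a u d (a + k)
    down   : ∀ {k} → k < d → Region a u d (a + (u + k))
    after  : ∀ k → Region a u d (a + (u + (d + k)))

  region : ∀ a u d x → Region a u d x
  region a u d x with split-at a x
  ... | inj₁ x<a = before x<a
  ... | inj₂ (k , refl) with split-at u k
  ...   | inj₁ k<u = up k<u
  ...   | inj₂ (l , refl) with split-at d l
  ...     | inj₁ l<d       = down l<d
  ...     | inj₂ (m , refl) = after m

  x+[y+z]≡y+[x+z] : ∀ x y z → x + (y + z) ≡ y + (x + z)
  x+[y+z]≡y+[x+z] x y z = trans (sym (+-assoc x y z)) (trans (cong (_+ z) (+-comm x y)) (+-assoc y x z))

  swapBlocks-inverse : ∀ a u d x → swapBlocks a d u (swapBlocks a u d x) ≡ x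
  swapBlocks-inverse a u d x with region a u d x
  ... | before x<a    = trans (cong (swapBlocks a d u) (swapBlocks-before a x<a)) (swapBlocks-before a x<a)
  ... | up k<u        = trans (cong (swapBlocks a d u) (swapBlocks-up a k<u)) (swapBlocks-down a k<u)
  ... | down k<d      = trans (cong (swapBlocks a d u) (swapBlocks-down a k<d)) (swapBlocks-up a k<d)
  ... | after k       = begin
    swapBlocks a d u (swapBlocks a u d (a + (u + (d + k)))) ≡⟨ cong (swapBlocks a d u) (swapBlocks-after a u d k) ⟩
    swapBlocks a d u (a + (u + (d + k)))                    ≡⟨ cong (λ y → swapBlocks a d u (a + y)) (x+[y+z]≡y+[x+z] u d k) ⟩
    swapBlocks a d u (a + (d + (u + k)))                    ≡⟨ swapBlocks-after a d u k ⟩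
    a + (d + (u + k))                                       ≡⟨ cong (a +_) (x+[y+z]≡y+[x+z] d u k) ⟩
    a + (u + (d + k))                                       ∎

  swapBlocks-< : ∀ a u d {n x} → a + (u + d) ≤ n → x < n → swapBlocks a u d x < n
  swapBlocks-< a u d {n} {x} bound x<n with region a u d x
  ... | before x<a = subst (_< n) (sym (swapBlocks-before a x<a)) x<n
  ... | up {k} k<u = subst (_< n) (sym (swapBlocks-up a k<u))
    (<-≤-trans (+-monoʳ-< a (subst (d + k <_) (+-comm d u) (+-monoʳ-< d k<u))) bound)
  ... | down k<d   = subst (_< n) (sym (swapBlocks-down a k<d)) (<-≤-trans (+-monoʳ-< a (<-≤-trans k<d (m≤n+m d u))) bound)
  ... | after k    = subst (_< n) (sym (swapBlocks-after a u d k)) x<n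

  DescendsOnlyAt : (ℕ → ℕ) → ℕ → Set
  DescendsOnlyAt F d = F (suc d) < F d × (∀ x → x ≢ d → F x < F (suc x))

  swapBlocks-descends : ∀ a r q → DescendsOnlyAt (swapBlocks a (suc r) (suc q)) (a + r)
  swapBlocks-descends a r q = descent , ascents
    where
    F = swapBlocks a (suc r) (suc q)

    descent : F (suc (a + r)) < F (a + r)
    descent = subst₂ _<_ (sym F[1+a+r]) (sym (swapBlocks-up a (n<1+n r))) (m<m+n a z<s)
      where
      F[1+a+r] : F (suc (a + r)) ≡ a
      F[1+a+r] = begin
        F (suc (a + r))         ≡⟨ cong F (+-suc a r) ⟨
        F (a + suc r)           ≡⟨ cong (λ y → F (a + y)) (+-identityʳ (suc r)) ⟨
        F (a + (suc r + 0))     ≡⟨ swapBlocks-down a z<s ⟩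
        a + 0                   ≡⟨ +-identityʳ a ⟩
        a                       ∎

    ascents : ∀ x → x ≢ a + r → F x < F (suc x)
    ascents x x≢ with region a (suc r) (suc q) x
    ... | before x<a with m≤n⇒m<n∨m≡n x<a
    ...   | inj₁ 1+x<a = subst₂ _<_ (sym (swapBlocks-before a x<a)) (sym (swapBlocks-before a 1+x<a)) (n<1+n x)
    ...   | inj₂ refl  = subst₂ _<_ (sym (swapBlocks-before a x<a)) (sym F[a]) (≤-trans x<a (m≤m+n a _))
      where
      F[a] : F (suc x) ≡ suc x + (suc q + 0)
      F[a] = trans (cong F (sym (+-identityʳ (suc x)))) (swapBlocks-up (suc x) z<s)
    ascents x x≢ | up {k} k<1+r = subst₂ _<_ (sym (swapBlocks-up a k<1+r)) (sym F[1+x])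
        (+-monoʳ-< a (+-monoʳ-< (suc q) (n<1+n k)))
      where
      1+k<1+r : suc k < suc r
      1+k<1+r = ≤∧≢⇒< k<1+r (λ { refl → x≢ refl })
      F[1+x] : F (suc (a + k)) ≡ a + (suc q + suc k)
      F[1+x] = trans (cong F (sym (+-suc a k))) (swapBlocks-up a 1+k<1+r)
    ascents x x≢ | down {k} k<1+q with m≤n⇒m<n∨m≡n k<1+q
    ... | inj₁ 1+k<1+q = subst₂ _<_ (sym (swapBlocks-down a k<1+q)) (sym F[1+x]) (+-monoʳ-< a (n<1+n k))
      where
      F[1+x] : F (suc (a + (suc r + k))) ≡ a + suc k
      F[1+x] = trans (cong F (trans (sym (+-suc a (suc r + k))) (cong (a +_) (sym (+-suc (suc r) k))))) (swapBlocks-down a 1+k<1+q)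
    ... | inj₂ refl = subst₂ _<_ (sym (swapBlocks-down a k<1+q)) (sym F[1+x]) (+-monoʳ-< a (≤-trans (m≤m+n (suc k) 0) (m≤n+m (suc k + 0) (suc r))))
      where
      F[1+x] : F (suc (a + (suc r + k))) ≡ a + (suc r + (suc k + 0))
      F[1+x] = trans (cong F (trans (sym (+-suc a (suc r + k))) (cong (a +_) (trans (sym (+-suc (suc r) k)) (cong (suc r +_) (sym (+-identityʳ (suc k)))))))) (swapBlocks-after a (suc r) (suc k) 0)
    ascents x x≢ | after k = subst₂ _<_ (sym (swapBlocks-after a (suc r) (suc q) k)) (sym F[1+x]) (n<1+n _)
      where
      1+x≡ : suc (a + (suc r + (suc q + k))) ≡ a + (suc r + (suc q + suc k))
      1+x≡ = trans (sym (+-suc a _)) (cong (a +_) (trans (sym (+-suc (suc r) _)) (cong (suc r +_) (sym (+-suc (suc q) k)))))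
      F[1+x] : F (suc (a + (suc r + (suc q + k)))) ≡ suc (a + (suc r + (suc q + k)))
      F[1+x] = trans (cong F 1+x≡) (trans (swapBlocks-after a (suc r) (suc q) (suc k)) (sym 1+x≡))

  -- That the inverse P descends only at e says that every value v other than e stands to the left
  -- of v + 1. As F increases both up to d and beyond d, it advances by exactly one at each step
  -- there, except on reaching the value e + 1 in the first range or on leaving the value e in the
  -- second.
  module Classification {F P : ℕ → ℕ} (FP : ∀ y → F (P y) ≡ y) (PF : ∀ x → P (F x) ≡ x)
    {d e} (F-descends : DescendsOnlyAt F d) (P-descends : DescendsOnlyAt P e) where

    mono : ∀ {f d} → DescendsOnlyAt f d → ∀ {x y} → x < y → y ≤ d ⊎ d < x → f x < f y
    mono {f} {d} D {x} {suc y} (s≤s x≤y) side with m≤n⇒m<n∨m≡n x≤y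
    ... | inj₂ refl = proj₂ D x (λ { refl → [ n≮n x , n≮n x ]′ side })
    ... | inj₁ x<y = <-trans (mono D x<y (map₁ <⇒≤ side)) (proj₂ D y (y≢d side))
      where
      y≢d : suc y ≤ d ⊎ d < x → y ≢ d
      y≢d (inj₁ p) refl = n≮n _ p
      y≢d (inj₂ p) refl = <-asym p x<y

    mono-≤ : ∀ {f d} → DescendsOnlyAt f d → ∀ {x y} → x ≤ y → y ≤ d ⊎ d < x → f x ≤ f y
    mono-≤ D x≤y side with m≤n⇒m<n∨m≡n x≤y
    ... | inj₁ x<y  = <⇒≤ (mono D x<y side)
    ... | inj₂ refl = ≤-refl

    start : F 0 ≢ suc e → F 0 ≡ 0
    start F0≢ with F 0 in eq
    ... | zero  = refl
    ... | suc v = contradiction (subst (P v <_) (trans (cong P (sym eq)) (PF 0)) (proj₂ P-descends v (λ { refl → F0≢ refl }))) n≮0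

    -- The value just below `F (suc x)` stands at x or earlier, so by monotonicity up to d it is at
    -- most `F x`: no value is skipped.
    step-before : ∀ {x} → x < d → F (suc x) ≢ suc e → F (suc x) ≡ suc (F x)
    step-before {x} x<d F≢ with F (suc x) in eq | proj₂ F-descends x (<⇒≢ x<d)
    ... | suc v | s≤s Fx≤v = cong suc (≤-antisym v≤Fx Fx≤v)
      where
      Pv≤x : P v ≤ x
      Pv≤x = s≤s⁻¹ (subst (P v <_) (trans (cong P (sym eq)) (PF (suc x))) (proj₂ P-descends v (λ { refl → F≢ refl })))
      v≤Fx : v ≤ F x
      v≤Fx = subst (_≤ F x) (FP v) (mono-≤ F-descends Pv≤x (inj₁ (<⇒≤ x<d)))

    -- The value just above `F x` stands at x + 1 or later, so by monotonicity beyond d it is at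
    -- least `F (suc x)`.
    step-after : ∀ {x} → d < x → F x ≢ e → F (suc x) ≡ suc (F x)
    step-after {x} d<x Fx≢e = ≤-antisym
      (subst (F (suc x) ≤_) (FP (suc (F x))) (mono-≤ F-descends x<P[1+Fx] (inj₂ (m<n⇒m<1+n d<x))))
      (proj₂ F-descends x (>⇒≢ d<x))
      where
      x<P[1+Fx] : x < P (suc (F x))
      x<P[1+Fx] = subst (_< P (suc (F x))) (PF x) (proj₂ P-descends (F x) Fx≢e)

    a : ℕ
    a = P (suc e)

    F[a] : F a ≡ suc e
    F[a] = FP (suc e)

    a≤d : a ≤ d
    -- The value e + 1 stands to the left of e; beyond d, where F increases, this is impossible.
    a≤d = ≮⇒≥ λ d<a → <-asym (n<1+n e)
      (subst₂ _<_ F[a] (FP e) (mono F-descends (proj₁ P-descends) (inj₂ d<a)))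

    F-injective : ∀ {x y} → F x ≡ F y → x ≡ y
    F-injective {x} {y} eq = trans (sym (PF x)) (trans (cong P eq) (PF y))

    fixed-before : ∀ x → x < a → F x ≡ x
    fixed-before zero    0<a = start (λ eq → <⇒≢ 0<a (F-injective (trans eq (sym F[a]))))
    fixed-before (suc x) x<a = trans
      (step-before (<-≤-trans (<-trans (n<1+n x) x<a) a≤d) (λ eq → <⇒≢ x<a (F-injective (trans eq (sym F[a])))))
      (cong suc (fixed-before x (<-trans (n<1+n x) x<a)))

    up-block : ∀ k → a + k ≤ d → F (a + k) ≡ suc e + k
    up-block zero    _ = trans (cong F (+-identityʳ a)) (trans F[a] (sym (+-identityʳ (suc e))))
    up-block (suc k) p = begin
      F (a + suc k)     ≡⟨ cong F (+-suc a k) ⟩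
      F (suc (a + k))   ≡⟨ step-before a+k<d (λ eq → m≢1+m+n a (sym (F-injective (trans eq (sym F[a]))))) ⟩
      suc (F (a + k))   ≡⟨ cong suc (up-block k (<⇒≤ a+k<d)) ⟩
      suc (suc e + k)   ≡⟨ +-suc (suc e) k ⟨
      suc e + suc k     ∎
      where
      a+k<d : a + k < d
      a+k<d = subst (_≤ d) (+-suc a k) p

    -- From x on F is a translation, and a translation that is the identity far out is the identity
    -- throughout.
    fixed-after : ∀ x → d < x → (∀ k → F (x + k) ≢ e) → ∃[ n ] (∀ y → n ≤ y → F y ≡ y) → F x ≡ x
    fixed-after x d<x ≢e (n , fixed) = +-cancelʳ-≡ n (F x) x (trans (sym (shift n)) (fixed (x + n) (m≤n+m n x)))
      where
      shift : ∀ k → F (x + k) ≡ F x + k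
      shift zero    = trans (cong F (+-identityʳ x)) (sym (+-identityʳ (F x)))
      shift (suc k) = begin
        F (x + suc k)     ≡⟨ cong F (+-suc x k) ⟩
        F (suc (x + k))   ≡⟨ step-after (<-≤-trans d<x (m≤m+n x k)) (≢e k) ⟩
        suc (F (x + k))   ≡⟨ cong suc (shift k) ⟩
        suc (F x + k)     ≡⟨ +-suc (F x) k ⟨
        F x + suc k       ∎

  one-descent⇒swapBlocks : ∀ {F P : ℕ → ℕ} → (∀ y → F (P y) ≡ y) → (∀ x → P (F x) ≡ x) →
    ∃ (DescendsOnlyAt F) → ∃ (DescendsOnlyAt P) → ∃[ n ] (∀ x → n ≤ x → F x ≡ x) →
    ∃[ a ] ∃[ r ] ∃[ q ] F ≗ swapBlocks a (suc r) (suc q)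
  one-descent⇒swapBlocks {F} {P} FP PF (d , F-descends) (e , P-descends) fixed =
    -- The first block occupies the positions from a to d and the second takes the values from a to
    -- e, which gives the lengths d - a + 1 and e - a + 1.
    a , d ∸ a , e ∸ a , λ x → by-region x (region a (suc (d ∸ a)) (suc (e ∸ a)) x)
    where
    open Classification FP PF F-descends P-descends
    module P = Classification PF FP P-descends F-descends

    r q : ℕ
    r = d ∸ a
    q = e ∸ a

    a+r≡d : a + r ≡ d
    a+r≡d = m+[n∸m]≡n a≤d

    -- a and P.a are the smallest non-fixed points of F and of P.
    a≡P-a : P.a ≡ a
    a≡P-a with <-cmp P.a a
    ... | tri≈ _ eq _ = eq
    -- `P.a` is `F (suc d)` by definition. If F fixed this value, so would P, and d + 1 would lie
    -- below a, which is at most d.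
    ... | tri< P-a<a _ _ = contradiction (subst (_< d) (sym 1+d≡P-a) (<-≤-trans P-a<a a≤d)) (<-asym (n<1+n d))
      where
      1+d≡P-a : suc d ≡ P.a
      1+d≡P-a = begin
        suc d       ≡⟨ PF (suc d) ⟨
        P P.a       ≡⟨ cong P (fixed-before P.a P-a<a) ⟨
        P (F P.a)   ≡⟨ PF P.a ⟩
        P.a         ∎
    ... | tri> _ _ a<P-a = contradiction (proj₁ P-descends) (<-asym (subst (_< a) (sym P[e]) e<a))
      where
      1+e≡a : suc e ≡ a
      1+e≡a = begin
        suc e       ≡⟨ F[a] ⟨
        F a         ≡⟨ cong F (P.fixed-before a a<P-a) ⟨
        F (P a)     ≡⟨ FP a ⟩
        a           ∎
      e<a : e < a
      e<a = ≤-reflexive 1+e≡a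
      P[e] : P e ≡ e
      P[e] = trans (cong P (sym (fixed-before e e<a))) (PF e)

    a+q≡e : a + q ≡ e
    a+q≡e = m+[n∸m]≡n (subst (_≤ e) a≡P-a P.a≤d)

    1+d+k≡ : ∀ k → suc d + k ≡ a + (suc r + k)
    1+d+k≡ k = begin
      suc d + k           ≡⟨ cong (λ y → suc y + k) a+r≡d ⟨
      suc (a + r) + k     ≡⟨ cong (_+ k) (+-suc a r) ⟨
      a + suc r + k       ≡⟨ +-assoc a (suc r) k ⟩
      a + (suc r + k)     ∎

    down-block : ∀ k → a + k ≤ e → F (suc d + k) ≡ a + k
    down-block zero    _ = trans (cong F (+-identityʳ (suc d))) (trans a≡P-a (sym (+-identityʳ a)))
    down-block (suc k) p = begin
      F (suc d + suc k)   ≡⟨ cong F (+-suc (suc d) k) ⟩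
      F (suc (suc d + k)) ≡⟨ step-after (m≤m+n (suc d) k) (λ eq → <⇒≢ a+k<e (trans (sym ih) eq)) ⟩
      suc (F (suc d + k)) ≡⟨ cong suc ih ⟩
      suc (a + k)         ≡⟨ +-suc a k ⟨
      a + suc k           ∎
      where
      a+k<e : a + k < e
      a+k<e = subst (_≤ e) (+-suc a k) p
      ih : F (suc d + k) ≡ a + k
      ih = down-block k (<⇒≤ a+k<e)

    by-region : ∀ x → Region a (suc r) (suc q) x → F x ≡ swapBlocks a (suc r) (suc q) x
    by-region x (before x<a)   = trans (fixed-before x x<a) (sym (swapBlocks-before a x<a))
    by-region _ (up {k} k<1+r) = begin
      F (a + k)                             ≡⟨ up-block k (subst (a + k ≤_) a+r≡d (+-monoʳ-≤ a (s≤s⁻¹ k<1+r))) ⟩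
      suc e + k                             ≡⟨ cong (λ y → suc y + k) a+q≡e ⟨
      suc (a + q) + k                       ≡⟨ cong (_+ k) (+-suc a q) ⟨
      a + suc q + k                         ≡⟨ +-assoc a (suc q) k ⟩
      a + (suc q + k)                       ≡⟨ swapBlocks-up a k<1+r ⟨
      swapBlocks a (suc r) (suc q) (a + k)  ∎
    by-region _ (down {k} k<1+q) = begin
      F (a + (suc r + k))                             ≡⟨ cong F (1+d+k≡ k) ⟨
      F (suc d + k)                                   ≡⟨ down-block k (subst (a + k ≤_) a+q≡e (+-monoʳ-≤ a (s≤s⁻¹ k<1+q))) ⟩
      a + k                                           ≡⟨ swapBlocks-down a k<1+q ⟨
      swapBlocks a (suc r) (suc q) (a + (suc r + k))  ∎
    by-region _ (after k) = trans (fixed-after x d<x ≢e fixed) (sym (swapBlocks-after a (suc r) (suc q) k))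
      where
      x = a + (suc r + (suc q + k))
      d+q<x : suc d + q < x
      d+q<x = subst (suc d + q <_) (1+d+k≡ (suc q + k)) (+-monoʳ-< (suc d) (m≤m+n (suc q) k))
      d<x : d < x
      d<x = <-≤-trans (m≤m+n (suc d) q) (<⇒≤ d+q<x)
      -- The value e already stands at position d + 1 + q, which lies before x.
      ≢e : ∀ j → F (x + j) ≢ e
      ≢e j eq = <⇒≢ (<-≤-trans d+q<x (m≤m+n x j))
        (sym (F-injective (trans eq (sym (trans (down-block q (≤-reflexive a+q≡e)) a+q≡e)))))

  -- Classification of the bigrassmannian permutations

  ≈-sym : ∀ {n} {σ τ : Permutation′ n} → σ ≈ τ → τ ≈ σ
  ≈-sym p i = sym (p i)

  -- Continued by the identity to all of ℕ, a permutation can be evaluated at successors of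
  -- positions and values without bounds.
  ext : ∀ {n} → Permutation′ n → ℕ → ℕ
  ext {n} σ x with x <? n
  ... | yes x<n = toℕ (σ ⟨$⟩ʳ fromℕ< x<n)
  ... | no _    = x

  ext-toℕ : ∀ {n} (σ : Permutation′ n) i → ext σ (toℕ i) ≡ toℕ (σ ⟨$⟩ʳ i)
  ext-toℕ {n} σ i with toℕ i <? n
  ... | yes i<n = cong (λ j → toℕ (σ ⟨$⟩ʳ j)) (Fin.fromℕ<-toℕ i i<n)
  ... | no i≮n  = contradiction (Fin.toℕ<n i) i≮n

  ext-≥ : ∀ {n} (σ : Permutation′ n) {x} → n ≤ x → ext σ x ≡ x
  ext-≥ {n} σ {x} n≤x with x <? n
  ... | yes x<n = contradiction n≤x (<⇒≱ x<n)
  ... | no _    = refl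

  data Position (n : ℕ) : ℕ → Set where
    inside  : (i : Fin n) → Position n (toℕ i)
    outside : ∀ {x} → n ≤ x → Position n x

  position : ∀ n x → Position n x
  position n x with x <? n
  ... | yes x<n = subst (Position n) (Fin.toℕ-fromℕ< x<n) (inside (fromℕ< x<n))
  ... | no x≮n  = outside (≮⇒≥ x≮n)

  ext-cong : ∀ {n} {σ τ : Permutation′ n} → σ ≈ τ → ext σ ≗ ext τ
  ext-cong {n} {σ} {τ} σ≈τ x with position n x
  ... | inside i  = trans (ext-toℕ σ i) (trans (cong toℕ (σ≈τ i)) (sym (ext-toℕ τ i)))
  ... | outside p = trans (ext-≥ σ p) (sym (ext-≥ τ p))

  ext-injective : ∀ {n} {σ τ : Permutation′ n} → ext σ ≗ ext τ → σ ≈ τ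
  ext-injective {σ = σ} {τ} eq i = Fin.toℕ-injective (trans (sym (ext-toℕ σ i)) (trans (eq (toℕ i)) (ext-toℕ τ i)))

  ext-flip : ∀ {n} (σ : Permutation′ n) x → ext (flip σ) (ext σ x) ≡ x
  ext-flip {n} σ x with position n x
  ... | inside i  = trans (cong (ext (flip σ)) (ext-toℕ σ i)) (trans (ext-toℕ (flip σ) (σ ⟨$⟩ʳ i)) (cong toℕ (inverseˡ σ)))
  ... | outside p = trans (cong (ext (flip σ)) (ext-≥ σ p)) (ext-≥ (flip σ) p)

  ext-flip′ : ∀ {n} (σ : Permutation′ n) x → ext σ (ext (flip σ) x) ≡ x
  ext-flip′ {n} σ x with position n x
  ... | inside i  = trans (cong (ext σ) (ext-toℕ (flip σ) i)) (trans (ext-toℕ σ (σ ⟨$⟩ˡ i)) (cong toℕ (inverseʳ σ)))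
  ... | outside p = trans (cong (ext σ) (ext-≥ (flip σ) p)) (ext-≥ σ p)

  ext[σ]-injective : ∀ {n} (σ : Permutation′ n) {x y} → ext σ x ≡ ext σ y → x ≡ y
  ext[σ]-injective σ {x} {y} eq = trans (sym (ext-flip σ x)) (trans (cong (ext (flip σ)) eq) (ext-flip σ y))

  ext-descent⁺ : ∀ {n} (σ : Permutation′ n) i → Descent σ i → ext σ (suc (toℕ i)) < ext σ (toℕ i)
  ext-descent⁺ σ i (j , j≡1+i , σj<σi) = subst₂ _<_ (trans (sym (ext-toℕ σ j)) (cong (ext σ) j≡1+i)) (sym (ext-toℕ σ i)) σj<σi

  ext-descent⁻ : ∀ {n} (σ : Permutation′ n) x → ext σ (suc x) < ext σ x → ∃[ i ] toℕ i ≡ x × Descent σ i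
  ext-descent⁻ {n} σ x lt = i , i≡x , j , trans j≡1+x (cong suc (sym i≡x)) ,
    subst₂ _<_ (trans (cong (ext σ) (sym j≡1+x)) (ext-toℕ σ j)) (trans (cong (ext σ) (sym i≡x)) (ext-toℕ σ i)) lt
    where
    -- From the last position on the value at x is at most x, while x + 1 is fixed; so the extension
    -- creates no descent.
    ext-≤ : ∀ x → n ≤ suc x → ext σ x ≤ x
    ext-≤ x n≤1+x with x <? n
    ... | yes x<n = s≤s⁻¹ (<-≤-trans (Fin.toℕ<n (σ ⟨$⟩ʳ fromℕ< x<n)) n≤1+x)
    ... | no _    = ≤-refl
    1+x<n : suc x < n
    1+x<n = ≰⇒> λ n≤1+x → contradiction (subst (_< ext σ x) (ext-≥ σ n≤1+x) lt) (≤⇒≯ (m≤n⇒m≤1+n (ext-≤ x n≤1+x)))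
    x<n : x < n
    x<n = <-trans (n<1+n x) 1+x<n
    i j : Fin n
    i = fromℕ< x<n
    j = fromℕ< 1+x<n
    i≡x : toℕ i ≡ x
    i≡x = Fin.toℕ-fromℕ< x<n
    j≡1+x : toℕ j ≡ suc x
    j≡1+x = Fin.toℕ-fromℕ< 1+x<n

  oneDescent⁻ : ∀ {n} (σ : Permutation′ n) → OneDescent σ → ∃ (DescendsOnlyAt (ext σ))
  oneDescent⁻ σ (i , descent , unique) = toℕ i , ext-descent⁺ σ i descent , λ x x≢i → ≤∧≢⇒<
    (≮⇒≥ λ lt → let j , j≡x , descent′ = ext-descent⁻ σ x lt in x≢i (trans (sym j≡x) (cong toℕ (sym (unique descent′)))))
    (λ eq → m≢1+n+m x (ext[σ]-injective σ eq))

  oneDescent⁺ : ∀ {n} (σ : Permutation′ n) → ∃ (DescendsOnlyAt (ext σ)) → OneDescent σ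
  oneDescent⁺ σ (d , descent , ascents) with ext-descent⁻ σ d descent
  ... | i , refl , descent′ = i , descent′ , unique
    where
    unique : ∀ {j} → Descent σ j → i ≡ j
    unique {j} descent″ with i Fin.≟ j
    ... | yes i≡j = i≡j
    ... | no i≢j  = contradiction (ext-descent⁺ σ j descent″) (<⇒≯ (ascents (toℕ j) (i≢j ∘ sym ∘ Fin.toℕ-injective)))

  -- p + 1, q + 1, r + 1 and s + 1 are the numbers a + 1, b - a, c - b and n - c + 1.
  record Composition (m : ℕ) : Set where
    constructor composition
    field
      p q r s : ℕ
      total   : p + s + (q + r) ≡ m
  open Composition

  -- Inversion of permutations, by `flip-ω`.
  _ᵀ : ∀ {m} → Composition m → Composition m
  composition p q r s total ᵀ = composition p r q s (trans (cong (p + s +_) (+-comm r q)) total)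

  size-lemma : ∀ p q r s → p + (suc r + suc q) + s ≡ 2 + (p + s + (q + r))
  size-lemma = solve-∀

  bound : ∀ {m} (c : Composition m) → p c + (suc (r c) + suc (q c)) ≤ 2 + m
  bound (composition p q r s refl) = subst (p + (suc r + suc q) ≤_) (size-lemma p q r s) (m≤m+n _ s)

  -- The inverse map is taken from the transposed composition, which makes `flip-ω` hold by
  -- computation.
  ω : ∀ {m} → Composition m → Permutation′ (2 + m)
  ω {m} c = permutation (to c) (to (c ᵀ)) (inverse (c ᵀ)) (inverse c)
    where
    to : Composition m → Fin (2 + m) → Fin (2 + m)
    to c i = fromℕ< (swapBlocks-< (p c) (suc (r c)) (suc (q c)) (bound c) (Fin.toℕ<n i))
    inverse : ∀ c i → to (c ᵀ) (to c i) ≡ i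
    inverse c i = Fin.toℕ-injective (begin
      toℕ (to (c ᵀ) (to c i))                                                   ≡⟨ Fin.toℕ-fromℕ< _ ⟩
      swapBlocks (p c) (suc (q c)) (suc (r c)) (toℕ (to c i))
        ≡⟨ cong (swapBlocks (p c) (suc (q c)) (suc (r c))) (Fin.toℕ-fromℕ< _) ⟩
      swapBlocks (p c) (suc (q c)) (suc (r c)) (swapBlocks (p c) (suc (r c)) (suc (q c)) (toℕ i))
        ≡⟨ swapBlocks-inverse (p c) (suc (r c)) (suc (q c)) (toℕ i) ⟩
      toℕ i                                                                     ∎)

  ⟦_⟧ : ∀ {m} → Composition m → ℕ → ℕ
  ⟦ c ⟧ = swapBlocks (p c) (suc (r c)) (suc (q c))

  toℕ-ω : ∀ {m} (c : Composition m) i → toℕ (ω c ⟨$⟩ʳ i) ≡ ⟦ c ⟧ (toℕ i)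
  toℕ-ω c i = Fin.toℕ-fromℕ< _

  ext-ω : ∀ {m} (c : Composition m) → ext (ω c) ≗ ⟦ c ⟧
  ext-ω {m} c x with position (2 + m) x
  ... | inside i  = trans (ext-toℕ (ω c) i) (toℕ-ω c i)
  ... | outside p≤x with m≤n⇒∃[o]m+o≡n (≤-trans (bound c) p≤x)
  ...   | k , refl = trans (ext-≥ (ω c) p≤x) (sym (trans (cong ⟦ c ⟧ eq) (trans (swapBlocks-after (p c) (suc (r c)) (suc (q c)) k) (sym eq))))
    where
    eq : p c + (suc (r c) + suc (q c)) + k ≡ p c + (suc (r c) + (suc (q c) + k))
    eq = trans (+-assoc (p c) _ k) (cong (p c +_) (+-assoc (suc (r c)) (suc (q c)) k))

  flip-ω : ∀ {m} (c : Composition m) → flip (ω c) ≈ ω (c ᵀ)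
  flip-ω c i = refl

  descendsOnlyAt-resp : ∀ {F G} → F ≗ G → ∀ {d} → DescendsOnlyAt F d → DescendsOnlyAt G d
  descendsOnlyAt-resp eq {d} (descent , ascents) =
    subst₂ _<_ (eq (suc d)) (eq d) descent , λ x x≢d → subst₂ _<_ (eq x) (eq (suc x)) (ascents x x≢d)

  ω-oneDescent : ∀ {m} (c : Composition m) → OneDescent (ω c)
  ω-oneDescent c = oneDescent⁺ (ω c) (p c + r c , descendsOnlyAt-resp (λ x → sym (ext-ω c x)) (swapBlocks-descends (p c) (r c) (q c)))

  oneDescent-resp : ∀ {n} {σ τ : Permutation′ n} → σ ≈ τ → OneDescent σ → OneDescent τ
  oneDescent-resp {σ = σ} {τ} σ≈τ one = let d , D = oneDescent⁻ σ one in
    oneDescent⁺ τ (d , descendsOnlyAt-resp (ext-cong σ≈τ) D)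

  flip-cong : ∀ {n} {σ τ : Permutation′ n} → σ ≈ τ → flip σ ≈ flip τ
  flip-cong {σ = σ} {τ} σ≈τ i = begin
    σ ⟨$⟩ˡ i                      ≡⟨ cong (σ ⟨$⟩ˡ_) (inverseʳ τ) ⟨
    σ ⟨$⟩ˡ (τ ⟨$⟩ʳ (τ ⟨$⟩ˡ i))    ≡⟨ cong (σ ⟨$⟩ˡ_) (σ≈τ (τ ⟨$⟩ˡ i)) ⟨
    σ ⟨$⟩ˡ (σ ⟨$⟩ʳ (τ ⟨$⟩ˡ i))    ≡⟨ inverseˡ σ ⟩
    τ ⟨$⟩ˡ i                      ∎

  bigrassmannian-resp : ∀ {n} {σ τ : Permutation′ n} → σ ≈ τ → Bigrassmannian σ → Bigrassmannian τ
  bigrassmannian-resp {σ = σ} {τ} σ≈τ (one , one′) =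
    oneDescent-resp {σ = σ} {τ} σ≈τ one , oneDescent-resp {σ = flip σ} {flip τ} (flip-cong {σ = σ} {τ} σ≈τ) one′

  ω-bigrassmannian : ∀ {m} (c : Composition m) → Bigrassmannian (ω c)
  ω-bigrassmannian c = ω-oneDescent c , oneDescent-resp {σ = ω (c ᵀ)} {flip (ω c)} (≈-sym {σ = flip (ω c)} {ω (c ᵀ)} (flip-ω c)) (ω-oneDescent (c ᵀ))

  bigrassmannian⇒ω : ∀ {m} (σ : Permutation′ (2 + m)) → Bigrassmannian σ → ∃[ c ] σ ≈ ω c
  bigrassmannian⇒ω {m} σ (one , one′)
    with one-descent⇒swapBlocks (ext-flip′ σ) (ext-flip σ) (oneDescent⁻ σ one) (oneDescent⁻ (flip σ) one′) (2 + m , λ x → ext-≥ σ)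
  ... | a , r , q , eq = c , ext-injective {σ = σ} {ω c} (λ x → trans (eq x) (sym (ext-ω c x)))
    where
    last : ℕ
    last = a + (suc r + q)
    σ[last] : ext σ last ≡ a + q
    σ[last] = trans (eq last) (swapBlocks-down a (n<1+n q))
    -- The last point of the second block is moved, whereas the extension fixes everything from 2 +
    -- m on; hence both blocks fit.
    last<n : last < 2 + m
    last<n = ≰⇒> λ n≤last → contradiction (+-cancelˡ-≡ a _ _ (trans (sym (ext-≥ σ n≤last)) σ[last])) (m≢1+n+m q ∘ sym)
    z : ℕ
    z = 2 + m ∸ suc last
    total′ : a + z + (q + r) ≡ m
    total′ = suc-injective (suc-injective (begin
      2 + (a + z + (q + r))     ≡⟨ size a q r z ⟩
      suc last + z              ≡⟨ m+[n∸m]≡n last<n ⟩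
      2 + m                     ∎))
      where
      size : ∀ a q r s → 2 + (a + s + (q + r)) ≡ suc (a + (suc r + q)) + s
      size = solve-∀
    c : Composition m
    c = composition a q r z total′

  -- The order on the bigrassmannian permutations

  data Transposition {n} (i j : Fin n) : Fin n → Fin n → Set where
    fst   : Transposition i j i j
    snd   : Transposition i j j i
    other : ∀ {k} → k ≢ i → k ≢ j → Transposition i j k k

  transposition : ∀ {n} (i j k : Fin n) → Transposition i j k (Components.transpose i j k)
  transposition i j k with k Fin.≟ i
  ... | yes refl = fst
  ... | no k≢i with k Fin.≟ j
  ...   | yes refl = snd
  ...   | no k≢j   = other k≢i k≢j

  transpose-fst : ∀ {n} (i j : Fin n) → Components.transpose i j i ≡ j
  transpose-fst i j with Components.transpose i j i | transposition i j i
  ... | _ | fst         = refl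
  ... | _ | snd         = refl
  ... | _ | other i≢i _ = contradiction refl i≢i

  transpose-snd : ∀ {n} (i j : Fin n) → Components.transpose i j j ≡ i
  transpose-snd i j with Components.transpose i j j | transposition i j j
  ... | _ | fst         = refl
  ... | _ | snd         = refl
  ... | _ | other _ j≢j = contradiction refl j≢j

  transpose-other : ∀ {n} {i j k : Fin n} → k ≢ i → k ≢ j → Components.transpose i j k ≡ k
  transpose-other {i = i} {j} {k} k≢i k≢j with Components.transpose i j k | transposition i j k
  ... | _ | fst       = contradiction refl k≢i
  ... | _ | snd       = contradiction refl k≢j
  ... | _ | other _ _ = refl

  ⇝-lift : ∀ {n} {σ σ′ τ : Permutation′ n} → σ ≈ σ′ → σ ⇝ τ → ∃[ τ′ ] σ′ ⇝ τ′ × τ ≈ τ′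
  ⇝-lift σ≈σ′ (reduce {i} {j} i<j σj<σi) =
    _ , reduce i<j (subst₂ Fin._<_ (σ≈σ′ j) (σ≈σ′ i) σj<σi) , λ k → σ≈σ′ (transpose i j ⟨$⟩ʳ k)

  -- Transitivity requires this: a chain in `_≤ᴮ_` ends only up to `_≈_`, so the next chain has to
  -- be replayed from a pointwise equal start.
  ⇝*-lift : ∀ {n} {σ σ′ τ : Permutation′ n} → σ ≈ σ′ → Star _⇝_ σ τ → ∃[ τ′ ] Star _⇝_ σ′ τ′ × τ ≈ τ′
  ⇝*-lift {σ′ = σ′} σ≈σ′ ε = σ′ , ε , σ≈σ′
  ⇝*-lift σ≈σ′ (step ◅ steps) =
    let _ , step′ , ρ≈ρ′ = ⇝-lift σ≈σ′ step ; τ′ , steps′ , τ≈τ′ = ⇝*-lift ρ≈ρ′ steps in τ′ , step′ ◅ steps′ , τ≈τ′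

  ≈⇒≤ᴮ : ∀ {n} {π σ : Permutation′ n} → σ ≈ π → π ≤ᴮ σ
  ≈⇒≤ᴮ {σ = σ} σ≈π = σ , ε , σ≈π

  ≤ᴮ-trans : ∀ {n} {π ρ σ : Permutation′ n} → π ≤ᴮ ρ → ρ ≤ᴮ σ → π ≤ᴮ σ
  ≤ᴮ-trans (π′ , ρ⇝π′ , π′≈π) (ρ′ , σ⇝ρ′ , ρ′≈ρ) =
    let π″ , ρ′⇝π″ , π′≈π″ = ⇝*-lift (λ i → sym (ρ′≈ρ i)) ρ⇝π′ in
    π″ , σ⇝ρ′ ◅◅ ρ′⇝π″ , λ i → trans (sym (π′≈π″ i)) (π′≈π i)

  ≤ᴮ-resp-≈ : ∀ {n} {π π′ σ σ′ : Permutation′ n} → π ≈ π′ → σ ≈ σ′ → π ≤ᴮ σ → π′ ≤ᴮ σ′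
  ≤ᴮ-resp-≈ {π = π} {π′} {σ} {σ′} π≈π′ σ≈σ′ π≤σ =
    ≤ᴮ-trans {π = π′} {π} {σ′} (≈⇒≤ᴮ {π = π′} {π} π≈π′) (≤ᴮ-trans {π = π} {σ} {σ′} π≤σ (≈⇒≤ᴮ {π = σ} {σ′} (λ i → sym (σ≈σ′ i))))

  ≤ᴮ-reduce : ∀ {n} {π σ τ : Permutation′ n} → σ ⇝ τ → π ≤ᴮ τ → π ≤ᴮ σ
  ≤ᴮ-reduce step (π′ , steps , π′≈π) = π′ , step ◅ steps , π′≈π

  -- The inversion of σ at positions i < j is the inversion of the inverse at positions σ j < σ i.
  -- Consequently inversion of permutations preserves the order.
  flip-reduce : ∀ {n} {σ τ : Permutation′ n} → σ ⇝ τ → ∃[ τ′ ] flip σ ⇝ τ′ × τ′ ≈ flip τ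
  flip-reduce {σ = σ} (reduce {i} {j} i<j σj<σi) =
    _ , reduce σj<σi (subst₂ Fin._<_ (sym (inverseˡ σ)) (sym (inverseˡ σ)) i<j) , flips
    where
    flips : ∀ k → σ ⟨$⟩ˡ Components.transpose (σ ⟨$⟩ʳ j) (σ ⟨$⟩ʳ i) k ≡ Components.transpose j i (σ ⟨$⟩ˡ k)
    flips k with Components.transpose (σ ⟨$⟩ʳ j) (σ ⟨$⟩ʳ i) k | transposition (σ ⟨$⟩ʳ j) (σ ⟨$⟩ʳ i) k
    ... | _ | fst = trans (inverseˡ σ) (sym (trans (cong (Components.transpose j i) (inverseˡ σ)) (transpose-fst j i)))
    ... | _ | snd = trans (inverseˡ σ) (sym (trans (cong (Components.transpose j i) (inverseˡ σ)) (transpose-snd j i)))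
    ... | _ | other k≢σj k≢σi = sym (transpose-other (λ { refl → k≢σj (sym (inverseʳ σ)) }) (λ { refl → k≢σi (sym (inverseʳ σ)) }))

  ≤ᴮ-flip : ∀ {n} {π σ : Permutation′ n} → π ≤ᴮ σ → flip π ≤ᴮ flip σ
  ≤ᴮ-flip {π = π} {σ} (π′ , ε , σ≈π) = ≈⇒≤ᴮ {π = flip π} {flip σ} (flip-cong {σ = σ} {π} σ≈π)
  ≤ᴮ-flip {π = π} {σ} (π′ , _◅_ {j = ρ} step steps , π′≈π) =
    let ρ′ , step′ , ρ′≈ = flip-reduce step in
    ≤ᴮ-reduce {π = flip π} {flip σ} {ρ′} step′ (≤ᴮ-trans {π = flip π} {flip ρ} {ρ′} (≤ᴮ-flip {π = π} {ρ} (π′ , steps , π′≈π)) (≈⇒≤ᴮ {π = flip ρ} {ρ′} ρ′≈))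

  ≤ᴮ-preserves : ∀ {n} (Q : Permutation′ n → Set) → (∀ {σ τ} → σ ≈ τ → Q σ → Q τ) → (∀ {σ τ} → σ ⇝ τ → Q σ → Q τ) →
    ∀ {π σ} → π ≤ᴮ σ → Q σ → Q π
  ≤ᴮ-preserves Q resp step {π} (π′ , steps , π′≈π) Qσ = resp {π′} {π} π′≈π (along steps Qσ)
    where
    along : ∀ {σ τ} → Star _⇝_ σ τ → Q σ → Q τ
    along ε             Qσ = Qσ
    along (st ◅ steps) Qσ = along steps (step st Qσ)

  -- A reduction does not increase the largest displacements to the right and to
  -- the left, and keeps the fixed points of a fixed initial or final segment.
  RightBounded LeftBounded FixesBelow FixesFrom : ∀ {n} → ℕ → Permutation′ n → Set
  RightBounded b σ = ∀ i → toℕ (σ ⟨$⟩ʳ i) ≤ toℕ i + b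
  LeftBounded  b σ = ∀ i → toℕ i ≤ toℕ (σ ⟨$⟩ʳ i) + b
  FixesBelow   b σ = ∀ i → toℕ i < b → σ ⟨$⟩ʳ i ≡ i
  FixesFrom    b σ = ∀ i → b ≤ toℕ i → σ ⟨$⟩ʳ i ≡ i

  perm-injective : ∀ {n} (σ : Permutation′ n) {i j} → σ ⟨$⟩ʳ i ≡ σ ⟨$⟩ʳ j → i ≡ j
  perm-injective σ eq = trans (sym (inverseˡ σ)) (trans (cong (σ ⟨$⟩ˡ_) eq) (inverseˡ σ))

  rightBounded-⇝ : ∀ {n b} {σ τ : Permutation′ n} → σ ⇝ τ → RightBounded b σ → RightBounded b τ
  rightBounded-⇝ {b = b} {σ} (reduce {i} {j} i<j σj<σi) bounded k with Components.transpose i j k | transposition i j k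
  ... | _ | fst       = ≤-trans (<⇒≤ σj<σi) (bounded i)
  ... | _ | snd       = ≤-trans (bounded i) (+-monoˡ-≤ b (<⇒≤ i<j))
  ... | _ | other _ _ = bounded k

  leftBounded-⇝ : ∀ {n b} {σ τ : Permutation′ n} → σ ⇝ τ → LeftBounded b σ → LeftBounded b τ
  leftBounded-⇝ {b = b} {σ} (reduce {i} {j} i<j σj<σi) bounded k with Components.transpose i j k | transposition i j k
  ... | _ | fst       = ≤-trans (<⇒≤ i<j) (bounded j)
  ... | _ | snd       = ≤-trans (bounded j) (+-monoˡ-≤ b (<⇒≤ σj<σi))
  ... | _ | other _ _ = bounded k

  -- No reduction touches a position i < b: then σ j < σ i = i, so σ j would be a fixed point, hence
  -- equal to j, although i < j.
  fixesBelow-⇝ : ∀ {n b} {σ τ : Permutation′ n} → σ ⇝ τ → FixesBelow b σ → FixesBelow b τ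
  fixesBelow-⇝ {b = b} {σ} (reduce {i} {j} i<j σj<σi) fixes k k<b =
    trans (cong (σ ⟨$⟩ʳ_) (transpose-other (λ { refl → i≮b k<b }) (λ { refl → i≮b (<-trans i<j k<b) }))) (fixes k k<b)
    where
    i≮b : ¬ toℕ i < b
    i≮b i<b = <-asym i<j (subst (Fin._< i) σj≡j σj<i)
      where
      σj<i : σ ⟨$⟩ʳ j Fin.< i
      σj<i = subst (σ ⟨$⟩ʳ j Fin.<_) (fixes i i<b) σj<σi
      σj≡j : σ ⟨$⟩ʳ j ≡ j
      σj≡j = perm-injective σ (fixes (σ ⟨$⟩ʳ j) (<-trans σj<i i<b))

  fixesFrom-⇝ : ∀ {n b} {σ τ : Permutation′ n} → σ ⇝ τ → FixesFrom b σ → FixesFrom b τ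
  fixesFrom-⇝ {b = b} {σ} (reduce {i} {j} i<j σj<σi) fixes k b≤k =
    trans (cong (σ ⟨$⟩ʳ_) (transpose-other (λ { refl → b≰j (≤-trans b≤k (<⇒≤ i<j)) }) (λ { refl → b≰j b≤k }))) (fixes k b≤k)
    where
    b≰j : ¬ b ≤ toℕ j
    b≰j b≤j = <-asym i<j (subst (j Fin.<_) σi≡i j<σi)
      where
      j<σi : j Fin.< σ ⟨$⟩ʳ i
      j<σi = subst (Fin._< σ ⟨$⟩ʳ i) (fixes j b≤j) σj<σi
      σi≡i : σ ⟨$⟩ʳ i ≡ i
      σi≡i = perm-injective σ (fixes (σ ⟨$⟩ʳ i) (≤-trans b≤j (<⇒≤ j<σi)))

  infix 4 _⊑_
  _⊑_ : ∀ {m} → Composition m → Composition m → Set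
  c′ ⊑ c = p c ≤ p c′ × s c ≤ s c′ × q c′ ≤ q c × r c′ ≤ r c

  ⟦⟧-up : ∀ {m} (c : Composition m) {k} → k < suc (r c) → ⟦ c ⟧ (p c + k) ≡ p c + (suc (q c) + k)
  ⟦⟧-up c = swapBlocks-up (p c)

  ⟦⟧-down : ∀ {m} (c : Composition m) {k} → k < suc (q c) → ⟦ c ⟧ (p c + (suc (r c) + k)) ≡ p c + k
  ⟦⟧-down c = swapBlocks-down (p c)

  ⟦⟧-after : ∀ {m} (c : Composition m) k → ⟦ c ⟧ (p c + (suc (r c) + (suc (q c) + k))) ≡ p c + (suc (r c) + (suc (q c) + k))
  ⟦⟧-after c = swapBlocks-after (p c) (suc (r c)) (suc (q c))

  ⟦⟧-≤ : ∀ {m} (c : Composition m) x → ⟦ c ⟧ x ≤ x + suc (q c)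
  ⟦⟧-≤ c x with region (p c) (suc (r c)) (suc (q c)) x
  ... | before x<p   = subst (_≤ x + suc (q c)) (sym (swapBlocks-before (p c) x<p)) (m≤m+n x _)
  ... | up {k} k<r   = ≤-reflexive (trans (⟦⟧-up c k<r) (trans (cong (p c +_) (+-comm (suc (q c)) k)) (sym (+-assoc (p c) k (suc (q c))))))
  ... | down {k} k<q = subst (_≤ x + suc (q c)) (sym (⟦⟧-down c k<q)) (≤-trans (+-monoʳ-≤ (p c) (m≤n+m k (suc (r c)))) (m≤m+n x _))
  ... | after k      = subst (_≤ x + suc (q c)) (sym (⟦⟧-after c k)) (m≤m+n x _)

  rightBounded-ω : ∀ {m} (c : Composition m) → RightBounded (suc (q c)) (ω c)
  rightBounded-ω c i = subst (_≤ toℕ i + suc (q c)) (sym (toℕ-ω c i)) (⟦⟧-≤ c (toℕ i))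

  leftBounded-ω : ∀ {m} (c : Composition m) → LeftBounded (suc (r c)) (ω c)
  leftBounded-ω c i = subst (λ j → toℕ j ≤ toℕ (ω c ⟨$⟩ʳ i) + suc (r c)) (inverseˡ (ω c)) (rightBounded-ω (c ᵀ) (ω c ⟨$⟩ʳ i))

  fixesBelow-ω : ∀ {m} (c : Composition m) → FixesBelow (p c) (ω c)
  fixesBelow-ω c i i<p = Fin.toℕ-injective (trans (toℕ-ω c i) (swapBlocks-before (p c) i<p))

  fixesFrom-ω : ∀ {m} (c : Composition m) → FixesFrom (p c + (suc (r c) + suc (q c))) (ω c)
  fixesFrom-ω c i b≤i with m≤n⇒∃[o]m+o≡n b≤i
  ... | k , b+k≡i = Fin.toℕ-injective (begin
      toℕ (ω c ⟨$⟩ʳ i)      ≡⟨ toℕ-ω c i ⟩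
      ⟦ c ⟧ (toℕ i)         ≡⟨ cong ⟦ c ⟧ i≡ ⟩
      ⟦ c ⟧ _               ≡⟨ ⟦⟧-after c k ⟩
      _                     ≡⟨ i≡ ⟨
      toℕ i                 ∎)
    where
    i≡ : toℕ i ≡ p c + (suc (r c) + (suc (q c) + k))
    i≡ = trans (sym b+k≡i) (trans (+-assoc (p c) _ k) (cong (p c +_) (+-assoc (suc (r c)) (suc (q c)) k)))

  module _ {m} (c : Composition m) where

    at-position : ∀ {Q : Fin (2 + m) → ℕ → Set} → (∀ i → Q i (toℕ (ω c ⟨$⟩ʳ i))) →
      ∀ {x y} → x < 2 + m → ⟦ c ⟧ x ≡ y → ∃[ i ] toℕ i ≡ x × Q i y
    at-position {Q} all {x} x<n eq = i , i≡x , subst (Q i) (trans (toℕ-ω c i) (trans (cong ⟦ c ⟧ i≡x) eq)) (all i)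
      where
      i = fromℕ< x<n
      i≡x : toℕ i ≡ x
      i≡x = Fin.toℕ-fromℕ< x<n

    position<n : ∀ {k} → k < suc (r c) + suc (q c) → p c + k < 2 + m
    position<n k< = <-≤-trans (+-monoʳ-< (p c) k<) (bound c)

  -- Each inequality tests an invariant of `ω c` at one point of `ω c′`. The first block moves right
  -- by q′ + 1 and the second left by r′ + 1; the first point of the first block and the last point
  -- of the second are moved, so they lie outside the fixed segments of `ω c`.
  ω≤ᴮω⇒⊑ : ∀ {m} (c′ c : Composition m) → ω c′ ≤ᴮ ω c → c′ ⊑ c
  ω≤ᴮω⇒⊑ {m} c′ c le = p≤p′ , s≤s′ , q′≤q , r′≤r
    where
    first : p c′ + 0 < 2 + m
    first = position<n c′ z<s
    ⟦first⟧ : ⟦ c′ ⟧ (p c′ + 0) ≡ p c′ + (suc (q c′) + 0)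
    ⟦first⟧ = ⟦⟧-up c′ z<s

    q′≤q : q c′ ≤ q c
    q′≤q with at-position c′ {λ i y → y ≤ toℕ i + suc (q c)}
      (≤ᴮ-preserves (RightBounded (suc (q c))) (λ {σ} {τ} σ≈τ B i → subst (λ j → toℕ j ≤ toℕ i + suc (q c)) (σ≈τ i) (B i)) (λ {σ} {τ} → rightBounded-⇝) {ω c′} {ω c} le (rightBounded-ω c))
      first ⟦first⟧
    ... | i , i≡ , B = s≤s⁻¹ (+-cancelˡ-≤ (p c′) _ _ (subst₂ _≤_ (cong (p c′ +_) (+-identityʳ _)) (cong (_+ suc (q c)) (trans i≡ (+-identityʳ _))) B))

    r′≤r : r c′ ≤ r c
    r′≤r with at-position c′ {λ i y → toℕ i ≤ y + suc (r c)}
      (≤ᴮ-preserves (LeftBounded (suc (r c))) (λ {σ} {τ} σ≈τ B i → subst (λ j → toℕ i ≤ toℕ j + suc (r c)) (σ≈τ i) (B i)) (λ {σ} {τ} → leftBounded-⇝) {ω c′} {ω c} le (leftBounded-ω c))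
      (position<n c′ (+-monoʳ-< (suc (r c′)) z<s)) (⟦⟧-down c′ z<s)
    ... | i , i≡ , B = s≤s⁻¹ (+-cancelˡ-≤ (p c′) _ _ (subst₂ _≤_ (trans i≡ (cong (p c′ +_) (+-identityʳ _))) (cong (_+ suc (r c)) (+-identityʳ (p c′))) B))

    p≤p′ : p c ≤ p c′
    p≤p′ = ≮⇒≥ λ p′<p → let
        i , i≡ , fixed = at-position c′ {λ i y → toℕ i < p c → y ≡ toℕ i}
          (λ i i<p → cong toℕ (≤ᴮ-preserves (FixesBelow (p c)) (λ {σ} {τ} σ≈τ B i lt → trans (sym (σ≈τ i)) (B i lt)) (λ {σ} {τ} → fixesBelow-⇝) {ω c′} {ω c} le (fixesBelow-ω c) i i<p))
          first ⟦first⟧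
      in contradiction (trans (fixed (subst (_< p c) (sym (trans i≡ (+-identityʳ _))) p′<p)) i≡) (first-moved (p c′))
      where
      first-moved : ∀ x → x + (suc (q c′) + 0) ≢ x + 0
      first-moved x eq with () ← +-cancelˡ-≡ x _ _ eq

    last<c : p c′ + (suc (r c′) + q c′) < p c + (suc (r c) + suc (q c))
    last<c = ≰⇒> λ c≤last → let
        i , i≡ , fixed = at-position c′ {λ i y → p c + (suc (r c) + suc (q c)) ≤ toℕ i → y ≡ toℕ i}
          (λ i c≤i → cong toℕ (≤ᴮ-preserves (FixesFrom (p c + (suc (r c) + suc (q c)))) (λ {σ} {τ} σ≈τ B i lt → trans (sym (σ≈τ i)) (B i lt)) (λ {σ} {τ} → fixesFrom-⇝) {ω c′} {ω c} le (fixesFrom-ω c) i c≤i))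
          (position<n c′ (+-monoʳ-< (suc (r c′)) (n<1+n (q c′)))) (⟦⟧-down c′ (n<1+n (q c′)))
      in contradiction (+-cancelˡ-≡ (p c′) _ _ (trans (fixed (subst (_ ≤_) (sym i≡) c≤last)) i≡)) (m≢1+n+m (q c′))

    s≤s′ : s c ≤ s c′
    -- Both permutations have length 2 + m, so blocks that end no later leave at least as many
    -- points after them.
    s≤s′ = +-cancelˡ-≤ (p c + (suc (r c) + suc (q c))) (s c) (s c′) (subst (_≤ p c + (suc (r c) + suc (q c)) + s c′) sizes (+-monoˡ-≤ (s c′) end≤))
      where
      end≤ : p c′ + (suc (r c′) + suc (q c′)) ≤ p c + (suc (r c) + suc (q c))
      end≤ = subst (_≤ p c + (suc (r c) + suc (q c))) (trans (sym (+-suc (p c′) _)) (cong (p c′ +_) (sym (+-suc (suc (r c′)) (q c′))))) last<c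
      sizes : p c′ + (suc (r c′) + suc (q c′)) + s c′ ≡ p c + (suc (r c) + suc (q c)) + s c
      sizes = begin
        p c′ + (suc (r c′) + suc (q c′)) + s c′       ≡⟨ size-lemma (p c′) (q c′) (r c′) (s c′) ⟩
        2 + (p c′ + s c′ + (q c′ + r c′))             ≡⟨ cong (2 +_) (trans (total c′) (sym (total c))) ⟩
        2 + (p c + s c + (q c + r c))                 ≡⟨ size-lemma (p c) (q c) (r c) (s c) ⟨
        p c + (suc (r c) + suc (q c)) + s c           ∎

  -- Chains of reductions between block interchanges

  ext-transpose-fst : ∀ {n} (σ : Permutation′ n) i j → ext (transpose i j ∘ₚ σ) (toℕ i) ≡ ext σ (toℕ j)
  ext-transpose-fst σ i j = trans (ext-toℕ (transpose i j ∘ₚ σ) i) (trans (cong (λ k → toℕ (σ ⟨$⟩ʳ k)) (transpose-fst i j)) (sym (ext-toℕ σ j)))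

  ext-transpose-snd : ∀ {n} (σ : Permutation′ n) i j → ext (transpose i j ∘ₚ σ) (toℕ j) ≡ ext σ (toℕ i)
  ext-transpose-snd σ i j = trans (ext-toℕ (transpose i j ∘ₚ σ) j) (trans (cong (λ k → toℕ (σ ⟨$⟩ʳ k)) (transpose-snd i j)) (sym (ext-toℕ σ i)))

  ext-transpose-other : ∀ {n} (σ : Permutation′ n) i j {x} → x ≢ toℕ i → x ≢ toℕ j → ext (transpose i j ∘ₚ σ) x ≡ ext σ x
  ext-transpose-other {n} σ i j {x} x≢i x≢j with position n x
  ... | inside k  = trans (ext-toℕ (transpose i j ∘ₚ σ) k) (trans (cong (λ l → toℕ (σ ⟨$⟩ʳ l)) (transpose-other (x≢i ∘ cong toℕ) (x≢j ∘ cong toℕ))) (sym (ext-toℕ σ k)))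
  ... | outside q = trans (ext-≥ (transpose i j ∘ₚ σ) q) (sym (ext-≥ σ q))

  -- Exchanging the position h with i, i + 1, …, i + k - 1 in turn moves the
  -- values V 0 < V 1 < ⋯ < V k one place to the left along i, …, i + k - 1, h.
  ≤ᴮ-cycle : ∀ {n} k i h (V : ℕ → ℕ) (τ σ : Permutation′ n) → i + k ≤ h → h < n → (∀ j → j < k → V j < V (suc j)) →
    ext σ h ≡ V 0 → (∀ j → j < k → ext σ (i + j) ≡ V (suc j)) →
    ext τ h ≡ V k → (∀ j → j < k → ext τ (i + j) ≡ V j) →
    (∀ x → x ≢ h → x < i ⊎ i + k ≤ x → ext τ x ≡ ext σ x) → τ ≤ᴮ σ
  ≤ᴮ-cycle zero i h V τ σ i≤h h<n V-increasing σ[h] σ[i+_] τ[h] τ[i+_] elsewhere =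
    ≈⇒≤ᴮ {π = τ} {σ} (ext-injective {σ = σ} {τ} λ x → sym (same x))
    where
    same : ∀ x → ext τ x ≡ ext σ x
    same x with x ≟ h
    ... | yes refl = trans τ[h] (sym σ[h])
    ... | no x≢h with <-≤-connex x (i + 0)
    ...   | inj₁ x<i = elsewhere x x≢h (inj₁ (subst (x <_) (+-identityʳ i) x<i))
    ...   | inj₂ i≤x = elsewhere x x≢h (inj₂ i≤x)
  ≤ᴮ-cycle {n} (suc k) i h V τ σ i+1+k≤h h<n V-increasing σ[h] σ[i+_] τ[h] τ[i+_] elsewhere =
    ≤ᴮ-reduce {π = τ} {σ} {σ′} step (≤ᴮ-cycle k (suc i) h (V ∘ suc) τ σ′ 1+i+k≤h h<n (λ j j<k → V-increasing (suc j) (s≤s j<k))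
      σ′[h] σ′[1+i+_] τ[h] (λ j j<k → trans (cong (ext τ) (sym (+-suc i j))) (τ[i+_] (suc j) (s≤s j<k))) elsewhere′)
    where
    1+i+k≤h : suc i + k ≤ h
    1+i+k≤h = subst (_≤ h) (+-suc i k) i+1+k≤h
    i<h : i < h
    i<h = ≤-trans (m≤m+n (suc i) k) 1+i+k≤h
    fi fh : Fin n
    fi = fromℕ< (<-trans i<h h<n)
    fh = fromℕ< h<n
    fi≡i : toℕ fi ≡ i
    fi≡i = Fin.toℕ-fromℕ< (<-trans i<h h<n)
    fh≡h : toℕ fh ≡ h
    fh≡h = Fin.toℕ-fromℕ< h<n
    σ′ : Permutation′ n
    σ′ = transpose fi fh ∘ₚ σ
    σ[i] : ext σ i ≡ V 1
    σ[i] = trans (cong (ext σ) (sym (+-identityʳ i))) (σ[i+_] 0 z<s)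
    step : σ ⇝ σ′
    step = reduce (subst₂ _<_ (sym fi≡i) (sym fh≡h) i<h)
      (subst₂ _<_ (trans (sym σ[h]) (trans (cong (ext σ) (sym fh≡h)) (ext-toℕ σ fh))) (trans (sym σ[i]) (trans (cong (ext σ) (sym fi≡i)) (ext-toℕ σ fi))) (V-increasing 0 z<s))
    σ′[h] : ext σ′ h ≡ V 1
    σ′[h] = begin
      ext σ′ h           ≡⟨ cong (ext σ′) fh≡h ⟨
      ext σ′ (toℕ fh)    ≡⟨ ext-transpose-snd σ fi fh ⟩
      ext σ (toℕ fi)     ≡⟨ cong (ext σ) fi≡i ⟩
      ext σ i            ≡⟨ σ[i] ⟩
      V 1                ∎
    σ′≡σ : ∀ {x} → x ≢ i → x ≢ h → ext σ′ x ≡ ext σ x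
    σ′≡σ x≢i x≢h = ext-transpose-other σ fi fh (λ eq → x≢i (trans eq fi≡i)) (λ eq → x≢h (trans eq fh≡h))
    σ′[1+i+_] : ∀ j → j < k → ext σ′ (suc i + j) ≡ V (2 + j)
    σ′[1+i+_] j j<k = trans (σ′≡σ (m≢1+m+n i ∘ sym) (<⇒≢ (<-≤-trans (+-monoʳ-< (suc i) j<k) 1+i+k≤h)))
      (trans (cong (ext σ) (sym (+-suc i j))) (σ[i+_] (suc j) (s≤s j<k)))
    elsewhere′ : ∀ x → x ≢ h → x < suc i ⊎ suc i + k ≤ x → ext τ x ≡ ext σ′ x
    elsewhere′ x x≢h (inj₂ 1+i+k≤x) = trans (elsewhere x x≢h (inj₂ (subst (_≤ x) (sym (+-suc i k)) 1+i+k≤x)))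
      (sym (σ′≡σ (>⇒≢ (≤-trans (m≤m+n (suc i) k) 1+i+k≤x)) x≢h))
    elsewhere′ x x≢h (inj₁ x<1+i) with m≤n⇒m<n∨m≡n (s≤s⁻¹ x<1+i)
    ... | inj₁ x<i  = trans (elsewhere x x≢h (inj₁ x<i)) (sym (σ′≡σ (<⇒≢ x<i) x≢h))
    ... | inj₂ refl = begin
      ext τ x            ≡⟨ cong (ext τ) (+-identityʳ x) ⟨
      ext τ (x + 0)      ≡⟨ τ[i+_] 0 z<s ⟩
      V 0                ≡⟨ σ[h] ⟨
      ext σ h            ≡⟨ cong (ext σ) fh≡h ⟨
      ext σ (toℕ fh)     ≡⟨ ext-transpose-fst σ fi fh ⟨
      ext σ′ (toℕ fi)    ≡⟨ cong (ext σ′) fi≡i ⟩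
      ext σ′ x           ∎

  shift-p : ∀ {m} p q r s → p + s + (suc q + r) ≡ m → suc p + s + (q + r) ≡ m
  shift-p p q r s refl = sym (+-suc (p + s) (q + r))

  shift-s : ∀ {m} p q r s → p + s + (suc q + r) ≡ m → p + suc s + (q + r) ≡ m
  shift-s p q r s refl = trans (cong (_+ (q + r)) (+-suc p s)) (sym (+-suc (p + s) (q + r)))

  -- The value p, first entry of the second block, is carried from h to position p. It is fixed
  -- there, and the first block has moved one place to the right.
  ω-shift-p : ∀ {m} p q r s (total : p + s + (suc q + r) ≡ m) →
    ω (composition (suc p) q r s (shift-p p q r s total)) ≤ᴮ ω (composition p (suc q) r s total)
  ω-shift-p {m} p q r s total = ≤ᴮ-cycle (suc r) p h V (ω c′) (ω c) ≤-refl (position<n c (+-monoʳ-< 1 (m<m+n r z<s)))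
      V-increasing
      (trans (ext-ω c h) (trans (cong (λ y → ⟦ c ⟧ (p + y)) (sym (+-identityʳ (suc r)))) (trans (⟦⟧-down c z<s) (+-identityʳ p))))
      (λ j j<1+r → trans (ext-ω c (p + j)) (⟦⟧-up c j<1+r))
      (τ[p+1+_] r (n<1+n r)) τ[p+_] elsewhere
    where
    c c′ : Composition m
    c  = composition p (suc q) r s total
    c′ = composition (suc p) q r s (shift-p p q r s total)
    h : ℕ
    h = p + suc r
    V : ℕ → ℕ
    V zero    = p
    V (suc j) = p + (suc (suc q) + j)
    V-increasing : ∀ j → j < suc r → V j < V (suc j)
    V-increasing zero    _ = m<m+n p z<s
    V-increasing (suc j) _ = +-monoʳ-< p (+-monoʳ-< (suc (suc q)) (n<1+n j))
    τ[p+1+_] : ∀ j → j < suc r → ext (ω c′) (p + suc j) ≡ V (suc j)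
    τ[p+1+_] j j<1+r = begin
      ext (ω c′) (p + suc j)        ≡⟨ ext-ω c′ (p + suc j) ⟩
      ⟦ c′ ⟧ (p + suc j)            ≡⟨ cong ⟦ c′ ⟧ (+-suc p j) ⟩
      ⟦ c′ ⟧ (suc p + j)            ≡⟨ ⟦⟧-up c′ j<1+r ⟩
      suc p + (suc q + j)           ≡⟨ +-suc p (suc q + j) ⟨
      p + (suc (suc q) + j)         ∎
    τ[p+_] : ∀ j → j < suc r → ext (ω c′) (p + j) ≡ V j
    τ[p+_] zero    _     = trans (ext-ω c′ (p + 0)) (trans (swapBlocks-before (suc p) (s≤s (≤-reflexive (+-identityʳ p)))) (+-identityʳ p))
    τ[p+_] (suc j) j<1+r = τ[p+1+_] j (<-trans (n<1+n j) j<1+r)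
    elsewhere : ∀ x → x ≢ h → x < p ⊎ p + suc r ≤ x → ext (ω c′) x ≡ ext (ω c) x
    elsewhere x x≢h (inj₁ x<p) = trans (ext-ω c′ x) (trans (swapBlocks-before (suc p) (m<n⇒m<1+n x<p))
      (sym (trans (ext-ω c x) (swapBlocks-before p x<p))))
    elsewhere x x≢h (inj₂ h≤x) with m≤n⇒∃[o]m+o≡n h≤x
    ... | zero  , refl = contradiction (+-identityʳ h) x≢h
    ... | suc k , refl with split-at (suc q) k
    ...   | inj₁ k<1+q = begin
      ext (ω c′) (h + suc k)            ≡⟨ ext-ω c′ (h + suc k) ⟩
      ⟦ c′ ⟧ (h + suc k)                ≡⟨ cong ⟦ c′ ⟧ (pos₁ p r k) ⟩
      ⟦ c′ ⟧ (suc p + (suc r + k))      ≡⟨ ⟦⟧-down c′ k<1+q ⟩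
      suc p + k                         ≡⟨ +-suc p k ⟨
      p + suc k                         ≡⟨ ⟦⟧-down c (s≤s k<1+q) ⟨
      ⟦ c ⟧ (p + (suc r + suc k))       ≡⟨ cong ⟦ c ⟧ (+-assoc p (suc r) (suc k)) ⟨
      ⟦ c ⟧ (h + suc k)                 ≡⟨ ext-ω c (h + suc k) ⟨
      ext (ω c) (h + suc k)             ∎
      where
      pos₁ : ∀ p r k → p + suc r + suc k ≡ suc p + (suc r + k)
      pos₁ = solve-∀
    ...   | inj₂ (l , refl) = begin
      ext (ω c′) (h + suc (suc q + l))            ≡⟨ ext-ω c′ (h + suc (suc q + l)) ⟩
      ⟦ c′ ⟧ (h + suc (suc q + l))                ≡⟨ cong ⟦ c′ ⟧ (pos₁ p q r l) ⟩
      ⟦ c′ ⟧ (suc p + (suc r + (suc q + l)))      ≡⟨ ⟦⟧-after c′ l ⟩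
      suc p + (suc r + (suc q + l))               ≡⟨ pos₁ p q r l ⟨
      h + suc (suc q + l)                         ≡⟨ pos₂ p q r l ⟩
      p + (suc r + (suc (suc q) + l))             ≡⟨ ⟦⟧-after c l ⟨
      ⟦ c ⟧ (p + (suc r + (suc (suc q) + l)))     ≡⟨ cong ⟦ c ⟧ (pos₂ p q r l) ⟨
      ⟦ c ⟧ (h + suc (suc q + l))                 ≡⟨ ext-ω c (h + suc (suc q + l)) ⟨
      ext (ω c) (h + suc (suc q + l))             ∎
      where
      pos₁ : ∀ p q r l → p + suc r + suc (suc q + l) ≡ suc p + (suc r + (suc q + l))
      pos₁ = solve-∀
      pos₂ : ∀ p q r l → p + suc r + suc (suc q + l) ≡ p + (suc r + (suc (suc q) + l))
      pos₂ = solve-∀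

  -- Here h is the last position of the second block. Each value of the first block drops by one,
  -- the lowest to the value that stood at h, while the highest moves to h and is fixed there.
  ω-shift-s : ∀ {m} p q r s (total : p + s + (suc q + r) ≡ m) →
    ω (composition p q r (suc s) (shift-s p q r s total)) ≤ᴮ ω (composition p (suc q) r s total)
  ω-shift-s {m} p q r s total = ≤ᴮ-cycle (suc r) p h V (ω c′) (ω c) (+-monoʳ-≤ p (m≤m+n (suc r) (suc q))) (position<n c (+-monoʳ-< (suc r) (n<1+n (suc q))))
      (λ j _ → +-monoʳ-< p (+-monoʳ-< (suc q) (n<1+n j)))
      (trans (ext-ω c h) (trans (⟦⟧-down c (n<1+n (suc q))) (cong (p +_) (sym (+-identityʳ (suc q))))))
      (λ j j<1+r → trans (ext-ω c (p + j)) (trans (⟦⟧-up c j<1+r) (cong (p +_) (sym (+-suc (suc q) j)))))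
      τ[h]
      (λ j j<1+r → trans (ext-ω c′ (p + j)) (⟦⟧-up c′ j<1+r)) elsewhere
    where
    c c′ : Composition m
    c  = composition p (suc q) r s total
    c′ = composition p q r (suc s) (shift-s p q r s total)
    h : ℕ
    h = p + (suc r + suc q)
    V : ℕ → ℕ
    V j = p + (suc q + j)
    τ[h] : ext (ω c′) h ≡ V (suc r)
    τ[h] = begin
      ext (ω c′) h                          ≡⟨ ext-ω c′ h ⟩
      ⟦ c′ ⟧ h                              ≡⟨ cong (λ y → ⟦ c′ ⟧ (p + (suc r + y))) (+-identityʳ (suc q)) ⟨
      ⟦ c′ ⟧ (p + (suc r + (suc q + 0)))    ≡⟨ ⟦⟧-after c′ 0 ⟩
      p + (suc r + (suc q + 0))             ≡⟨ cong (λ y → p + (suc r + y)) (+-identityʳ (suc q)) ⟩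
      p + (suc r + suc q)                   ≡⟨ cong (p +_) (+-comm (suc r) (suc q)) ⟩
      p + (suc q + suc r)                   ∎
    elsewhere : ∀ x → x ≢ h → x < p ⊎ p + suc r ≤ x → ext (ω c′) x ≡ ext (ω c) x
    elsewhere x x≢h (inj₁ x<p) = trans (ext-ω c′ x) (trans (swapBlocks-before p x<p)
      (sym (trans (ext-ω c x) (swapBlocks-before p x<p))))
    elsewhere x x≢h (inj₂ h≤x) with m≤n⇒∃[o]m+o≡n h≤x
    ... | k , refl with split-at (suc q) k
    ...   | inj₁ k<1+q = begin
      ext (ω c′) (p + suc r + k)        ≡⟨ ext-ω c′ (p + suc r + k) ⟩
      ⟦ c′ ⟧ (p + suc r + k)            ≡⟨ cong ⟦ c′ ⟧ (+-assoc p (suc r) k) ⟩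
      ⟦ c′ ⟧ (p + (suc r + k))          ≡⟨ ⟦⟧-down c′ k<1+q ⟩
      p + k                             ≡⟨ ⟦⟧-down c (<-trans k<1+q (n<1+n _)) ⟨
      ⟦ c ⟧ (p + (suc r + k))           ≡⟨ cong ⟦ c ⟧ (+-assoc p (suc r) k) ⟨
      ⟦ c ⟧ (p + suc r + k)             ≡⟨ ext-ω c (p + suc r + k) ⟨
      ext (ω c) (p + suc r + k)         ∎
    ...   | inj₂ (zero , refl)  = contradiction (trans (+-assoc p (suc r) (suc q + 0)) (cong (λ y → p + (suc r + y)) (+-identityʳ (suc q)))) x≢h
    ...   | inj₂ (suc l , refl) = begin
      ext (ω c′) (p + suc r + (suc q + suc l))        ≡⟨ ext-ω c′ (p + suc r + (suc q + suc l)) ⟩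
      ⟦ c′ ⟧ (p + suc r + (suc q + suc l))            ≡⟨ cong ⟦ c′ ⟧ (+-assoc p (suc r) (suc q + suc l)) ⟩
      ⟦ c′ ⟧ (p + (suc r + (suc q + suc l)))          ≡⟨ ⟦⟧-after c′ (suc l) ⟩
      p + (suc r + (suc q + suc l))                   ≡⟨ pos ⟩
      p + (suc r + (suc (suc q) + l))                 ≡⟨ ⟦⟧-after c l ⟨
      ⟦ c ⟧ (p + (suc r + (suc (suc q) + l)))         ≡⟨ cong ⟦ c ⟧ pos ⟨
      ⟦ c ⟧ (p + (suc r + (suc q + suc l)))           ≡⟨ cong ⟦ c ⟧ (+-assoc p (suc r) (suc q + suc l)) ⟨
      ⟦ c ⟧ (p + suc r + (suc q + suc l))             ≡⟨ ext-ω c (p + suc r + (suc q + suc l)) ⟨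
      ext (ω c) (p + suc r + (suc q + suc l))         ∎
      where
      pos : p + (suc r + (suc q + suc l)) ≡ p + (suc r + (suc (suc q) + l))
      pos = cong (λ y → p + (suc r + y)) (+-suc (suc q) l)

  ≡⇒≤ᴮ : ∀ {m} (c′ c : Composition m) → p c ≡ p c′ → q c ≡ q c′ → r c ≡ r c′ → ω c′ ≤ᴮ ω c
  ≡⇒≤ᴮ c′ c refl refl refl = ≈⇒≤ᴮ {π = ω c′} {ω c} λ i → Fin.toℕ-injective (trans (toℕ-ω c i) (sym (toℕ-ω c′ i)))

  -- The surpluses `d` of q and `e` of r are handed over to p and s one unit at a time. Units of q
  -- move by the two shifts, units of r by their images under inversion. The balance `f + g ≡ d + e`
  -- ensures a recipient for every unit.
  ω-≤ᴮ : ∀ {m} d e f g (c′ c : Composition m) → f + g ≡ d + e →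
    p c′ ≡ f + p c → s c′ ≡ g + s c → q c ≡ d + q c′ → r c ≡ e + r c′ → ω c′ ≤ᴮ ω c
  ω-≤ᴮ zero zero zero zero c′ c _ p≡ s≡ q≡ r≡ = ≡⇒≤ᴮ c′ c (sym p≡) q≡ r≡
  ω-≤ᴮ (suc d) e (suc f) g c′ (composition p _ r s total) fg≡de p≡ s≡ refl r≡ =
    ≤ᴮ-trans {π = ω c′} {ω c₁} (ω-≤ᴮ d e f g c′ c₁ (suc-injective fg≡de) (trans p≡ (sym (+-suc f p))) s≡ refl r≡)
      (ω-shift-p p (d + q c′) r s total)
    where c₁ = composition (suc p) (d + q c′) r s (shift-p p (d + q c′) r s total)
  ω-≤ᴮ (suc d) e zero (suc g) c′ (composition p _ r s total) fg≡de p≡ s≡ refl r≡ =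
    ≤ᴮ-trans {π = ω c′} {ω c₁} (ω-≤ᴮ d e zero g c′ c₁ (suc-injective fg≡de) p≡ (trans s≡ (sym (+-suc g s))) refl r≡)
      (ω-shift-s p (d + q c′) r s total)
    where c₁ = composition p (d + q c′) r (suc s) (shift-s p (d + q c′) r s total)
  ω-≤ᴮ zero (suc e) (suc f) g c′ c@(composition p q _ s total) fg≡de p≡ s≡ q≡ refl =
    ≤ᴮ-trans {π = ω c′} {ω (c₁ ᵀ)} (ω-≤ᴮ zero e f g c′ (c₁ ᵀ) (suc-injective fg≡de) (trans p≡ (sym (+-suc f p))) s≡ q≡ refl)
      (≤ᴮ-flip {π = ω c₁} {ω (c ᵀ)} (ω-shift-p p (e + r c′) q s (Composition.total (c ᵀ))))
    where c₁ = composition (suc p) (e + r c′) q s (shift-p p (e + r c′) q s (Composition.total (c ᵀ)))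
  ω-≤ᴮ zero (suc e) zero (suc g) c′ c@(composition p q _ s total) fg≡de p≡ s≡ q≡ refl =
    ≤ᴮ-trans {π = ω c′} {ω (c₁ ᵀ)} (ω-≤ᴮ zero e zero g c′ (c₁ ᵀ) (suc-injective fg≡de) p≡ (trans s≡ (sym (+-suc g s))) q≡ refl)
      (≤ᴮ-flip {π = ω c₁} {ω (c ᵀ)} (ω-shift-s p (e + r c′) q s (Composition.total (c ᵀ))))
    where c₁ = composition p (e + r c′) q (suc s) (shift-s p (e + r c′) q s (Composition.total (c ᵀ)))

  -- Counting

  length-sum : ∀ {a} {A : Set a} (xs : List A) → length xs ≡ sum (map (λ _ → 1) xs)
  length-sum []       = refl
  length-sum (x ∷ xs) = cong suc (length-sum xs)

  module _ {a ℓ} (S : Setoid a ℓ) where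

    open Setoid S using (Carrier) renaming (_≈_ to _≈ₛ_; sym to ≈ₛ-sym; trans to ≈ₛ-trans)
    open SetoidMembership S using () renaming (_∈_ to _∈ₛ_)
    open SetoidUnique S using () renaming (Unique to Uniqueₛ)

    ∈-─ : ∀ {x z ys} (x∈ys : x ∈ₛ ys) → z ∈ₛ ys → ¬ x ≈ₛ z → z ∈ₛ (ys ─ x∈ys)
    ∈-─ (here x≈y)    (here z≈y)    x≉z = contradiction (≈ₛ-trans x≈y (≈ₛ-sym z≈y)) x≉z
    ∈-─ (here x≈y)    (there z∈ys)  x≉z = z∈ys
    ∈-─ (there x∈ys)  (here z≈y)    x≉z = here z≈y
    ∈-─ (there x∈ys)  (there z∈ys)  x≉z = there (∈-─ x∈ys z∈ys x≉z)

    module _ (f : Carrier → ℕ) (f-cong : ∀ {x y} → x ≈ₛ y → f x ≡ f y) where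

      sum-─ : ∀ {x ys} (x∈ys : x ∈ₛ ys) → sum (map f ys) ≡ f x + sum (map f (ys ─ x∈ys))
      sum-─ {ys = y ∷ ys} (here x≈y) = cong (_+ sum (map f ys)) (sym (f-cong x≈y))
      sum-─ {x} {y ∷ ys} (there x∈ys) = trans (cong (f y +_) (sum-─ x∈ys))
        (x+[y+z]≡y+[x+z] (f y) (f x) (sum (map f (ys ─ x∈ys))))

      -- The entries of `xs` are deleted from `ys` in turn, and uniqueness keeps the later ones
      -- inside what is left. Equality is that of the setoid, as permutations are listed only up to
      -- `_≈_`.
      sum-⊆ : ∀ {xs ys} → Uniqueₛ xs → (∀ {x} → x ∈ₛ xs → x ∈ₛ ys) → sum (map f xs) ≤ sum (map f ys)
      sum-⊆ []               _     = z≤n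
      sum-⊆ {x ∷ xs} {ys} (x∉xs ∷ xs!) xs⊆ys = subst (f x + sum (map f xs) ≤_) (sym (sum-─ x∈ys))
        (+-monoʳ-≤ (f x) (sum-⊆ xs! λ z∈xs → ∈-─ x∈ys (xs⊆ys (there z∈xs))
          λ x≈z → All.All¬⇒¬Any x∉xs (SetoidMembershipₚ.∈-resp-≈ S (≈ₛ-sym x≈z) z∈xs)))
        where
        x∈ys : x ∈ₛ ys
        x∈ys = xs⊆ys (here (Setoid.refl S))

      sum-unique-≡ : ∀ {xs ys} → Uniqueₛ xs → Uniqueₛ ys → (∀ {x} → x ∈ₛ xs → x ∈ₛ ys) → (∀ {x} → x ∈ₛ ys → x ∈ₛ xs) →
        sum (map f xs) ≡ sum (map f ys)
      sum-unique-≡ xs! ys! xs⊆ys ys⊆xs = ≤-antisym (sum-⊆ xs! xs⊆ys) (sum-⊆ ys! ys⊆xs)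

  length-unique-≡ : ∀ {a ℓ} (S : Setoid a ℓ) {xs ys} → SetoidUnique.Unique S xs → SetoidUnique.Unique S ys →
    (∀ {x} → SetoidMembership._∈_ S x xs → SetoidMembership._∈_ S x ys) →
    (∀ {x} → SetoidMembership._∈_ S x ys → SetoidMembership._∈_ S x xs) → length xs ≡ length ys
  length-unique-≡ S {xs} {ys} xs! ys! xs⊆ys ys⊆xs = trans (length-sum xs)
    (trans (sum-unique-≡ S (λ _ → 1) (λ _ → refl) xs! ys! xs⊆ys ys⊆xs) (sym (length-sum ys)))

  sum-concatMap : ∀ {a b} {A : Set a} {B : Set b} (h : B → ℕ) (f : A → List B) xs →
    sum (map h (concatMap f xs)) ≡ sum (map (λ x → sum (map h (f x))) xs)
  sum-concatMap h f []       = refl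
  sum-concatMap h f (x ∷ xs) = begin
    sum (map h (f x ++ concatMap f xs))              ≡⟨ cong sum (map-++ h (f x) (concatMap f xs)) ⟩
    sum (map h (f x) ++ map h (concatMap f xs))      ≡⟨ sum-++ (map h (f x)) (map h (concatMap f xs)) ⟩
    sum (map h (f x)) + sum (map h (concatMap f xs)) ≡⟨ cong (sum (map h (f x)) +_) (sum-concatMap h f xs) ⟩
    sum (map (λ x → sum (map h (f x))) (x ∷ xs))     ∎

  sum-cartesianProductWith : ∀ {a b c} {A : Set a} {B : Set b} {C : Set c} (h : C → ℕ) (f : A → B → C) xs ys →
    sum (map h (cartesianProductWith f xs ys)) ≡ sum (map (λ x → sum (map (λ y → h (f x y)) ys)) xs)
  sum-cartesianProductWith h f []       ys = refl
  sum-cartesianProductWith h f (x ∷ xs) ys = begin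
    sum (map h (map (f x) ys ++ cartesianProductWith f xs ys))
      ≡⟨ cong sum (map-++ h (map (f x) ys) (cartesianProductWith f xs ys)) ⟩
    sum (map h (map (f x) ys) ++ map h (cartesianProductWith f xs ys))
      ≡⟨ sum-++ (map h (map (f x) ys)) _ ⟩
    sum (map h (map (f x) ys)) + sum (map h (cartesianProductWith f xs ys))
      ≡⟨ cong₂ _+_ (cong sum (sym (map-∘ ys))) (sum-cartesianProductWith h f xs ys) ⟩
    sum (map (λ x → sum (map (λ y → h (f x y)) ys)) (x ∷ xs)) ∎

  sum-*ˡ : ∀ {a} {A : Set a} k (h : A → ℕ) xs → k * sum (map h xs) ≡ sum (map (λ x → k * h x) xs)
  sum-*ˡ k h []       = *-zeroʳ k
  sum-*ˡ k h (x ∷ xs) = trans (*-distribˡ-+ k (h x) _) (cong (k * h x +_) (sum-*ˡ k h xs))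

  concatMap-unique : ∀ {a b} {A : Set a} {B : Set b} (f : A → List B) →
    (∀ {x y z} → z ∈ f x → z ∈ f y → x ≡ y) → (∀ x → Unique (f x)) → ∀ {xs} → Unique xs → Unique (concatMap f xs)
  concatMap-unique f f-disjoint f! []           = []
  concatMap-unique {A = A} f f-disjoint f! (_∷_ {x} {xs} x∉xs xs!) = Uniqueₚ.++⁺ (f! x) (concatMap-unique f f-disjoint f! xs!)
    λ (z∈fx , z∈rest) → All.All¬⇒¬Any x∉xs (Any.map (λ z∈fy → f-disjoint z∈fx z∈fy) (∈ₚ.∈-concatMap⁻ f {xs = xs} z∈rest))

  record Split (n : ℕ) : Set where
    constructor split
    field
      left right : ℕ
      left+right : left + right ≡ n
  open Split

  split-≡ : ∀ {n} {x y : Split n} → left x ≡ left y → x ≡ y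
  split-≡ {x = split l r refl} {split l′ r′ eq} refl with +-cancelˡ-≡ l r′ r eq
  split-≡ {x = split l r refl} {split l′ r′ refl} refl | refl = refl

  nthSplit : ∀ n → Fin (suc n) → Split n
  nthSplit n i = split (toℕ i) (n ∸ toℕ i) (m+[n∸m]≡n (Fin.toℕ≤pred[n] i))

  splits : ∀ n → List (Split n)
  splits n = tabulate (nthSplit n)

  splits-unique : ∀ n → Unique (splits n)
  splits-unique n = Uniqueₚ.tabulate⁺ {f = nthSplit n} (λ eq → Fin.toℕ-injective (cong left eq))

  ∈-splits : ∀ {n} (x : Split n) → x ∈ splits n
  ∈-splits {n} x = subst (_∈ splits n) (split-≡ (Fin.toℕ-fromℕ< left<1+n)) (∈ₚ.∈-tabulate⁺ {f = nthSplit n} (fromℕ< left<1+n))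
    where
    left<1+n : left x < suc n
    left<1+n = s≤s (subst (left x ≤_) (left+right x) (m≤m+n (left x) (right x)))

  composition-≡ : ∀ {m} {c c′ : Composition m} → p c ≡ p c′ → q c ≡ q c′ → r c ≡ r c′ → s c ≡ s c′ → c ≡ c′
  composition-≡ refl refl refl refl = cong (composition _ _ _ _) (≡-irrelevant _ _)

  glue : ∀ {m} (x : Split m) → Split (left x) → Split (right x) → Composition m
  glue x y z = composition (left y) (left z) (right z) (right y) (trans (cong₂ _+_ (left+right y) (left+right z)) (left+right x))

  glueAll : ∀ {m} → Split m → List (Composition m)
  glueAll x = cartesianProductWith (glue x) (splits (left x)) (splits (right x))

  -- Ordered by the split of m into p + s and q + r, along which the sums of moments factor.
  compositions : ∀ m → List (Composition m)
  compositions m = concatMap glueAll (splits m)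

  glue-injective : ∀ {m} {x : Split m} {y y′ z z′} → glue x y z ≡ glue x y′ z′ → y ≡ y′ × z ≡ z′
  glue-injective eq = split-≡ (cong p eq) , split-≡ (cong q eq)

  compositions-unique : ∀ m → Unique (compositions m)
  compositions-unique m = concatMap-unique glueAll disjoint
    (λ x → Uniqueₚ.cartesianProductWith⁺ (glue x) glue-injective (splits-unique (left x)) (splits-unique (right x))) (splits-unique m)
    where
    left≡ : ∀ x {c} → c ∈ glueAll x → p c + s c ≡ left x
    left≡ x c∈ with ∈ₚ.∈-cartesianProductWith⁻ (glue x) (splits (left x)) (splits (right x)) c∈
    ... | y , z , _ , _ , refl = left+right y
    disjoint : ∀ {x y c} → c ∈ glueAll x →
      c ∈ glueAll y → x ≡ y
    disjoint {x} {y} c∈x c∈y = split-≡ (trans (sym (left≡ x c∈x)) (left≡ y c∈y))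

  ∈-compositions : ∀ {m} (c : Composition m) → c ∈ compositions m
  ∈-compositions {m} c = ∈ₚ.∈-concatMap⁺ glueAll (Any.map (λ { refl → subst (_∈ glueAll x) (composition-≡ refl refl refl refl)
    (∈ₚ.∈-cartesianProductWith⁺ (glue x) (∈-splits (split (p c) (s c) refl)) (∈-splits (split (q c) (r c) refl))) }) (∈-splits x))
    where
    x : Split m
    x = split (p c + s c) (q c + r c) (total c)

  -- The right-hand side is a Cauchy product: once p + s is chosen, a summand separating (p, s) from
  -- (q, r) is summed independently over both pairs.
  sum-compositions : ∀ m (f h : ℕ → ℕ → ℕ) →
    sum (map (λ c → f (p c) (s c) * h (q c) (r c)) (compositions m)) ≡
    sum (map (λ x → sum (map (λ y → f (left y) (right y)) (splits (left x))) * sum (map (λ z → h (left z) (right z)) (splits (right x)))) (splits m))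
  sum-compositions m f h = trans (sum-concatMap F glueAll (splits m))
    (cong sum (map-cong (λ x → begin
      sum (map F (cartesianProductWith (glue x) (splits (left x)) (splits (right x))))
        ≡⟨ sum-cartesianProductWith F (glue x) (splits (left x)) (splits (right x)) ⟩
      sum (map (λ y → sum (map (λ z → f (left y) (right y) * h (left z) (right z)) (splits (right x)))) (splits (left x)))
        ≡⟨ cong sum (map-cong (λ y → sum-*ˡ (f (left y) (right y)) (λ z → h (left z) (right z)) (splits (right x))) (splits (left x))) ⟨
      sum (map (λ y → f (left y) (right y) * H x) (splits (left x)))
        ≡⟨ cong sum (map-cong (λ y → *-comm (f (left y) (right y)) (H x)) (splits (left x))) ⟩
      sum (map (λ y → H x * f (left y) (right y)) (splits (left x)))
        ≡⟨ sum-*ˡ (H x) (λ y → f (left y) (right y)) (splits (left x)) ⟨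
      H x * sum (map (λ y → f (left y) (right y)) (splits (left x)))
        ≡⟨ *-comm (H x) _ ⟩
      sum (map (λ y → f (left y) (right y)) (splits (left x))) * H x ∎) (splits m)))
    where
    F : Composition m → ℕ
    F c = f (p c) (s c) * h (q c) (r c)
    H : Split m → ℕ
    H x = sum (map (λ z → h (left z) (right z)) (splits (right x)))

  -- The block interchanges below a given one

  lower-total : ∀ {m} p q r s l l′ k k′ d d′ → k + k′ ≡ q → d + d′ ≡ r → l + l′ ≡ k + d → p + s + (q + r) ≡ m → l + p + (l′ + s) + (k′ + d′) ≡ m
  lower-total p q r s l l′ k k′ d d′ refl refl l+l′≡ refl = begin
    l + p + (l′ + s) + (k′ + d′)          ≡⟨ regroup l p l′ s k′ d′ ⟩
    p + s + ((l + l′) + (k′ + d′))        ≡⟨ cong (λ y → p + s + (y + (k′ + d′))) l+l′≡ ⟩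
    p + s + ((k + d) + (k′ + d′))         ≡⟨ cong (p + s +_) (regroup′ k d k′ d′) ⟩
    p + s + ((k + k′) + (d + d′))         ∎
    where
    regroup : ∀ l p l′ s k′ d′ → l + p + (l′ + s) + (k′ + d′) ≡ p + s + ((l + l′) + (k′ + d′))
    regroup = solve-∀
    regroup′ : ∀ k d k′ d′ → (k + d) + (k′ + d′) ≡ (k + k′) + (d + d′)
    regroup′ = solve-∀

  module _ {m} (c : Composition m) where

    -- The left parts of x and y are what q and r give away, the right parts what they keep; z
    -- distributes the total given away over p and s.
    lowerBy : (xy : Split (q c) × Split (r c)) → Split (left (proj₁ xy) + left (proj₂ xy)) → Composition m
    lowerBy (x , y) z = composition (left z + p c) (right x) (right y) (right z + s c)
      (lower-total (p c) (q c) (r c) (s c) (left z) (right z) (left x) (right x) (left y) (right y) (left+right x) (left+right y) (left+right z) (total c))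

    lowersBy : Split (q c) × Split (r c) → List (Composition m)
    lowersBy xy = map (lowerBy xy) (splits (left (proj₁ xy) + left (proj₂ xy)))

    lowers : List (Composition m)
    lowers = concatMap lowersBy (cartesianProduct (splits (q c)) (splits (r c)))

    lowers-unique : Unique lowers
    lowers-unique = concatMap-unique lowersBy disjoint (λ xy → Uniqueₚ.map⁺ (λ eq → split-≡ (+-cancelʳ-≡ (p c) _ _ (cong p eq))) (splits-unique (left (proj₁ xy) + left (proj₂ xy))))
      (Uniqueₚ.cartesianProduct⁺ (splits-unique (q c)) (splits-unique (r c)))
      where
      split-right-≡ : ∀ {n} {x y : Split n} → right x ≡ right y → x ≡ y
      split-right-≡ {x = x} {y} eq = split-≡ (+-cancelʳ-≡ (right x) _ _ (trans (left+right x) (trans (sym (left+right y)) (cong (left y +_) (sym eq)))))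
      disjoint : ∀ {xy xy′ c′} → c′ ∈ lowersBy xy →
        c′ ∈ lowersBy xy′ → xy ≡ xy′
      disjoint {xy} {xy′} c′∈ c′∈′ with ∈ₚ.∈-map⁻ (lowerBy xy) c′∈ | ∈ₚ.∈-map⁻ (lowerBy xy′) c′∈′
      ... | z , _ , c′≡ | z′ , _ , c′≡′ = cong₂ _,_ (split-right-≡ (cong q (trans (sym c′≡) c′≡′))) (split-right-≡ (cong r (trans (sym c′≡) c′≡′)))

    ∈-lowers⁻ : ∀ {c′} → c′ ∈ lowers → ω c′ ≤ᴮ ω c
    ∈-lowers⁻ {c′} c′∈ with Any.satisfied (∈ₚ.∈-concatMap⁻ lowersBy {xs = cartesianProduct (splits (q c)) (splits (r c))} c′∈)
    ... | (x , y) , c′∈map with ∈ₚ.∈-map⁻ (lowerBy (x , y)) c′∈map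
    ...   | z , _ , refl = ω-≤ᴮ (left x) (left y) (left z) (right z) c′ c (left+right z) refl refl (sym (left+right x)) (sym (left+right y))

    ∈-lowers⁺ : ∀ {c′} → c′ ⊑ c → c′ ∈ lowers
    ∈-lowers⁺ {c′} (p≤p′ , s≤s′ , q′≤q , r′≤r) = ∈ₚ.∈-concatMap⁺ lowersBy (Any.map (λ { refl →
        subst (_∈ lowersBy (x , y)) (composition-≡ (m∸n+n≡m p≤p′) refl refl (m∸n+n≡m s≤s′)) (∈ₚ.∈-map⁺ (lowerBy (x , y)) (∈-splits z)) })
        (∈ₚ.∈-cartesianProduct⁺ (∈-splits x) (∈-splits y)))
      where
      x : Split (q c)
      x = split (q c ∸ q c′) (q c′) (m∸n+n≡m q′≤q)
      y : Split (r c)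
      y = split (r c ∸ r c′) (r c′) (m∸n+n≡m r′≤r)
      differences : ∀ f g d e p s q′ r′ → f + p + (g + s) + (q′ + r′) ≡ p + s + ((d + q′) + (e + r′)) → f + g ≡ d + e
      differences f g d e p s q′ r′ eq = +-cancelʳ-≡ (p + s + (q′ + r′)) (f + g) (d + e) (trans (regroup f g p s q′ r′) (trans eq (regroup′ d e p s q′ r′)))
        where
        regroup : ∀ f g p s q′ r′ → f + g + (p + s + (q′ + r′)) ≡ f + p + (g + s) + (q′ + r′)
        regroup = solve-∀
        regroup′ : ∀ d e p s q′ r′ → p + s + ((d + q′) + (e + r′)) ≡ d + e + (p + s + (q′ + r′))
        regroup′ = solve-∀
      z : Split (left x + left y)
      z = split (p c′ ∸ p c) (s c′ ∸ s c) (differences (p c′ ∸ p c) (s c′ ∸ s c) (left x) (left y) (p c) (s c) (q c′) (r c′) (begin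
        p c′ ∸ p c + p c + (s c′ ∸ s c + s c) + (q c′ + r c′)   ≡⟨ cong₂ (λ a b → a + b + (q c′ + r c′)) (m∸n+n≡m p≤p′) (m∸n+n≡m s≤s′) ⟩
        p c′ + s c′ + (q c′ + r c′)                             ≡⟨ trans (total c′) (sym (total c)) ⟩
        p c + s c + (q c + r c)                                 ≡⟨ cong₂ (λ a b → p c + s c + (a + b)) (left+right x) (left+right y) ⟨
        p c + s c + ((q c ∸ q c′ + q c′) + (r c ∸ r c′ + r c′)) ∎))

  ω≤ᴮω⇐⊑ : ∀ {m} {c′ c : Composition m} → c′ ⊑ c → ω c′ ≤ᴮ ω c
  ω≤ᴮω⇐⊑ {c′ = c′} {c} c′⊑c = ∈-lowers⁻ c (∈-lowers⁺ c {c′} c′⊑c)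

  -- With common difference 2 the sum needs no halving. This is why the count below is stated for
  -- twice the length.
  sum-arithmetic : ∀ n a → sum (tabulate {n = suc n} (λ i → a + 2 * toℕ i)) ≡ suc n * (a + n)
  sum-arithmetic zero    a = trans (+-identityʳ _) (sym (+-identityʳ (a + 0)))
  sum-arithmetic (suc n) a = begin
    a + 2 * 0 + sum (tabulate {n = suc n} (λ i → a + 2 * suc (toℕ i)))      ≡⟨ cong (λ x → a + 2 * 0 + sum x) (tabulate-cong {n = suc n} λ i → shift a (toℕ i)) ⟩
    a + 2 * 0 + sum (tabulate {n = suc n} (λ i → 2 + a + 2 * toℕ i))        ≡⟨ cong (a + 2 * 0 +_) (sum-arithmetic n (2 + a)) ⟩
    a + 2 * 0 + suc n * (2 + a + n)                                         ≡⟨ collect n a ⟩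
    suc (suc n) * (a + suc n)                                               ∎
    where
    shift : ∀ a i → a + 2 * suc i ≡ 2 + a + 2 * i
    shift = solve-∀
    collect : ∀ n a → a + 2 * 0 + suc n * (2 + a + n) ≡ suc (suc n) * (a + suc n)
    collect = solve-∀

  sum-splits-arithmetic : ∀ n a → sum (map (λ x → a + 2 * left x) (splits n)) ≡ suc n * (a + n)
  sum-splits-arithmetic n a = trans (cong sum (map-tabulate (nthSplit n) (λ x → a + 2 * left x))) (sum-arithmetic n a)

  -- If q gives away i and r gives away j, there are i + j + 1 ways to distribute them. Twice the
  -- sum of these over i up to q and j up to r consists of two nested arithmetic progressions.
  2*length-lowers : ∀ {m} (c : Composition m) → 2 * length (lowers c) ≡ suc (q c) * suc (r c) * (2 + (q c + r c))
  2*length-lowers c = begin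
    2 * length (lowers c)
      ≡⟨ cong (2 *_) (trans (length-sum (lowers c)) (trans (sum-concatMap (λ _ → 1) (lowersBy c) (cartesianProduct (splits (q c)) (splits (r c))))
           (trans (cong sum (map-cong sizes (cartesianProduct (splits (q c)) (splits (r c))))) (sum-cartesianProductWith (λ (x , y) → suc (left x + left y)) _,_ (splits (q c)) (splits (r c)))))) ⟩
    2 * sum (map (λ x → sum (map (λ y → suc (left x + left y)) (splits (r c)))) (splits (q c)))
      ≡⟨ sum-*ˡ 2 (λ x → sum (map (λ y → suc (left x + left y)) (splits (r c)))) (splits (q c)) ⟩
    sum (map (λ x → 2 * sum (map (λ y → suc (left x + left y)) (splits (r c)))) (splits (q c)))
      ≡⟨ cong sum (map-cong inner (splits (q c))) ⟩
    sum (map (λ x → suc (r c) * (2 + r c + 2 * left x)) (splits (q c)))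
      ≡⟨ sum-*ˡ (suc (r c)) (λ x → 2 + r c + 2 * left x) (splits (q c)) ⟨
    suc (r c) * sum (map (λ x → 2 + r c + 2 * left x) (splits (q c)))
      ≡⟨ cong (suc (r c) *_) (sum-splits-arithmetic (q c) (2 + r c)) ⟩
    suc (r c) * (suc (q c) * (2 + r c + q c))
      ≡⟨ collect (q c) (r c) ⟩
    suc (q c) * suc (r c) * (2 + (q c + r c)) ∎
    where
    sizes : ∀ xy → sum (map (λ _ → 1) (lowersBy c xy)) ≡ suc (left (proj₁ xy) + left (proj₂ xy))
    sizes xy = trans (sym (length-sum (lowersBy c xy)))
      (trans (length-map (lowerBy c xy) (splits (left (proj₁ xy) + left (proj₂ xy)))) (length-tabulate (nthSplit (left (proj₁ xy) + left (proj₂ xy)))))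
    inner : ∀ x → 2 * sum (map (λ y → suc (left x + left y)) (splits (r c))) ≡ suc (r c) * (2 + r c + 2 * left x)
    inner x = begin
      2 * sum (map (λ y → suc (left x + left y)) (splits (r c)))        ≡⟨ sum-*ˡ 2 (λ y → suc (left x + left y)) (splits (r c)) ⟩
      sum (map (λ y → 2 * suc (left x + left y)) (splits (r c)))        ≡⟨ cong sum (map-cong (λ y → double (left x) (left y)) (splits (r c))) ⟩
      sum (map (λ y → 2 * suc (left x) + 2 * left y) (splits (r c)))    ≡⟨ sum-splits-arithmetic (r c) (2 * suc (left x)) ⟩
      suc (r c) * (2 * suc (left x) + r c)                              ≡⟨ cong (suc (r c) *_) (swap-terms (left x) (r c)) ⟩
      suc (r c) * (2 + r c + 2 * left x)                                ∎
      where
      double : ∀ a b → 2 * suc (a + b) ≡ 2 * suc a + 2 * b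
      double = solve-∀
      swap-terms : ∀ a b → 2 * suc a + b ≡ 2 + b + 2 * a
      swap-terms = solve-∀
    collect : ∀ q r → suc r * (suc q * (2 + r + q)) ≡ suc q * suc r * (2 + (q + r))
    collect = solve-∀

  -- Counting and summing over 𝔅

  module _ {n : ℕ} where

    open SetoidMembership (𝔖-setoid n) using () renaming (_∈_ to _∈𝔖_)
    open SetoidUnique (𝔖-setoid n) using () renaming (Unique to Unique𝔖)

    ∈-𝔅⁺ : ∀ {σ} → Bigrassmannian σ → σ ∈𝔖 𝔅 n
    ∈-𝔅⁺ {σ} = SetoidMembershipₚ.∈-filter⁺ (𝔖-setoid n) bigrassmannian?
      (λ {σ} {τ} → bigrassmannian-resp {σ = σ} {τ}) {σ} {𝔖 n} (𝔖-complete n σ)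

    ∈-𝔅⁻ : ∀ {σ} → σ ∈𝔖 𝔅 n → Bigrassmannian σ
    ∈-𝔅⁻ {σ} σ∈ = proj₂ (SetoidMembershipₚ.∈-filter⁻ (𝔖-setoid n) bigrassmannian?
      (λ {σ} {τ} → bigrassmannian-resp {σ = σ} {τ}) {σ} {𝔖 n} σ∈)

    𝔅-unique : Unique𝔖 (𝔅 n)
    𝔅-unique = SetoidUniqueₚ.filter⁺ (𝔖-setoid n) bigrassmannian? {𝔖 n} (𝔖-unique n)

    module _ {P : Permutation′ n → Set} (P? : ∀ σ → Dec (P σ)) (P-resp : ∀ {σ τ} → σ ≈ τ → P σ → P τ) where

      length-filter-𝔅 : ∀ {σs} → Unique𝔖 σs → (∀ {σ} → Bigrassmannian σ → P σ → σ ∈𝔖 σs) →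
        (∀ {σ} → σ ∈𝔖 σs → Bigrassmannian σ × P σ) → length (filter P? (𝔅 n)) ≡ length σs
      length-filter-𝔅 {σs} σs! complete sound = length-unique-≡ (𝔖-setoid n)
        (SetoidUniqueₚ.filter⁺ (𝔖-setoid n) P? {𝔅 n} 𝔅-unique) σs!
        (λ {σ} σ∈ → let σ∈𝔅 , Pσ = SetoidMembershipₚ.∈-filter⁻ (𝔖-setoid n) P? (λ {σ} {τ} → P-resp {σ} {τ}) {σ} {𝔅 n} σ∈
          in complete {σ} (∈-𝔅⁻ {σ} σ∈𝔅) Pσ)
        (λ {σ} σ∈ → let big , Pσ = sound {σ} σ∈
          in SetoidMembershipₚ.∈-filter⁺ (𝔖-setoid n) P? (λ {σ} {τ} → P-resp {σ} {τ}) {σ} {𝔅 n} (∈-𝔅⁺ {σ} big) Pσ)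

    β-cong : {σ τ : Permutation′ n} → σ ≈ τ → β σ ≡ β τ
    β-cong {σ} {τ} σ≈τ = cong length (filter-≐ (_≤ᴮ? σ) (_≤ᴮ? τ)
      ((λ {π} → ≤ᴮ-resp-≈ {π = π} {π} {σ} {τ} (λ _ → refl) σ≈τ) , (λ {π} → ≤ᴮ-resp-≈ {π = π} {π} {τ} {σ} (λ _ → refl) (≈-sym {σ = σ} {τ} σ≈τ))) (𝔅 n))

    α-cong : {σ τ : Permutation′ n} → σ ≈ τ → α σ ≡ α τ
    α-cong {σ} {τ} σ≈τ = cong length (filter-≐ (σ ≤ᴮ?_) (τ ≤ᴮ?_)
      ((λ {π} → ≤ᴮ-resp-≈ {π = σ} {τ} {π} {π} σ≈τ (λ _ → refl)) , (λ {π} → ≤ᴮ-resp-≈ {π = τ} {σ} {π} {π} (≈-sym {σ = σ} {τ} σ≈τ) (λ _ → refl))) (𝔅 n))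

  module _ {m : ℕ} where

    open SetoidMembership (𝔖-setoid (2 + m)) using () renaming (_∈_ to _∈𝔖_)
    open SetoidUnique (𝔖-setoid (2 + m)) using () renaming (Unique to Unique𝔖)

    -- Pointwise equal permutations are comparable in both directions, and `_⊑_` is antisymmetric.
    ω-injective : {c c′ : Composition m} → ω c ≈ ω c′ → c ≡ c′
    ω-injective {c} {c′} eq =
      let p≤ , s≤ , q≤ , r≤ = ω≤ᴮω⇒⊑ c′ c (≈⇒≤ᴮ {π = ω c′} {ω c} eq)
          p≥ , s≥ , q≥ , r≥ = ω≤ᴮω⇒⊑ c c′ (≈⇒≤ᴮ {π = ω c} {ω c′} (≈-sym {σ = ω c} {ω c′} eq))
      in composition-≡ (≤-antisym p≤ p≥) (≤-antisym q≥ q≤) (≤-antisym r≥ r≤) (≤-antisym s≤ s≥)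

    map-ω-unique : ∀ {cs : List (Composition m)} → Unique cs → Unique𝔖 (map ω cs)
    map-ω-unique = SetoidUniqueₚ.map⁺ (setoid (Composition m)) (𝔖-setoid (2 + m)) (λ {c} {c′} → ω-injective {c} {c′})

    ∈-map-ω⁺ : ∀ {c} {cs : List (Composition m)} {σ} → σ ≈ ω c → c ∈ cs → σ ∈𝔖 map ω cs
    ∈-map-ω⁺ {c} {cs} {σ} σ≈ω c∈cs = SetoidMembershipₚ.∈-resp-≈ (𝔖-setoid (2 + m)) {x = ω c} {σ} (≈-sym {σ = σ} {ω c} σ≈ω)
      (SetoidMembershipₚ.∈-map⁺ (setoid (Composition m)) (𝔖-setoid (2 + m)) (λ { refl _ → refl }) c∈cs)

    ∈-map-ω⁻ : ∀ {cs : List (Composition m)} {σ} → σ ∈𝔖 map ω cs → ∃[ c ] c ∈ cs × σ ≈ ω c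
    ∈-map-ω⁻ {cs} {σ} = SetoidMembershipₚ.∈-map⁻ (setoid (Composition m)) (𝔖-setoid (2 + m)) {σ} {cs} {ω}

    sum-𝔅 : (f : Permutation′ (2 + m) → ℕ) → (∀ {σ τ} → σ ≈ τ → f σ ≡ f τ) →
      sum (map f (𝔅 (2 + m))) ≡ sum (map (f ∘ ω) (compositions m))
    sum-𝔅 f f-cong = trans
      (sum-unique-≡ (𝔖-setoid (2 + m)) f (λ {σ} {τ} → f-cong {σ} {τ}) {𝔅 (2 + m)} {map ω (compositions m)}
        𝔅-unique (map-ω-unique (compositions-unique m)) (λ {σ} → to {σ}) (λ {σ} → from {σ}))
      (cong sum (sym (map-∘ (compositions m))))
      where
      to : ∀ {σ} → σ ∈𝔖 𝔅 (2 + m) → σ ∈𝔖 map ω (compositions m)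
      to {σ} σ∈ = let c , σ≈ωc = bigrassmannian⇒ω σ (∈-𝔅⁻ {σ = σ} σ∈) in ∈-map-ω⁺ {c} {σ = σ} σ≈ωc (∈-compositions c)
      from : ∀ {σ} → σ ∈𝔖 map ω (compositions m) → σ ∈𝔖 𝔅 (2 + m)
      from {σ} σ∈ = let c , _ , σ≈ωc = ∈-map-ω⁻ {compositions m} {σ} σ∈ in
        ∈-𝔅⁺ {σ = σ} (bigrassmannian-resp {σ = ω c} {σ} (≈-sym {σ = σ} {ω c} σ≈ωc) (ω-bigrassmannian c))

    length-filter-ω : {P : Permutation′ (2 + m) → Set} (P? : ∀ σ → Dec (P σ)) → (∀ {σ τ} → σ ≈ τ → P σ → P τ) →
      ∀ cs → Unique cs → (∀ {c} → P (ω c) → c ∈ cs) → (∀ {c} → c ∈ cs → P (ω c)) →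
      length (filter P? (𝔅 (2 + m))) ≡ length cs
    length-filter-ω {P} P? P-resp cs cs! complete sound = trans
      (length-filter-𝔅 P? (λ {σ} {τ} → P-resp {σ} {τ}) {map ω cs} (map-ω-unique cs!) (λ {σ} → to {σ}) (λ {σ} → from {σ})) (length-map ω cs)
      where
      to : ∀ {σ} → Bigrassmannian σ → P σ → σ ∈𝔖 map ω cs
      to {σ} big Pσ = let c , σ≈ωc = bigrassmannian⇒ω σ big in ∈-map-ω⁺ {c} {σ = σ} σ≈ωc (complete (P-resp {σ} {ω c} σ≈ωc Pσ))
      from : ∀ {σ} → σ ∈𝔖 map ω cs → Bigrassmannian σ × P σ
      from {σ} σ∈ =
        let c , c∈cs , σ≈ωc = ∈-map-ω⁻ {cs} {σ} σ∈
            ωc≈σ = ≈-sym {σ = σ} {ω c} σ≈ωc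
        in bigrassmannian-resp {σ = ω c} {σ} ωc≈σ (ω-bigrassmannian c) , P-resp {ω c} {σ} ωc≈σ (sound c∈cs)

    2*β : (c : Composition m) → 2 * β (ω c) ≡ suc (q c) * suc (r c) * (2 + (q c + r c))
    2*β c = trans (cong (2 *_) (length-filter-ω (_≤ᴮ? ω c) (λ {π} {ρ} π≈ρ → ≤ᴮ-resp-≈ {π = π} {ρ} {ω c} {ω c} π≈ρ (λ _ → refl))
      (lowers c) (lowers-unique c) (λ {c′} le → ∈-lowers⁺ c {c′} (ω≤ᴮω⇒⊑ c′ c le)) (∈-lowers⁻ c))) (2*length-lowers c)

    -- Exchanging the roles of (p, s) and (q, r) reverses the order.
    dual : Composition m → Composition m
    dual (composition p q r s total) = composition q p s r (trans (+-comm (q + r) (p + s)) total)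

    2*α : (c : Composition m) → 2 * α (ω c) ≡ suc (p c) * suc (s c) * (2 + (p c + s c))
    2*α c = trans (cong (2 *_) (trans (length-filter-ω (ω c ≤ᴮ?_) (λ {π} {ρ} π≈ρ → ≤ᴮ-resp-≈ {π = ω c} {ω c} {π} {ρ} (λ _ → refl) π≈ρ)
        (map dual (lowers (dual c))) (Uniqueₚ.map⁺ dual-injective (lowers-unique (dual c))) complete sound) (length-map dual (lowers (dual c)))))
      (2*length-lowers (dual c))
      where
      dual-injective : ∀ {c c′} → dual c ≡ dual c′ → c ≡ c′
      dual-injective eq = composition-≡ (cong q eq) (cong p eq) (cong s eq) (cong r eq)
      dual-dual : ∀ c → dual (dual c) ≡ c
      dual-dual c = composition-≡ refl refl refl refl
      dual-⊑ : ∀ {c c′} → c ⊑ c′ → dual c′ ⊑ dual c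
      dual-⊑ (p≤ , s≤ , q≤ , r≤) = q≤ , r≤ , p≤ , s≤
      complete : ∀ {c′} → ω c ≤ᴮ ω c′ → c′ ∈ map dual (lowers (dual c))
      complete {c′} le = subst (_∈ map dual (lowers (dual c))) (dual-dual c′)
        (∈ₚ.∈-map⁺ dual (∈-lowers⁺ (dual c) {dual c′} (dual-⊑ {c} {c′} (ω≤ᴮω⇒⊑ c c′ le))))
      sound : ∀ {c′} → c′ ∈ map dual (lowers (dual c)) → ω c ≤ᴮ ω c′
      sound c′∈ with ∈ₚ.∈-map⁻ dual c′∈
      ... | d , d∈ , refl = subst (λ c → ω c ≤ᴮ ω (dual d)) (dual-dual c)
        (ω≤ᴮω⇐⊑ {c′ = dual (dual c)} {dual d} (dual-⊑ {d} {dual c} (ω≤ᴮω⇒⊑ d (dual c) (∈-lowers⁻ (dual c) d∈))))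

-- Comparison of the moment with the coefficient

open import Data.Fin.Base as Fin using (Fin; toℕ)
open import Data.Integer.Base using (+_)
open import Data.List.Base using (map; tabulate)
open import Data.List.Properties using (map-cong; map-tabulate)
open import Data.Nat.Base as ℕ using (ℕ; zero; suc; _+_; _*_; _∸_; _^_; _≤_; z≤n; s≤s; _!)
open import Data.Nat.ListAction using (sum)
import Data.Nat.Properties as ℕ
open import Data.Rational.Base as ℚ using (ℚ; _/_)
import Data.Rational.Properties as ℚ
open import Data.Rational.Solver using (module +-*-Solver)
open import Algebra.Properties.CommutativeSemigroup ℕ.*-commutativeSemigroup using () renaming (interchange to ℕ*-interchange)
open import Algebra.Properties.Semiring.Sum (CommutativeRing.semiring ℚ.+-*-commutativeRing) using () renaming (sum to ∑)
open import Defs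
open RationalEmbedding
open PowerSeries
open BruhatOrder
open Composition
open Split
open ≡-Reasoning

ι-sum : ∀ {n} (h : Fin n → ℕ) → ι (sum (tabulate h)) ≡ ∑ (ι ∘ h)
ι-sum {zero}  h = refl
ι-sum {suc n} h = trans (ι-+ (h Fin.zero) (sum (tabulate (h ∘ Fin.suc)))) (cong (λ x → ι (h Fin.zero) ℚ.+ x) (ι-sum (h ∘ Fin.suc)))

ι-sum-splits : ∀ n (h : ℕ → ℕ → ℕ) → ι (sum (map (λ x → h (left x) (right x)) (splits n))) ≡ ∑≤ n (λ i → ι (h i (n ∸ i)))
ι-sum-splits n h = trans (cong (ι ∘ sum) (map-tabulate (nthSplit n) (λ x → h (left x) (right x)))) (ι-sum {suc n} (λ i → h (toℕ i) (n ∸ toℕ i)))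

-- The k-th power of 2 α at (p, s), and of 2 β at (q, r).
W : ℕ → ℕ → ℕ → ℕ
W k x y = (suc x * suc y * (2 + (x + y))) ^ k

[k!]*U : ∀ k i → ι (k !) ℚ.* U k i ≡ ι (sum (map (λ x → W k (left x) (right x)) (splits i)))
[k!]*U k i = begin
  ι (k !) ℚ.* (1/ k ! ℚ.* V)                    ≡⟨ solve 3 (λ a b c → a :* (b :* c) := b :* a :* c) refl (ι (k !)) (1/ k !) V ⟩
  1/ k ! ℚ.* ι (k !) ℚ.* V                      ≡⟨ cong (ℚ._* V) (1/!-* k) ⟩
  ℚ.1ℚ ℚ.* V                                    ≡⟨ ℚ.*-identityˡ V ⟩
  V                                             ≡⟨ ∑≤-cong-≤ i (λ p p≤i → cong (λ y → ι ((suc p * suc (i ∸ p) * (2 + y)) ^ k)) (ℕ.m+[n∸m]≡n p≤i)) ⟨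
  ∑≤ i (λ p → ι (W k p (i ∸ p)))                ≡⟨ ι-sum-splits i (W k) ⟨
  ι (sum (map (λ x → W k (left x) (right x)) (splits i)))    ∎
  where
  open +-*-Solver using (solve; _:*_; _:=_)
  V : ℚ
  V = ∑≤ i (λ p → ι ((suc p * suc (i ∸ p) * suc (suc i)) ^ k))

-- The Cauchy product over the splits of m is the product of series in t; k! and ℓ! clear the
-- factors 1 / k! and 1 / ℓ! in `U`.
ι-sum-compositions : ∀ k ℓ m → ι (sum (map (λ c → W k (p c) (s c) * W ℓ (q c) (r c)) (compositions m))) ≡ ι (k ! * ℓ !) ℚ.* (U k ⊗ U ℓ) m
ι-sum-compositions k ℓ m = begin
  ι (sum (map (λ c → W k (p c) (s c) * W ℓ (q c) (r c)) (compositions m)))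
    ≡⟨ cong ι (sum-compositions m (W k) (W ℓ)) ⟩
  ι (sum (map (λ x → T k (left x) * T ℓ (right x)) (splits m)))
    ≡⟨ ι-sum-splits m (λ x y → T k x * T ℓ y) ⟩
  ∑≤ m (λ i → ι (T k i * T ℓ (m ∸ i)))
    ≡⟨ ∑≤-cong m summand ⟩
  ∑≤ m (λ i → ι (k ! * ℓ !) ℚ.* (U k i ℚ.* U ℓ (m ∸ i)))
    ≡⟨ *-∑≤ m (ι (k ! * ℓ !)) (λ i → U k i ℚ.* U ℓ (m ∸ i)) ⟨
  ι (k ! * ℓ !) ℚ.* (U k ⊗ U ℓ) m ∎
  where
  open +-*-Solver using (solve; _:*_; _:=_)
  T : ℕ → ℕ → ℕ
  T k i = sum (map (λ x → W k (left x) (right x)) (splits i))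
  summand : ∀ i → ι (T k i * T ℓ (m ∸ i)) ≡ ι (k ! * ℓ !) ℚ.* (U k i ℚ.* U ℓ (m ∸ i))
  summand i = begin
    ι (T k i * T ℓ (m ∸ i))                                     ≡⟨ ι-* (T k i) (T ℓ (m ∸ i)) ⟩
    ι (T k i) ℚ.* ι (T ℓ (m ∸ i))                               ≡⟨ cong₂ ℚ._*_ ([k!]*U k i) ([k!]*U ℓ (m ∸ i)) ⟨
    (ι (k !) ℚ.* U k i) ℚ.* (ι (ℓ !) ℚ.* U ℓ (m ∸ i))
      ≡⟨ solve 4 (λ a b c d → (a :* b) :* (c :* d) := (a :* c) :* (b :* d)) refl (ι (k !)) (U k i) (ι (ℓ !)) (U ℓ (m ∸ i)) ⟩
    (ι (k !) ℚ.* ι (ℓ !)) ℚ.* (U k i ℚ.* U ℓ (m ∸ i))           ≡⟨ cong (ℚ._* (U k i ℚ.* U ℓ (m ∸ i))) (ι-* (k !) (ℓ !)) ⟨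
    ι (k ! * ℓ !) ℚ.* (U k i ℚ.* U ℓ (m ∸ i))                   ∎

2^*sum-𝔅 : ∀ k ℓ m → 2 ^ (k + ℓ) * sum (map (λ ω → α ω ^ k * β ω ^ ℓ) (𝔅 (2 + m))) ≡
  sum (map (λ c → W k (p c) (s c) * W ℓ (q c) (r c)) (compositions m))
2^*sum-𝔅 k ℓ m = begin
  2 ^ (k + ℓ) * sum (map (λ ω → α ω ^ k * β ω ^ ℓ) (𝔅 (2 + m)))
    ≡⟨ cong (2 ^ (k + ℓ) *_) (sum-𝔅 {m} (λ ω → α ω ^ k * β ω ^ ℓ) (λ {σ} {τ} σ≈τ → cong₂ (λ x y → x ^ k * y ^ ℓ) (α-cong {σ = σ} {τ} σ≈τ) (β-cong {σ = σ} {τ} σ≈τ))) ⟩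
  2 ^ (k + ℓ) * sum (map (λ c → α (ω c) ^ k * β (ω c) ^ ℓ) (compositions m))
    ≡⟨ sum-*ˡ (2 ^ (k + ℓ)) (λ c → α (ω c) ^ k * β (ω c) ^ ℓ) (compositions m) ⟩
  sum (map (λ c → 2 ^ (k + ℓ) * (α (ω c) ^ k * β (ω c) ^ ℓ)) (compositions m))
    ≡⟨ cong sum (map-cong powers (compositions m)) ⟩
  sum (map (λ c → W k (p c) (s c) * W ℓ (q c) (r c)) (compositions m)) ∎
  where
  -- The power 2^(k+ℓ) gives each of the k factors α and the ℓ factors β the 2 with which they were
  -- counted.
  distribute : ∀ x y → 2 ^ (k + ℓ) * (x ^ k * y ^ ℓ) ≡ (2 * x) ^ k * (2 * y) ^ ℓ
  distribute x y = begin
    2 ^ (k + ℓ) * (x ^ k * y ^ ℓ)             ≡⟨ cong (_* (x ^ k * y ^ ℓ)) (ℕ.^-distribˡ-+-* 2 k ℓ) ⟩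
    2 ^ k * 2 ^ ℓ * (x ^ k * y ^ ℓ)           ≡⟨ ℕ*-interchange (2 ^ k) (2 ^ ℓ) (x ^ k) (y ^ ℓ) ⟩
    2 ^ k * x ^ k * (2 ^ ℓ * y ^ ℓ)           ≡⟨ cong₂ _*_ (ℕ^-distrib-* 2 x k) (ℕ^-distrib-* 2 y ℓ) ⟨
    (2 * x) ^ k * (2 * y) ^ ℓ                 ∎
  powers : ∀ c → 2 ^ (k + ℓ) * (α (ω c) ^ k * β (ω c) ^ ℓ) ≡ W k (p c) (s c) * W ℓ (q c) (r c)
  powers c = trans (distribute (α (ω c)) (β (ω c))) (cong₂ (λ x y → x ^ k * y ^ ℓ) (2*α c) (2*β c))

-- Both sides are multiplied by `M * B`. In the application `M` is the power of 2 and `B` the number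
-- of bigrassmannian permutations.
/-≡ : ∀ {S B M N : ℕ} {C : ℚ} .{{_ : ℕ.NonZero B}} .{{_ : ℕ.NonZero (M * B)}} → ι (M * S) ≡ ι N ℚ.* C → + S / B ≡ + N / (M * B) ℚ.* C
/-≡ {S} {B} {M} {N} {C} eq = *-ι-cancelʳ (M * B) (begin
  + S / B ℚ.* ι (M * B)                  ≡⟨ cong (λ x → + S / B ℚ.* x) (ι-* M B) ⟩
  + S / B ℚ.* (ι M ℚ.* ι B)              ≡⟨ solve 3 (λ a b c → a :* (b :* c) := b :* (a :* c)) refl (+ S / B) (ι M) (ι B) ⟩
  ι M ℚ.* (+ S / B ℚ.* ι B)              ≡⟨ cong (λ x → ι M ℚ.* x) (/-*-ι S B) ⟩
  ι M ℚ.* ι S                            ≡⟨ ι-* M S ⟨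
  ι (M * S)                              ≡⟨ eq ⟩
  ι N ℚ.* C                              ≡⟨ cong (ℚ._* C) (/-*-ι N (M * B)) ⟨
  + N / (M * B) ℚ.* ι (M * B) ℚ.* C      ≡⟨ solve 3 (λ a b c → a :* b :* c := a :* c :* b) refl (+ N / (M * B)) (ι (M * B)) C ⟩
  + N / (M * B) ℚ.* C ℚ.* ι (M * B)      ∎)
  where open +-*-Solver using (solve; _:*_; _:=_)

theorem1p3 : ∀ (k ℓ n : ℕ) (2≤n : 2 ≤ n) →
    let instance
          _ = 𝔟≢0 2≤n
          _ = 2^m*𝔟≢0 (k + ℓ) 2≤n
    in
    𝔼 n (λ ω → α ω ^ k * β ω ^ ℓ) ≡
      + (k ! * ℓ !) / (2 ^ (k + ℓ) * 𝔟 n) ℚ.*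
      ([t^ n + 2 u^ k v^ ℓ ]
        ((g k ∘ₛ (t *ₛ exp ((1ₛ -ₛ t) *ₛ u)) -ₛ 𝟏[ k ≡0]) ^ₛ 2
          *ₛ (g ℓ ∘ₛ (t *ₛ exp ((1ₛ -ₛ t) *ₛ v)) -ₛ 𝟏[ ℓ ≡0]) ^ₛ 2
          /ₛ (1ₛ -ₛ t) ^ₛ (k + ℓ)))
theorem1p3 k ℓ (suc (suc m)) 2≤n@(s≤s (s≤s z≤n)) = /-≡ {S} {𝔟 (2 + m)} {2 ^ (k + ℓ)} {k ! * ℓ !} {{𝔟≢0 2≤n}} {{2^m*𝔟≢0 (k + ℓ) 2≤n}} (begin
    ι (2 ^ (k + ℓ) * S)                                                                    ≡⟨ cong ι (2^*sum-𝔅 k ℓ m) ⟩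
    ι (sum (map (λ c → W k (p c) (s c) * W ℓ (q c) (r c)) (compositions m)))               ≡⟨ ι-sum-compositions k ℓ m ⟩
    ι (k ! * ℓ !) ℚ.* (U k ⊗ U ℓ) m                                                        ≡⟨ cong (λ x → ι (k ! * ℓ !) ℚ.* x) (generating-function-coefficient k ℓ m) ⟨
    _                                                                                      ∎)
  where
  S : ℕ
  S = sum (map (λ ω → α ω ^ k * β ω ^ ℓ) (𝔅 (2 + m)))
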